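{- Let $a,b,c,a',b',c'$ be non-negative integers, let $X,Y\subseteq[a+b]$ and $X',Y'\subseteq[a'+b']$, and suppose that: (1) $(X',Y')$ is a shuffling of $(X,Y)$, i.e. $X\cup Y=X'\cup Y'$ and $X\cap Y=X'\cap Y'$; (2) $a+b=a'+b'$ and $b+c=b'+c'$; (3) $a+b\ge c$ and $a'+b'\ge c'$; (4) $b-|X|=c-|Y|=b'-|X'|=c'-|Y'|\ge 0$, and $b-|X|\le |[a+b]\setminus(X\cup Y)|$. Then, with $q$ an indeterminate, $$\frac{M(V_{a',b',c'}(X',Y');q)}{M(V_{a,b,c}(X,Y);q)}=q^{\alpha}\,\frac{\Delta_{1,q}([b])\,\Delta_{1,q}([c])}{\Delta_{1,q}([b'])\,\Delta_{1,q}([c'])}\cdot\frac{\Delta_{1,q}(X')\,\Delta_{1,q}(Y')}{\Delta_{1,q}(X)\,\Delta_{1,q}(Y)},$$ where $$\alpha=\Big[\sum_{i'\in X'}i'-(b'+c')\sum_{j'\in Y'}j'-\tfrac{b'(b'+1)}{2}+(a'+b'+1)(b'+1)c'-\tfrac{(b'+1)c'(c'+1)}{2}+\tfrac{(a'+b'+1)c'(c'-1)}{2}\Big]$$ $$\qquad-\Big[\sum_{i\in X}i-(b+c)\sum_{j\in Y}j-\tfrac{b(b+1)}{2}+(a+b+1)(b+1)c-\tfrac{(b+1)c(c+1)}{2}+\tfrac{(a+b+1)c(c-1)}{2}\Big].$$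
   Context: Work on the triangular lattice drawn so that one family of lattice lines is horizontal. A lozenge is the union of two unit triangles sharing an edge; a lozenge tiling of a region is a set of lozenges covering it without overlap. There are three kinds of lozenges: a vertical-lozenge consists of an up-pointing unit triangle and the down-pointing unit triangle directly below it sharing its horizontal base; a right-lozenge consists of an up-pointing unit triangle and the down-pointing unit triangle immediately to its right (so it is a parallelogram with horizontal top and bottom sides, the top side shifted half a unit to the right relative to the bottom side); a left-lozenge consists of an up-pointing unit triangle and the down-pointing unit triangle immediately to its left. For a bounded region $G$, give each right-lozenge the weight $q^k$, where $k\sqrt3/2$ is the distance between the bottom (horizontal) side of the lozenge and the highest horizontal lattice line meeting the closure of $G$; give weight $1$ to all vertical- and left-lozenges. The weight of a tiling is the product of the weights of its lozenges, and $M(G;q)$ is the sum of the weights of all lozenge tilings of $G$. $[n]=\{1,2,\dots,n\}$. For non-negative integers $a,b,c$ with $c\le a+b$, $V_{a,b,c}$ is the hexagon on the lattice with side lengths $a,b,c,a+b-c,c,b$ in clockwise order starting from the (horizontal) top side. Its horizontal diagonal $\ell$ joins its leftmost and rightmost vertices (at depth $b$ below the top side) and has length $a+b$; label the unit segments of $\ell$ from left to right by $1,\dots,a+b$. For $X,Y\subseteq[a+b]$, $V_{a,b,c}(X,Y)$ is obtained from $V_{a,b,c}$ by removing the up-pointing unit triangles whose bases are the unit segments of $\ell$ labeled by elements of $X$, and the down-pointing unit triangles whose (top) bases are the unit segments of $\ell$ labeled by elements of $Y$. For a positive integer $n$, $[n]_q=\frac{1-q^n}{1-q}$. For a finite set $S$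 of positive integers, $\Delta_{1,q}(S)=\prod_{s,s'\in S,\ s<s'}([s']_q-[s]_q)$ (empty product $=1$). -}

module Defs where

open import Data.Bool using (Bool; true; false; if_then_else_; _∧_; not)
open import Data.Nat as ℕ using (ℕ; zero; suc; _∸_; _≡ᵇ_; _%_)
open import Data.Nat.DivMod using (_/_)
open import Data.Integer as ℤ using (ℤ; +_; _⊓_)
open import Data.List using (List; []; _∷_; _++_; map; concatMap; upTo; foldr; length)
open import Data.Nat.ListAction using (sum)
open import Data.Product using (_×_; _,_; proj₁; proj₂)
open import Data.Product.Properties using (≡-dec)
open import Data.Vec using (Vec; []; _∷_)
open import Data.Fin.Subset using (Subset)
open import Relation.Nullary.Decidable using (⌊_⌋)
open import Algebra.Bundles using (CommutativeRing)

-- Triangular lattice.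
-- Horizontal lattice lines are indexed by r ∈ ℤ, increasing DOWNWARDS;
-- the strip r lies between line r (top) and line r+1 (bottom).
-- A unit triangle is (r , j): it lies in strip r and j is twice the
-- x-coordinate of its horizontal midpoint.  It is up-pointing iff r + j
-- is even, down-pointing iff r + j is odd.
--   up (r , j) has base on line r+1; the down triangle below it is (r+1 , j);
--   its right neighbour is the down triangle (r , j+1), its left (r , j-1).

Tri : Set
Tri = ℤ × ℤ

filter : ∀ {A : Set} → (A → Bool) → List A → List A
filter p []       = []
filter p (x ∷ xs) = if p x then x ∷ filter p xs else filter p xs

any : ∀ {A : Set} → (A → Bool) → List A → Bool
any p = foldr (λ x b → p x Data.Bool.∨ b) false
  where import Data.Bool

all : ∀ {A : Set} → (A → Bool) → List A → Bool
all p = foldr (λ x b → p x ∧ b) true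

_≟T_ = ≡-dec ℤ._≟_ ℤ._≟_

_∈ᵇ_ : Tri → List Tri → Bool
t ∈ᵇ G = any (λ u → ⌊ t ≟T u ⌋) G

isUp : Tri → Bool
isUp (r , j) = (ℤ.∣ r ℤ.+ j ∣ % 2) ≡ᵇ 0

data Kind : Set where
  vert right left : Kind

-- a lozenge is given by its kind and its up-pointing triangle
Lozenge : Set
Lozenge = Kind × Tri

partner : Lozenge → Tri
partner (vert  , (r , j)) = (r ℤ.+ + 1 , j)
partner (right , (r , j)) = (r , j ℤ.+ + 1)
partner (left  , (r , j)) = (r , j ℤ.- + 1)

covers : Lozenge → Tri → Bool
covers L t = ⌊ t ≟T proj₂ L ⌋ Data.Bool.∨ ⌊ t ≟T partner L ⌋
  where import Data.Bool

lozengesIn : List Tri → List Lozenge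
lozengesIn G = filter (λ L → partner L ∈ᵇ G)
  (concatMap (λ t → if isUp t then (vert , t) ∷ (right , t) ∷ (left , t) ∷ [] else []) G)

sublists : ∀ {A : Set} → List A → List (List A)
sublists []       = [] ∷ []
sublists (x ∷ xs) = sublists xs ++ map (x ∷_) (sublists xs)

-- S is a lozenge tiling of G: every triangle of G is covered by exactly
-- one lozenge of S (lozenges of S are taken among those contained in G)
isTiling : List Tri → List Lozenge → Bool
isTiling G S = all (λ t → length (filter (λ L → covers L t) S) ≡ᵇ 1) G

tilings : List Tri → List (List Lozenge)
tilings G = filter (isTiling G) (sublists (lozengesIn G))

-- index of the highest horizontal lattice line meeting the closure of G
topLine : List Tri → ℤ
topLine []             = + 0
topLine ((r , _) ∷ ts) = foldr (λ t m → proj₁ t ⊓ m) r ts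

-- The regions V_{a,b,c}(X,Y).
-- The top side of the hexagon lies on line 0, its left endpoint has x = 0.
-- Strip r (0 ≤ r < b) contains the triangles with -r ≤ j ≤ 2a + r;
-- strip r (b ≤ r < b + c) contains those with r - 2b + 1 ≤ j ≤ 2a + 2b - r - 1.
-- ℓ is line b; its unit segment labelled i (1 ≤ i ≤ a+b) has midpoint
-- j = 2i - 1 - b; the up triangle on it is (b-1 , 2i-1-b), the down
-- triangle below it is (b , 2i-1-b).

rangeℤ : ℤ → ℕ → List ℤ
rangeℤ lo len = map (λ k → lo ℤ.+ + k) (upTo len)

hexRow : ℕ → ℕ → ℕ → ℕ → List Tri
hexRow a b c r with r ℕ.<ᵇ b
... | true  = map (λ j → (+ r , j)) (rangeℤ (ℤ.- + r) (2 ℕ.* a ℕ.+ 2 ℕ.* r ℕ.+ 1))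
... | false = map (λ j → (+ r , j))
                (rangeℤ (+ r ℤ.- + (2 ℕ.* b) ℤ.+ + 1)
                        ((2 ℕ.* a ℕ.+ 4 ℕ.* b) ∸ (2 ℕ.* r ℕ.+ 1)))

hexagon : ℕ → ℕ → ℕ → List Tri
hexagon a b c = concatMap (hexRow a b c) (upTo (b ℕ.+ c))

labelMid : ℕ → ℕ → ℤ
labelMid b i = + (2 ℕ.* i) ℤ.- + 1 ℤ.- + b

V : ℕ → ℕ → ℕ → List ℕ → List ℕ → List Tri
V a b c X Y = filter (λ t → not (t ∈ᵇ removed)) (hexagon a b c)
  where
  removed : List Tri
  removed = map (λ i → (+ b ℤ.- + 1 , labelMid b i)) X
         ++ map (λ i → (+ b , labelMid b i)) Y

-- elements (labels 1..n, increasing) of a subset of [n]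
labels : ∀ {n} → Subset n → List ℕ
labels []          = []
labels (s ∷ p) = (if s then 1 ∷ [] else []) ++ map suc (labels p)

range1 : ℕ → List ℕ
range1 n = map suc (upTo n)

-- Exponents.  The bracket in α for (a,b,c,X,Y) equals P - N with
--   P = Σ_{i∈X} i + (a+b+1)(b+1)c + (a+b+1)c(c-1)/2
--   N = (b+c) Σ_{j∈Y} j + b(b+1)/2 + (b+1)c(c+1)/2
expP : ℕ → ℕ → ℕ → List ℕ → List ℕ → ℕ
expP a b c X Y = sum X ℕ.+ (a ℕ.+ b ℕ.+ 1) ℕ.* (b ℕ.+ 1) ℕ.* c
                 ℕ.+ ((a ℕ.+ b ℕ.+ 1) ℕ.* c ℕ.* (c ∸ 1)) / 2

expN : ℕ → ℕ → ℕ → List ℕ → List ℕ → ℕ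
expN a b c X Y = (b ℕ.+ c) ℕ.* sum Y ℕ.+ (b ℕ.* (b ℕ.+ 1)) / 2
                 ℕ.+ ((b ℕ.+ 1) ℕ.* c ℕ.* (c ℕ.+ 1)) / 2

module RingDefs {ℓ₁ ℓ₂} (R : CommutativeRing ℓ₁ ℓ₂) where
  open CommutativeRing R

  pow : Carrier → ℕ → Carrier
  pow x zero    = 1#
  pow x (suc n) = x * pow x n

  sumR : List Carrier → Carrier
  sumR = foldr _+_ 0#

  prodR : List Carrier → Carrier
  prodR = foldr _*_ 1#

  qint : Carrier → ℕ → Carrier
  qint q n = sumR (map (pow q) (upTo n))

  -- Δ_{1,q}(S) for S given as a strictly increasing list
  Δ : Carrier → List ℕ → Carrier
  Δ q []       = 1#
  Δ q (s ∷ ss) = prodR (map (λ s' → qint q s' - qint q s) ss) * Δ q ss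

  wt : Carrier → List Tri → Lozenge → Carrier
  wt q G (right , (r , j)) = pow q ℤ.∣ (r ℤ.+ + 1) ℤ.- topLine G ∣
  wt q G (vert  , _)       = 1#
  wt q G (left  , _)       = 1#

  M : Carrier → List Tri → Carrier
  M q G = sumR (map (λ S → prodR (map (wt q G) S)) (tilings G))

{-# OPTIONS --safe #-}
module Submission where

-- Cut a tiling along ℓ and let Z be the set of labels of the vertical lozenges crossing ℓ, so that M is the sum over Z
-- of (tilings above with dents X ∪ Z) × (tilings below with dents Y ∪ Z).  A strip of the lattice is a path of
-- triangles, whose tiling is unique and exists iff the dents of its two sides interlace.  Hence each half satisfies a
-- recursion summing over interlacing sets.  It is solved by determinants: up to powers of q the solution is the
-- q-Vandermonde product of the set of dents, divided by that of [b] or [c].  In the product for X ∪ Z and Y ∪ Z the factors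
-- involving Z depend on the multiset X + Y only, hence are the same for (X′ , Y′), and this holds for the powers of
-- q as well.  The rows of the determinants are chosen so that no power of q ever has to be cancelled: R is arbitrary.

open import Defs
open import Algebra.Bundles using (CommutativeRing; CommutativeMonoid)
open import Data.Bool using (Bool; true; false; if_then_else_; _∧_; _∨_; not)
import Data.Bool.Properties as Boolₚ
open import Data.Empty using (⊥-elim)
open import Data.Fin using (Fin; zero; suc; toℕ; inject₁)
import Data.Fin.Properties as Finₚ
open import Data.Fin.Subset using (Subset; ⊥; ⊤; _∪_; _∩_) renaming (∣_∣ to size)
open import Data.Integer as ℤ using (ℤ; +_; -[1+_])
import Data.Integer.Properties as ℤₚ
open import Data.Integer.Tactic.RingSolver using (solve-∀)
open import Data.List using (List; []; _∷_; _++_; map; concatMap; upTo; applyUpTo; foldr; length)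
import Data.List.Properties as Listₚ
open import Data.List.Membership.Propositional using (_∈_; _∉_; find; lose)
open import Data.List.Membership.Propositional.Properties
open import Data.List.Relation.Unary.All as All using (All; []; _∷_)
import Data.List.Relation.Unary.All.Properties as Allₚ
open import Data.List.Relation.Unary.AllPairs using (AllPairs; []; _∷_)
import Data.List.Relation.Unary.AllPairs.Properties as AllPairsₚ
open import Data.List.Relation.Unary.Any using (here; there)
import Data.List.Relation.Unary.Unique.Propositional.Properties as Uniqueₚ
open import Data.Maybe as Maybe using ()
open import Data.Nat as ℕ using (ℕ; zero; suc; _∸_; _≡ᵇ_)
open import Data.Nat.DivMod using (_/_; m*n/n≡m)
open import Data.Nat.ListAction using (sum)
import Data.Nat.Properties as ℕₚ
open import Data.Nat.Solver using (module +-*-Solver)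
import Data.Nat.Tactic.RingSolver as ℕSolver
open import Data.Product using (_×_; _,_; proj₁; proj₂; ∃)
open import Data.Sign as Sign using (Sign)
open import Data.Sum using (_⊎_; inj₁; inj₂)
import Data.Unit as Unit
open import Data.Vec using ([]; _∷_; _∷ʳ_; lookup)
import Data.Vec.Properties as Vecₚ
open import Function using (_∘_)
open import Relation.Binary.PropositionalEquality as ≡ using (_≡_; _≢_; cong; cong₂; subst; subst₂)
open import Relation.Nullary using (¬_; yes; no; dec⇒maybe)
open import Relation.Nullary.Decidable using (⌊_⌋)
open import Algebra.Properties.AbelianGroup ℤₚ.+-0-abelianGroup using (∙-cancelˡ)

-- Determinants solve the recursion because summation over interlacing sets (`fresh`) commutes, up
-- to sign, with expansion along a row: a row f comes out of `fresh` as a row F as soon as f i = ƛ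
-- F(i+1) - κ F(i). It remains to find, for every strip, rows F whose twisted differences are
-- multiples of the rows of the neighbouring, smaller strip. Above ℓ, where κ = q^N and ƛ = 1, these
-- are q^(iu) times products of -[u+t]. Below ℓ, where κ = 1 and ƛ = y is a power of q, they are y^d
-- times Newton polynomials in [d], with d counted from the right end. The multiples contain factors
-- [j+1], whose product over all strips is Δ([b]) or Δ([c]) up to a power of q: this is where these
-- constants of the formula come from. Since `R` may have zero divisors and q need not be
-- invertible, every identity is stated with denominators cleared, the final one included. The sums
-- for (X , Y) and (X′ , Y′) run over the same sets Z and agree term by term once multiplied by
-- their constants; neither sum is evaluated.

module IntegerSolver {ℓ₁ ℓ₂} (R : CommutativeRing ℓ₁ ℓ₂) where
  open CommutativeRing R hiding (zero)
  open import Algebra.Properties.Ring ring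
  open import Algebra.Properties.AbelianGroup +-abelianGroup using (⁻¹-∙-comm)
  open import Algebra.Properties.Semiring.Mult.TCOptimised semiring renaming (_×_ to _×ℕ_)
  open import Algebra.Solver.Ring.AlmostCommutativeRing
  open import Relation.Binary.Reasoning.Setoid setoid

  private
    ⟦_⟧ : ℤ → Carrier
    ⟦ + n ⟧      = n ×ℕ 1#
    ⟦ -[1+ n ] ⟧ = - (suc n ×ℕ 1#)

    neg-homo : ∀ i → ⟦ ℤ.- i ⟧ ≈ - ⟦ i ⟧
    neg-homo (+ zero)   = sym -0#≈0#
    neg-homo (+ suc n)  = refl
    neg-homo (-[1+ n ]) = sym (-‿involutive _)

    ⊖-homo : ∀ m n → ⟦ m ℤ.⊖ n ⟧ ≈ m ×ℕ 1# - n ×ℕ 1#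
    ⊖-homo m zero = sym (trans (+-congˡ -0#≈0#) (+-identityʳ _))
    ⊖-homo zero (suc n) = sym (+-identityˡ _)
    ⊖-homo (suc m) (suc n) = begin
      ⟦ suc m ℤ.⊖ suc n ⟧ ≡⟨ cong ⟦_⟧ (ℤₚ.[1+m]⊖[1+n]≡m⊖n m n) ⟩
      ⟦ m ℤ.⊖ n ⟧ ≈⟨ ⊖-homo m n ⟩
      m ×ℕ 1# - n ×ℕ 1# ≈⟨ +-congˡ (trans (sym (+-identityˡ _)) (trans (+-congʳ (sym (-‿inverseʳ 1#))) (+-assoc _ _ _))) ⟩
      m ×ℕ 1# + (1# + (- 1# - n ×ℕ 1#)) ≈⟨ sym (+-assoc _ _ _) ⟩
      (m ×ℕ 1# + 1#) + (- 1# - n ×ℕ 1#) ≈⟨ +-cong (+-comm _ _) (⁻¹-∙-comm _ _) ⟩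
      (1# + m ×ℕ 1#) - (1# + n ×ℕ 1#) ≈⟨ +-cong (sym (×-homo-+ 1# 1 m)) (-‿cong (sym (×-homo-+ 1# 1 n))) ⟩
      suc m ×ℕ 1# - suc n ×ℕ 1# ∎

    +-homo′ : ∀ i j → ⟦ i ℤ.+ j ⟧ ≈ ⟦ i ⟧ + ⟦ j ⟧
    +-homo′ (+ m) (+ n) = ×-homo-+ 1# m n
    +-homo′ (+ m) (-[1+ n ]) = ⊖-homo m (suc n)
    +-homo′ (-[1+ m ]) (+ n) = trans (⊖-homo n (suc m)) (+-comm _ _)
    +-homo′ (-[1+ m ]) (-[1+ n ]) = begin
      - (suc (suc (m ℕ.+ n)) ×ℕ 1#) ≡⟨ cong (λ k → - (k ×ℕ 1#)) (cong suc (≡.sym (ℕₚ.+-suc m n))) ⟩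
      - ((suc m ℕ.+ suc n) ×ℕ 1#) ≈⟨ -‿cong (×-homo-+ 1# (suc m) (suc n)) ⟩
      - (suc m ×ℕ 1# + suc n ×ℕ 1#) ≈⟨ sym (⁻¹-∙-comm _ _) ⟩
      - (suc m ×ℕ 1#) - suc n ×ℕ 1# ∎

    -◃-homo : ∀ n → ⟦ Sign.- ℤ.◃ n ⟧ ≈ - (n ×ℕ 1#)
    -◃-homo n = trans (reflexive (cong ⟦_⟧ (ℤₚ.-◃n≡-n n))) (neg-homo (+ n))

    *-homo′ : ∀ i j → ⟦ i ℤ.* j ⟧ ≈ ⟦ i ⟧ * ⟦ j ⟧
    *-homo′ (+ m) (+ n) = trans (reflexive (cong ⟦_⟧ (ℤₚ.+◃n≡+n (m ℕ.* n)))) (×1-homo-* m n)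
    *-homo′ (+ m) (-[1+ n ]) = trans (-◃-homo (m ℕ.* suc n)) (trans (-‿cong (×1-homo-* m (suc n))) (-‿distribʳ-* _ _))
    *-homo′ (-[1+ m ]) (+ n) = trans (-◃-homo (suc m ℕ.* n)) (trans (-‿cong (×1-homo-* (suc m) n)) (-‿distribˡ-* _ _))
    *-homo′ (-[1+ m ]) (-[1+ n ]) = begin
      (suc m ℕ.* suc n) ×ℕ 1# ≈⟨ ×1-homo-* (suc m) (suc n) ⟩
      suc m ×ℕ 1# * (suc n ×ℕ 1#) ≈⟨ sym (-‿involutive _) ⟩
      - - (suc m ×ℕ 1# * (suc n ×ℕ 1#)) ≈⟨ -‿cong (-‿distribˡ-* _ _) ⟩
      - (- (suc m ×ℕ 1#) * (suc n ×ℕ 1#)) ≈⟨ -‿distribʳ-* _ _ ⟩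
      - (suc m ×ℕ 1#) * - (suc n ×ℕ 1#) ∎

    -- The coefficients are integers because their equality is decidable and that of `R` need not
    -- be; with them the solver cancels opposite terms in an arbitrary commutative ring.
    morphism : ℤ.+-*-rawRing -Raw-AlmostCommutative⟶ fromCommutativeRing R
    morphism = record
      { ⟦_⟧ = ⟦_⟧ ; +-homo = +-homo′ ; *-homo = *-homo′ ; -‿homo = neg-homo
      ; 0-homo = refl ; 1-homo = refl }

  open import Algebra.Solver.Ring ℤ.+-*-rawRing (fromCommutativeRing R) morphism
    (λ i j → Maybe.map (reflexive ∘ cong ⟦_⟧) (dec⇒maybe (i ℤ.≟ j)))
    public using (solve; _:=_; _:+_; _:*_; _:-_; :-_; con)

-- Products over the elements and over the pairs of a set

module OneAndPairs {ℓ₁ ℓ₂} (Mo : CommutativeMonoid ℓ₁ ℓ₂) where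
  open CommutativeMonoid Mo

  one : ∀ {n} → (Fin n → Carrier) → Subset n → Carrier
  one g []          = ε
  one g (true ∷ U)  = g zero ∙ one (g ∘ suc) U
  one g (false ∷ U) = one (g ∘ suc) U

  -- Only pairs i < j enter. The monoid is a parameter so that one shuffling identity covers both
  -- the q-Vandermonde products (in `R`, multiplicatively) and the exponents of q (in ℕ,
  -- additively).
  pairs : ∀ {n} → (Fin n → Fin n → Carrier) → Subset n → Carrier
  pairs h []          = ε
  pairs h (true ∷ U)  = one (h zero ∘ suc) U ∙ pairs (λ i j → h (suc i) (suc j)) U
  pairs h (false ∷ U) = pairs (λ i j → h (suc i) (suc j)) U

  one-cong : ∀ {n} {g g′ : Fin n → Carrier} → (∀ i → g i ≈ g′ i) → ∀ U → one g U ≈ one g′ U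
  one-cong e []          = refl
  one-cong e (true ∷ U)  = ∙-cong (e zero) (one-cong (e ∘ suc) U)
  one-cong e (false ∷ U) = one-cong (e ∘ suc) U

  pairs-cong : ∀ {n} {h h′ : Fin n → Fin n → Carrier} → (∀ i j → i Data.Fin.< j → h i j ≈ h′ i j) →
               ∀ U → pairs h U ≈ pairs h′ U
  pairs-cong e []          = refl
  pairs-cong e (true ∷ U)  = ∙-cong (one-cong (λ j → e zero (suc j) (ℕ.s≤s ℕ.z≤n)) U)
                                    (pairs-cong (λ i j lt → e (suc i) (suc j) (ℕ.s≤s lt)) U)
  pairs-cong e (false ∷ U) = pairs-cong (λ i j lt → e (suc i) (suc j) (ℕ.s≤s lt)) U

-- Determinants and sums over interlacing sets

module Exterior {ℓ₁ ℓ₂} (R : CommutativeRing ℓ₁ ℓ₂) where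
  open CommutativeRing R hiding (zero)
  open import Algebra.Properties.Ring ring
  open import Relation.Binary.Reasoning.Setoid setoid
  open IntegerSolver R public
  open OneAndPairs *-commutativeMonoid public
  open RingDefs R

  Row Form : ℕ → Set ℓ₁
  Row n  = Fin n → Carrier
  Form n = Subset n → Carrier

  -- Expansion of a determinant along the row f, its columns being the elements of the set:
  -- f₁ ⌟ ⋯ ⌟ fₖ ⌟ 𝟙∅ is the determinant with rows fᵢ, and 0 on sets of size other than k.
  infixr 6 _⌟_
  _⌟_ : ∀ {n} → Row n → Form n → Form n
  (f ⌟ φ) []          = 0#
  (f ⌟ φ) (false ∷ U) = ((f ∘ suc) ⌟ (φ ∘ (false ∷_))) U
  (f ⌟ φ) (true ∷ U)  = f zero * φ (false ∷ U) - ((f ∘ suc) ⌟ (φ ∘ (true ∷_))) U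

  ⌟-cong : ∀ {n} {f g : Row n} {φ ψ : Form n} → (∀ i → f i ≈ g i) → (∀ U → φ U ≈ ψ U) →
           ∀ U → (f ⌟ φ) U ≈ (g ⌟ ψ) U
  ⌟-cong e e′ []          = refl
  ⌟-cong e e′ (false ∷ U) = ⌟-cong (e ∘ suc) (e′ ∘ (false ∷_)) U
  ⌟-cong e e′ (true ∷ U)  = +-cong (*-cong (e zero) (e′ (false ∷ U)))
                                   (-‿cong (⌟-cong (e ∘ suc) (e′ ∘ (true ∷_)) U))

  ⌟-congˡ : ∀ {n} {f : Row n} {φ ψ : Form n} → (∀ U → φ U ≈ ψ U) → ∀ U → (f ⌟ φ) U ≈ (f ⌟ ψ) U
  ⌟-congˡ = ⌟-cong (λ _ → refl)

  ⌟-congʳ : ∀ {n} {f g : Row n} {φ : Form n} → (∀ i → f i ≈ g i) → ∀ U → (f ⌟ φ) U ≈ (g ⌟ φ) U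
  ⌟-congʳ e = ⌟-cong e (λ _ → refl)

  ⌟-linearˡ : ∀ {n} a b (f : Row n) (φ ψ : Form n) U →
              (f ⌟ (λ V → a * φ V + b * ψ V)) U ≈ a * (f ⌟ φ) U + b * (f ⌟ ψ) U
  ⌟-linearˡ a b f φ ψ [] = solve 2 (λ a b → con (+ 0) := a :* con (+ 0) :+ b :* con (+ 0)) refl a b
  ⌟-linearˡ a b f φ ψ (false ∷ U) = ⌟-linearˡ a b _ _ _ U
  ⌟-linearˡ a b f φ ψ (true ∷ U) = trans
    (+-congˡ (-‿cong (⌟-linearˡ a b _ _ _ U)))
    (solve 7 (λ a b f x y s t → f :* (a :* x :+ b :* y) :- (a :* s :+ b :* t)
                              := a :* (f :* x :- s) :+ b :* (f :* y :- t)) refl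
       a b (f zero) (φ (false ∷ U)) (ψ (false ∷ U)) _ _)

  ⌟-linearʳ : ∀ {n} a b (f g : Row n) (φ : Form n) U →
              ((λ i → a * f i + b * g i) ⌟ φ) U ≈ a * (f ⌟ φ) U + b * (g ⌟ φ) U
  ⌟-linearʳ a b f g φ [] = solve 2 (λ a b → con (+ 0) := a :* con (+ 0) :+ b :* con (+ 0)) refl a b
  ⌟-linearʳ a b f g φ (false ∷ U) = ⌟-linearʳ a b _ _ _ U
  ⌟-linearʳ a b f g φ (true ∷ U) = trans
    (+-congˡ (-‿cong (⌟-linearʳ a b _ _ _ U)))
    (solve 7 (λ a b f g x s t → (a :* f :+ b :* g) :* x :- (a :* s :+ b :* t)
                              := a :* (f :* x :- s) :+ b :* (g :* x :- t)) refl
       a b (f zero) (g zero) (φ (false ∷ U)) _ _)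

  ⌟-scaleˡ : ∀ {n} a (f : Row n) (φ : Form n) U → (f ⌟ (λ V → a * φ V)) U ≈ a * (f ⌟ φ) U
  ⌟-scaleˡ a f φ U = trans (⌟-congˡ (λ V → solve 2 (λ a x → a :* x := a :* x :+ con (+ 0) :* x) refl a (φ V)) U)
    (trans (⌟-linearˡ a 0# f φ φ U) (solve 2 (λ a x → a :* x :+ con (+ 0) :* x := a :* x) refl a _))

  ⌟-scaleʳ : ∀ {n} a (f : Row n) (φ : Form n) U → ((λ i → a * f i) ⌟ φ) U ≈ a * (f ⌟ φ) U
  ⌟-scaleʳ a f φ U = trans (⌟-congʳ (λ i → solve 2 (λ a x → a :* x := a :* x :+ con (+ 0) :* x) refl a (f i)) U)
    (trans (⌟-linearʳ a 0# f f φ U) (solve 2 (λ a x → a :* x :+ con (+ 0) :* x := a :* x) refl a _))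

  ⌟-zero : ∀ {n} (f : Row n) U → (f ⌟ (λ _ → 0#)) U ≈ 0#
  ⌟-zero f U = trans (⌟-congˡ (λ _ → sym (zeroˡ 0#)) U) (trans (⌟-scaleˡ 0# f (λ _ → 0#) U) (zeroˡ _))

  -- At the first column the two copies of `f` contribute `f zero * X` with opposite signs; what is
  -- left is the same expression on the remaining columns. This vanishing of a determinant with two
  -- equal rows is what justifies all row operations.
  ⌟-square : ∀ {n} (f : Row n) (φ : Form n) U → (f ⌟ f ⌟ φ) U ≈ 0#
  ⌟-square f φ []          = refl
  ⌟-square f φ (false ∷ U) = ⌟-square (f ∘ suc) _ U
  ⌟-square f φ (true ∷ U)  = begin
    f zero * ((f ∘ suc) ⌟ (φ ∘ (false ∷_))) U
      - ((f ∘ suc) ⌟ (λ V → f zero * φ (false ∷ V) - ((f ∘ suc) ⌟ (φ ∘ (true ∷_))) V)) U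
      ≈⟨ +-congˡ (-‿cong (trans (⌟-congˡ (λ V → solve 3 (λ a x y → a :* x :- y := a :* x :+ (:- con (+ 1)) :* y) refl (f zero) _ _) U)
                                (⌟-linearˡ (f zero) (- 1#) _ _ _ U))) ⟩
    f zero * X - (f zero * X + - 1# * ((f ∘ suc) ⌟ (f ∘ suc) ⌟ (φ ∘ (true ∷_))) U)
      ≈⟨ +-congˡ (-‿cong (+-congˡ (*-congˡ (⌟-square (f ∘ suc) _ U)))) ⟩
    f zero * X - (f zero * X + - 1# * 0#)
      ≈⟨ solve 2 (λ a x → a :* x :- (a :* x :+ (:- con (+ 1)) :* con (+ 0)) := con (+ 0)) refl (f zero) X ⟩
    0# ∎
    where X = ((f ∘ suc) ⌟ (φ ∘ (false ∷_))) U

  -- Scaling of columns: each selected column carries its weight once, either in the expanded row or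
  -- in the minor.
  ⌟-weight : ∀ {n} (w f : Row n) (φ : Form n) U →
             ((λ i → w i * f i) ⌟ (λ V → one w V * φ V)) U ≈ one w U * (f ⌟ φ) U
  ⌟-weight w f φ [] = sym (zeroʳ _)
  ⌟-weight w f φ (false ∷ U) = ⌟-weight (w ∘ suc) (f ∘ suc) _ U
  ⌟-weight w f φ (true ∷ U) = trans
    (+-congˡ (-‿cong (trans (⌟-congˡ (λ V → *-assoc (w zero) _ _) U)
      (trans (⌟-scaleˡ (w zero) _ _ U) (*-congˡ (⌟-weight (w ∘ suc) (f ∘ suc) _ U))))))
    (solve 5 (λ w f o x y → w :* f :* (o :* x) :- w :* (o :* y) := w :* o :* (f :* x :- y)) refl
       (w zero) (f zero) (one (w ∘ suc) U) _ _)

  𝟙∅ : ∀ {n} → Form n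
  𝟙∅ []          = 1#
  𝟙∅ (false ∷ U) = 𝟙∅ U
  𝟙∅ (true ∷ U)  = 0#

  -- The rows are g i (k-1), g (i+1) (k-2), ..., g (i+k-1) 0. The sum of the two indices is constant
  -- because the rows of the upper half admit a common κ = q^N only when i + j + 1 = N. `∏` runs
  -- over the same pairs of indices.
  chain : ∀ {n} → (ℕ → ℕ → Row n) → ℕ → ℕ → Form n
  chain g i zero    = 𝟙∅
  chain g i (suc k) = g i k ⌟ chain g (suc i) k

  chain-cong : ∀ {n} {g h : ℕ → ℕ → Row n} → (∀ i j u → g i j u ≈ h i j u) → ∀ i k U → chain g i k U ≈ chain h i k U
  chain-cong e i zero    U = refl
  chain-cong e i (suc k) U = ⌟-cong (e i k) (chain-cong e (suc i) k) U

  chain-false : ∀ {n} (g : ℕ → ℕ → Row (suc n)) i k U →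
                chain g i k (false ∷ U) ≈ chain (λ i j → g i j ∘ suc) i k U
  chain-false g i zero    U = refl
  chain-false g i (suc k) U = ⌟-congˡ (chain-false g (suc i) k) U

  -- Laplace expansion along column zero, whose only nonzero entry stands in the last row. That
  -- entry has to pass the k other rows, and the sign of each passage is put into the row that is
  -- passed.
  chain-true : ∀ {n} (g : ℕ → ℕ → Row (suc n)) → (∀ i → g i 0 zero ≈ 1#) → (∀ i j → g i (suc j) zero ≈ 0#) →
               ∀ i k U → chain g i (suc k) (true ∷ U) ≈ chain (λ i j u → - g i (suc j) (suc u)) i k U
  chain-true g g₀ g₊ i zero U = trans (+-cong (*-congʳ (g₀ i)) (-‿cong (⌟-zero _ U)))
    (solve 1 (λ x → con (+ 1) :* x :- con (+ 0) := x) refl _)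
  chain-true g g₀ g₊ i (suc k) U = begin
    g i (suc k) zero * X - (f ⌟ (λ V → chain g (suc i) (suc k) (true ∷ V))) U
      ≈⟨ +-cong (*-congʳ (g₊ i k)) (-‿cong (⌟-congˡ (chain-true g g₀ g₊ (suc i) k) U)) ⟩
    0# * X - (f ⌟ C) U
      ≈⟨ solve 2 (λ x y → con (+ 0) :* x :- y := (:- con (+ 1)) :* y) refl X _ ⟩
    - 1# * (f ⌟ C) U ≈⟨ sym (⌟-scaleʳ (- 1#) f C U) ⟩
    ((λ u → - 1# * f u) ⌟ C) U ≈⟨ ⌟-congʳ (λ u → -1*x≈-x _) U ⟩
    ((λ u → - f u) ⌟ C) U ∎
    where
    X = chain g (suc i) (suc k) (false ∷ U)
    f = g i (suc k) ∘ suc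
    C = chain (λ i j u → - g i (suc j) (suc u)) (suc i) k

  chain-weight : ∀ {n} (w : Row n) (g : ℕ → ℕ → Row n) i k U →
                 chain (λ i j u → w u * g i j u) i k U ≈ one w U * chain g i k U
  chain-weight w g i zero U = lemma w U
    where
    lemma : ∀ {n} (w : Row n) U → 𝟙∅ U ≈ one w U * 𝟙∅ U
    lemma w []          = sym (*-identityˡ _)
    lemma w (true ∷ U)  = sym (zeroʳ _)
    lemma w (false ∷ U) = lemma (w ∘ suc) U
  chain-weight w g i (suc k) U =
    trans (⌟-congˡ (chain-weight w g (suc i) k) U) (⌟-weight w (g i k) _ U)

  ∏ : (ℕ → ℕ → Carrier) → ℕ → ℕ → Carrier
  ∏ α i zero    = 1#
  ∏ α i (suc k) = α i k * ∏ α (suc i) k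

  -- The added multiple of the previous row is killed by ⌟-square.
  chain-rowop : ∀ {n} (g g′ : ℕ → ℕ → Row n) (α β : ℕ → ℕ → Carrier) →
    (∀ i u → g′ i 0 u ≈ α i 0 * g i 0 u) →
    (∀ i j u → g′ i (suc j) u ≈ α i (suc j) * g i (suc j) u + β i j * g′ (suc i) j u) →
    ∀ i k U → chain g′ i k U ≈ ∏ α i k * chain g i k U
  chain-rowop g g′ α β e₀ e₊ i zero U = sym (*-identityˡ _)
  chain-rowop g g′ α β e₀ e₊ i (suc zero) U = begin
    (g′ i 0 ⌟ 𝟙∅) U ≈⟨ ⌟-congʳ (e₀ i) U ⟩
    ((λ u → α i 0 * g i 0 u) ⌟ 𝟙∅) U ≈⟨ ⌟-scaleʳ _ _ _ U ⟩
    α i 0 * (g i 0 ⌟ 𝟙∅) U ≈⟨ *-congʳ (sym (*-identityʳ _)) ⟩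
    ∏ α i 1 * chain g i 1 U ∎
  chain-rowop g g′ α β e₀ e₊ i (suc (suc k)) U = begin
    (g′ i (suc k) ⌟ chain g′ (suc i) (suc k)) U
      ≈⟨ ⌟-congʳ (e₊ i k) U ⟩
    ((λ u → α i (suc k) * g i (suc k) u + β i k * g′ (suc i) k u) ⌟ chain g′ (suc i) (suc k)) U
      ≈⟨ ⌟-linearʳ _ _ _ _ _ U ⟩
    α i (suc k) * (g i (suc k) ⌟ chain g′ (suc i) (suc k)) U
      + β i k * (g′ (suc i) k ⌟ g′ (suc i) k ⌟ chain g′ (suc (suc i)) k) U
      ≈⟨ +-cong (*-congˡ (trans (⌟-congˡ (chain-rowop g g′ α β e₀ e₊ (suc i) (suc k)) U) (⌟-scaleˡ _ _ _ U)))
                (*-congˡ (⌟-square _ _ U)) ⟩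
    α i (suc k) * (∏ α (suc i) (suc k) * chain g i (suc (suc k)) U) + β i k * 0#
      ≈⟨ solve 4 (λ a p x b → a :* (p :* x) :+ b :* con (+ 0) := a :* p :* x) refl _ _ _ _ ⟩
    ∏ α i (suc (suc k)) * chain g i (suc (suc k)) U ∎

  chain-scale : ∀ {n} (g : ℕ → ℕ → Row n) (α : ℕ → ℕ → Carrier) i k U →
    chain (λ i j u → α i j * g i j u) i k U ≈ ∏ α i k * chain g i k U
  chain-scale g α = chain-rowop g _ α (λ _ _ → 0#) (λ _ _ → refl)
    (λ i j u → solve 2 (λ x y → x := x :+ con (+ 0) :* y) refl _ _)

  Supported : ∀ {n} → Form n → ℕ → Set ℓ₂
  Supported φ k = ∀ U → size U ≢ k → φ U ≈ 0#

  ⌟-supported : ∀ {n} (f : Row n) {φ : Form n} {k} → Supported φ k → Supported (f ⌟ φ) (suc k)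
  ⌟-supported f s [] ne = refl
  ⌟-supported f s (false ∷ U) ne = ⌟-supported (f ∘ suc) (s ∘ (false ∷_)) U ne
  ⌟-supported f {k = zero} s (true ∷ U) ne = trans
    (+-cong (*-congˡ (s (false ∷ U) (ne ∘ cong suc)))
            (-‿cong (trans (⌟-congˡ (λ V → s (true ∷ V) (λ ())) U) (⌟-zero _ U))))
    (solve 1 (λ x → x :* con (+ 0) :- con (+ 0) := con (+ 0)) refl (f zero))
  ⌟-supported f {k = suc k} s (true ∷ U) ne = trans
    (+-cong (*-congˡ (s (false ∷ U) (ne ∘ cong suc)))
            (-‿cong (⌟-supported (f ∘ suc) (λ V ne′ → s (true ∷ V) (ne′ ∘ ℕₚ.suc-injective)) U (ne ∘ cong suc))))
    (solve 1 (λ x → x :* con (+ 0) :- con (+ 0) := con (+ 0)) refl (f zero))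

  chain-supported : ∀ {n} (g : ℕ → ℕ → Row n) i k → Supported (chain g i k) k
  chain-supported g i zero = supp
    where
    supp : ∀ {n} → Supported (𝟙∅ {n}) 0
    supp [] ne          = ⊥-elim (ne ≡.refl)
    supp (true ∷ U) ne  = refl
    supp (false ∷ U) ne = supp U ne
  chain-supported g i (suc k) = ⌟-supported (g i k) (chain-supported g (suc i) k)

  -- fresh φ U is the sum of φ D over all D interlacing U (u₁ ≤ d₁ < u₂ ≤ d₂ < ⋯), where a position outside D
  -- has weight ƛ between some uᵢ and dᵢ and weight κ otherwise; pending starts between uᵢ and dᵢ.
  module Interlacing (κ ƛ : Carrier) where
    mutual
      fresh : ∀ {n} → Form n → Form (suc n)
      fresh φ (true ∷ [])           = φ []
      fresh φ (false ∷ [])          = 0#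
      fresh φ (true ∷ U@(_ ∷ _))    = next φ U
      fresh φ (false ∷ U@(_ ∷ _))   = κ * fresh (φ ∘ (false ∷_)) U

      pending : ∀ {n} → Form n → Form (suc n)
      pending φ (true ∷ U)          = 0#
      pending φ (false ∷ [])        = ƛ * φ []
      pending φ (false ∷ U@(_ ∷ _)) = ƛ * next φ U

      next : ∀ {n} → Form (suc n) → Form (suc n)
      next φ U = fresh (φ ∘ (true ∷_)) U + pending (φ ∘ (false ∷_)) U

    mutual
      fresh-cong : ∀ {n} {φ ψ : Form n} → (∀ U → φ U ≈ ψ U) → ∀ U → fresh φ U ≈ fresh ψ U
      fresh-cong e (true ∷ [])         = e []
      fresh-cong e (false ∷ [])        = refl
      fresh-cong e (true ∷ U@(_ ∷ _))  = next-cong e U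
      fresh-cong e (false ∷ U@(_ ∷ _)) = *-congˡ (fresh-cong (e ∘ (false ∷_)) U)

      pending-cong : ∀ {n} {φ ψ : Form n} → (∀ U → φ U ≈ ψ U) → ∀ U → pending φ U ≈ pending ψ U
      pending-cong e (true ∷ U)          = refl
      pending-cong e (false ∷ [])        = *-congˡ (e [])
      pending-cong e (false ∷ U@(_ ∷ _)) = *-congˡ (next-cong e U)

      next-cong : ∀ {n} {φ ψ : Form (suc n)} → (∀ U → φ U ≈ ψ U) → ∀ U → next φ U ≈ next ψ U
      next-cong e U = +-cong (fresh-cong (e ∘ (true ∷_)) U) (pending-cong (e ∘ (false ∷_)) U)

    mutual
      fresh-linear : ∀ {n} a b (φ ψ : Form n) U →
        fresh (λ V → a * φ V + b * ψ V) U ≈ a * fresh φ U + b * fresh ψ U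
      fresh-linear a b φ ψ (true ∷ [])         = refl
      fresh-linear a b φ ψ (false ∷ [])        =
        solve 2 (λ a b → con (+ 0) := a :* con (+ 0) :+ b :* con (+ 0)) refl a b
      fresh-linear a b φ ψ (true ∷ U@(_ ∷ _))  = next-linear a b φ ψ U
      fresh-linear a b φ ψ (false ∷ U@(_ ∷ _)) = trans (*-congˡ (fresh-linear a b _ _ U))
        (solve 5 (λ k a b x y → k :* (a :* x :+ b :* y) := a :* (k :* x) :+ b :* (k :* y)) refl κ a b _ _)

      pending-linear : ∀ {n} a b (φ ψ : Form n) U →
        pending (λ V → a * φ V + b * ψ V) U ≈ a * pending φ U + b * pending ψ U
      pending-linear a b φ ψ (true ∷ U)          =
        solve 2 (λ a b → con (+ 0) := a :* con (+ 0) :+ b :* con (+ 0)) refl a b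
      pending-linear a b φ ψ (false ∷ [])        =
        solve 5 (λ k a b x y → k :* (a :* x :+ b :* y) := a :* (k :* x) :+ b :* (k :* y)) refl ƛ a b _ _
      pending-linear a b φ ψ (false ∷ U@(_ ∷ _)) = trans (*-congˡ (next-linear a b φ ψ U))
        (solve 5 (λ k a b x y → k :* (a :* x :+ b :* y) := a :* (k :* x) :+ b :* (k :* y)) refl ƛ a b _ _)

      next-linear : ∀ {n} a b (φ ψ : Form (suc n)) U →
        next (λ V → a * φ V + b * ψ V) U ≈ a * next φ U + b * next ψ U
      next-linear a b φ ψ U = trans (+-cong (fresh-linear a b _ _ U) (pending-linear a b _ _ U))
        (solve 6 (λ a b x y s t → a :* x :+ b :* y :+ (a :* s :+ b :* t) := a :* (x :+ s) :+ b :* (y :+ t)) refl a b _ _ _ _)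

    fresh-scale : ∀ {n} a (φ : Form n) U → fresh (λ V → a * φ V) U ≈ a * fresh φ U
    fresh-scale a φ U = trans (fresh-cong (λ V → solve 2 (λ a x → a :* x := a :* x :+ con (+ 0) :* x) refl a (φ V)) U)
      (trans (fresh-linear a 0# φ φ U) (solve 2 (λ a x → a :* x :+ con (+ 0) :* x := a :* x) refl a _))

    fresh-zero : ∀ {n} U → fresh {n} (λ _ → 0#) U ≈ 0#
    fresh-zero U = trans (fresh-cong (λ _ → sym (zeroˡ 0#)) U) (trans (fresh-scale 0# (λ _ → 0#) U) (zeroˡ _))

    mutual
      -- Between two consecutive elements of U there is exactly one element of D, and the weighted
      -- sum of a twisted difference over its positions telescopes to the values of `F` at the two
      -- ends. `pending-⌟` and `next-⌟` start in the middle of such a sum, hence their extra terms: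
      -- that of `pending-⌟` cancels against `f zero` in `next-⌟`, and that of `next-⌟` becomes the
      -- entry `F zero` of the expansion here.
      fresh-⌟ : ∀ {n} (f : Row n) (F : Row (suc n)) → (∀ i → f i ≈ ƛ * F (suc i) - κ * F (inject₁ i)) →
        ∀ φ U → fresh (f ⌟ φ) U ≈ - (F ⌟ fresh φ) U
      fresh-⌟ f F e φ (true ∷ []) = solve 1 (λ x → con (+ 0) := :- (x :* con (+ 0) :- con (+ 0))) refl (F zero)
      fresh-⌟ f F e φ (false ∷ []) = sym -0#≈0#
      fresh-⌟ f F e φ (true ∷ U@(_ ∷ _)) = begin
        next (f ⌟ φ) U ≈⟨ next-⌟ f F e φ U ⟩
        ((F ∘ suc) ⌟ next φ) U - κ * F zero * Y
          ≈⟨ solve 4 (λ k f x y → x :- k :* f :* y := :- (f :* (k :* y) :- x)) refl κ (F zero) _ Y ⟩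
        - (F zero * (κ * Y) - ((F ∘ suc) ⌟ next φ) U)
          ≈⟨ -‿cong (+-congˡ (-‿cong (⌟-congˡ (λ { (_ ∷ _) → refl }) U))) ⟩
        - (F ⌟ fresh φ) (true ∷ U) ∎
        where Y = fresh (φ ∘ (false ∷_)) U
      fresh-⌟ f F e φ (false ∷ U@(_ ∷ _)) = begin
        κ * fresh ((f ∘ suc) ⌟ (φ ∘ (false ∷_))) U ≈⟨ *-congˡ (fresh-⌟ (f ∘ suc) (F ∘ suc) (e ∘ suc) _ U) ⟩
        κ * - ((F ∘ suc) ⌟ fresh (φ ∘ (false ∷_))) U ≈⟨ sym (-‿distribʳ-* _ _) ⟩
        - (κ * ((F ∘ suc) ⌟ fresh (φ ∘ (false ∷_))) U) ≈⟨ -‿cong (sym (⌟-scaleˡ κ _ _ U)) ⟩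
        - ((F ∘ suc) ⌟ (λ V → κ * fresh (φ ∘ (false ∷_)) V)) U
          ≈⟨ -‿cong (⌟-congˡ (λ { (_ ∷ _) → refl }) U) ⟩
        - (F ⌟ fresh φ) (false ∷ U) ∎

      pending-⌟ : ∀ {n} (f : Row n) (F : Row (suc n)) → (∀ i → f i ≈ ƛ * F (suc i) - κ * F (inject₁ i)) →
        ∀ φ U → pending (f ⌟ φ) U ≈ (F ⌟ pending φ) U - ƛ * F zero * fresh φ U
      pending-⌟ f F e φ (true ∷ []) =
        solve 3 (λ k f x → con (+ 0) := f :* (k :* x) :- con (+ 0) :- k :* f :* x) refl ƛ (F zero) (φ [])
      pending-⌟ f F e φ (false ∷ []) =
        solve 2 (λ k f → k :* con (+ 0) := con (+ 0) :- k :* f :* con (+ 0)) refl ƛ (F zero)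
      pending-⌟ f F e φ (true ∷ U@(_ ∷ _)) = sym (begin
        F zero * (ƛ * next φ U) - ((F ∘ suc) ⌟ (λ V → 0#)) U - ƛ * F zero * next φ U
          ≈⟨ +-congʳ (+-congˡ (-‿cong (⌟-zero (F ∘ suc) U))) ⟩
        F zero * (ƛ * next φ U) - 0# - ƛ * F zero * next φ U
          ≈⟨ solve 3 (λ k f x → f :* (k :* x) :- con (+ 0) :- k :* f :* x := con (+ 0)) refl ƛ (F zero) (next φ U) ⟩
        0# ∎)
      pending-⌟ f F e φ (false ∷ U@(_ ∷ _)) = begin
        ƛ * next (f ⌟ φ) U ≈⟨ *-congˡ (next-⌟ f F e φ U) ⟩
        ƛ * (((F ∘ suc) ⌟ next φ) U - κ * F zero * Y)
          ≈⟨ solve 5 (λ l k f x y → l :* (x :- k :* f :* y) := l :* x :- l :* f :* (k :* y)) refl ƛ κ (F zero) _ Y ⟩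
        ƛ * ((F ∘ suc) ⌟ next φ) U - ƛ * F zero * (κ * Y)
          ≈⟨ +-congʳ (trans (sym (⌟-scaleˡ ƛ _ _ U)) (⌟-congˡ (λ { (_ ∷ _) → refl }) U)) ⟩
        (F ⌟ pending φ) (false ∷ U) - ƛ * F zero * fresh φ (false ∷ U) ∎
        where Y = fresh (φ ∘ (false ∷_)) U

      next-⌟ : ∀ {n} (f : Row (suc n)) (F : Row (suc (suc n))) → (∀ i → f i ≈ ƛ * F (suc i) - κ * F (inject₁ i)) →
        ∀ φ U → next (f ⌟ φ) U ≈ ((F ∘ suc) ⌟ next φ) U - κ * F zero * fresh (φ ∘ (false ∷_)) U
      next-⌟ f F e φ U = begin
        fresh (λ V → f zero * φ (false ∷ V) - (f′ ⌟ φₜ) V) U + pending (f′ ⌟ φ₀) U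
          ≈⟨ +-cong (fresh-cong (λ V → solve 3 (λ a x y → a :* x :- y := a :* x :+ (:- con (+ 1)) :* y) refl (f zero) _ _) U)
                    (pending-⌟ f′ F′ (e ∘ suc) φ₀ U) ⟩
        fresh (λ V → f zero * φ (false ∷ V) + - 1# * (f′ ⌟ φₜ) V) U + ((F′ ⌟ pending φ₀) U - ƛ * F′ zero * Y)
          ≈⟨ +-congʳ (fresh-linear (f zero) (- 1#) _ _ U) ⟩
        f zero * Y + - 1# * fresh (f′ ⌟ φₜ) U + ((F′ ⌟ pending φ₀) U - ƛ * F′ zero * Y)
          ≈⟨ +-congʳ (+-cong (*-congʳ (e zero)) (*-congˡ (fresh-⌟ f′ F′ (e ∘ suc) φₜ U))) ⟩
        (ƛ * F′ zero - κ * F zero) * Y + - 1# * - (F′ ⌟ fresh φₜ) U + ((F′ ⌟ pending φ₀) U - ƛ * F′ zero * Y)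
          ≈⟨ solve 7 (λ l k f g y s t → (l :* g :- k :* f) :* y :+ (:- con (+ 1)) :* (:- s) :+ (t :- l :* g :* y)
                                   := con (+ 1) :* s :+ con (+ 1) :* t :- k :* f :* y) refl ƛ κ (F zero) (F′ zero) Y _ _ ⟩
        1# * (F′ ⌟ fresh φₜ) U + 1# * (F′ ⌟ pending φ₀) U - κ * F zero * Y
          ≈⟨ +-congʳ (trans (sym (⌟-linearˡ 1# 1# _ _ _ U))
                            (⌟-congˡ (λ V → +-cong (*-identityˡ _) (*-identityˡ _)) U)) ⟩
        (F′ ⌟ next φ) U - κ * F zero * Y ∎
        where
        f′ = f ∘ suc
        F′ = F ∘ suc
        φ₀ = φ ∘ (false ∷_)
        φₜ = φ ∘ (true ∷_)
        Y = fresh φ₀ U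

    -- Summation over interlacing sets takes a determinant to one of size one larger: each row f is the twisted
    -- difference of a row F, and the empty form contributes the new row.
    fresh-chain : ∀ {n} (g : ℕ → ℕ → Row n) (G : ℕ → ℕ → Row (suc n)) (c : ℕ → ℕ → Carrier) N →
      (∀ i j → i ℕ.+ suc j ≡ N → ∀ u → c i j * g i j u ≈ κ * G i (suc j) (inject₁ u) - ƛ * G i (suc j) (suc u)) →
      (∀ U → fresh 𝟙∅ U ≈ (G N 0 ⌟ 𝟙∅) U) →
      ∀ i k → i ℕ.+ k ≡ N → ∀ U → ∏ c i k * fresh (chain g i k) U ≈ chain G i (suc k) U
    fresh-chain g G c N step base i zero eq U = trans (*-identityˡ _) (trans (base U)
      (⌟-congʳ (λ u → reflexive (cong (λ t → G t 0 u) (≡.trans (≡.sym eq) (ℕₚ.+-identityʳ i)))) U))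
    fresh-chain g G c N step base i (suc k) eq U = begin
      c i k * ∏ c (suc i) k * fresh (g i k ⌟ chain g (suc i) k) U
        ≈⟨ solve 3 (λ a b x → a :* b :* x := b :* (a :* x)) refl _ _ _ ⟩
      ∏ c (suc i) k * (c i k * fresh (g i k ⌟ chain g (suc i) k) U)
        ≈⟨ *-congˡ (trans (sym (fresh-scale _ _ U)) (fresh-cong (λ V → sym (⌟-scaleʳ _ _ _ V)) U)) ⟩
      ∏ c (suc i) k * fresh ((λ u → c i k * g i k u) ⌟ chain g (suc i) k) U
        ≈⟨ *-congˡ (fresh-⌟ _ (λ u → - G i (suc k) u)
             (λ u → trans (step i k eq u)
               (solve 4 (λ k l x y → k :* x :- l :* y := l :* (:- y) :- k :* (:- x)) refl κ ƛ _ _)) _ U) ⟩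
      ∏ c (suc i) k * - ((λ u → - G i (suc k) u) ⌟ fresh (chain g (suc i) k)) U
        ≈⟨ *-congˡ (-‿cong (trans (⌟-congʳ (λ u → sym (-1*x≈-x _)) U) (⌟-scaleʳ (- 1#) _ _ U))) ⟩
      ∏ c (suc i) k * - (- 1# * (G i (suc k) ⌟ fresh (chain g (suc i) k)) U)
        ≈⟨ solve 2 (λ a x → a :* (:- ((:- con (+ 1)) :* x)) := a :* x) refl _ _ ⟩
      ∏ c (suc i) k * (G i (suc k) ⌟ fresh (chain g (suc i) k)) U
        ≈⟨ sym (⌟-scaleˡ _ _ _ U) ⟩
      (G i (suc k) ⌟ (λ V → ∏ c (suc i) k * fresh (chain g (suc i) k) V)) U
        ≈⟨ ⌟-congˡ (fresh-chain g G c N step base (suc i) k (≡.trans (≡.sym (ℕₚ.+-suc i k)) eq)) U ⟩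
      chain G i (suc (suc k)) U ∎

    pending-empty : ∀ {n} U → pending {n} 𝟙∅ U ≈ pow ƛ (suc n) * 𝟙∅ U
    pending-empty (true ∷ U)          = sym (zeroʳ _)
    pending-empty (false ∷ [])        = *-congʳ (sym (*-identityʳ _))
    pending-empty (false ∷ U@(_ ∷ _)) = trans (*-congˡ (next-empty U)) (sym (*-assoc _ _ _))
      where
      next-empty : ∀ {n} (U : Subset (suc n)) → next 𝟙∅ U ≈ pow ƛ (suc n) * 𝟙∅ U
      next-empty U = trans (+-cong (fresh-zero U) (pending-empty U)) (+-identityˡ _)

    -- The empty set interlaces singletons only. For U = {u} the positions before u weigh κ and the
    -- n ∸ u positions from u on weigh ƛ. This is the row that each strip adds to the determinant.
    fresh-empty : ∀ {n} U → fresh {n} 𝟙∅ U ≈ ((λ u → pow κ (toℕ u) * pow ƛ (n ℕ.∸ toℕ u)) ⌟ 𝟙∅) U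
    fresh-empty (true ∷ [])           = solve 0 (con (+ 1) := con (+ 1) :* con (+ 1) :* con (+ 1) :- con (+ 0)) refl
    fresh-empty (false ∷ [])          = refl
    fresh-empty {suc n} (true ∷ U@(_ ∷ _)) = begin
      fresh (λ _ → 0#) U + pending 𝟙∅ U ≈⟨ +-cong (fresh-zero U) (pending-empty U) ⟩
      0# + pow ƛ (suc n) * 𝟙∅ U
        ≈⟨ solve 2 (λ p x → con (+ 0) :+ p :* x := con (+ 1) :* p :* x :- con (+ 0)) refl _ _ ⟩
      1# * pow ƛ (suc n) * 𝟙∅ U - 0# ≈⟨ +-congˡ (-‿cong (sym (⌟-zero _ U))) ⟩
      _ ∎
    fresh-empty (false ∷ U@(_ ∷ _)) = trans (*-congˡ (fresh-empty U)) (trans (sym (⌟-scaleʳ κ _ _ U))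
      (⌟-congʳ (λ u → sym (*-assoc _ _ _)) U))

-- Sums of exponents over elements and pairs

module ℕSum = OneAndPairs ℕₚ.+-0-commutativeMonoid
open ℕSum using () renaming (one to oneℕ; pairs to pairsℕ)

oneℕ-suc : ∀ {n} (e : Fin n → ℕ) U → oneℕ (suc ∘ e) U ≡ (size U) ℕ.+ oneℕ e U
oneℕ-suc e []          = ≡.refl
oneℕ-suc e (true ∷ U)  = cong suc (≡.trans (cong (e zero ℕ.+_) (oneℕ-suc (e ∘ suc) U))
  (≡.trans (≡.sym (ℕₚ.+-assoc (e zero) (size U) _)) (≡.trans (cong (ℕ._+ oneℕ (e ∘ suc) U) (ℕₚ.+-comm (e zero) (size U)))
    (ℕₚ.+-assoc (size U) (e zero) _))))
oneℕ-suc e (false ∷ U) = oneℕ-suc (e ∘ suc) U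

oneℕ-0 : ∀ {n} (U : Subset n) → oneℕ (λ _ → 0) U ≡ 0
oneℕ-0 []          = ≡.refl
oneℕ-0 (true ∷ U)  = oneℕ-0 U
oneℕ-0 (false ∷ U) = oneℕ-0 U

choose₂ : ℕ → ℕ
choose₂ zero    = 0
choose₂ (suc k) = k ℕ.+ choose₂ k

pairsℕ-suc : ∀ {n} (e : Fin n → Fin n → ℕ) U →
  pairsℕ (λ i j → suc (e i j)) U ≡ choose₂ (size U) ℕ.+ pairsℕ e U
pairsℕ-suc e []          = ≡.refl
pairsℕ-suc e (false ∷ U) = pairsℕ-suc (λ i j → e (suc i) (suc j)) U
pairsℕ-suc e (true ∷ U)  = ≡.trans
  (cong₂ ℕ._+_ (oneℕ-suc (e zero ∘ suc) U) (pairsℕ-suc (λ i j → e (suc i) (suc j)) U))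
  (solve 4 (λ k s c p → (k :+ s) :+ (c :+ p) := (k :+ c) :+ (s :+ p)) ≡.refl
    (size U) (oneℕ (e zero ∘ suc) U) (choose₂ (size U)) _)
  where open +-*-Solver

-- q-integers and the q-Vandermonde product of a set

module QAnalogue {ℓ₁ ℓ₂} (R : CommutativeRing ℓ₁ ℓ₂) (q : CommutativeRing.Carrier R) where
  open CommutativeRing R hiding (zero)
  open import Algebra.Properties.Ring ring
  open import Relation.Binary.Reasoning.Setoid setoid
  open Exterior R public
  open RingDefs R public

  [_] : ℕ → Carrier
  [_] = qint q

  pow-+ : ∀ x m n → pow x (m ℕ.+ n) ≈ pow x m * pow x n
  pow-+ x zero    n = sym (*-identityˡ _)
  pow-+ x (suc m) n = trans (*-congˡ (pow-+ x m n)) (sym (*-assoc _ _ _))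

  pow-* : ∀ m n → pow (pow q m) n ≈ pow q (m ℕ.* n)
  pow-* m zero = reflexive (cong (pow q) (≡.sym (ℕₚ.*-zeroʳ m)))
  pow-* m (suc n) = trans (*-congˡ (pow-* m n)) (trans (sym (pow-+ q m (m ℕ.* n)))
    (reflexive (cong (pow q) (≡.sym (ℕₚ.*-suc m n)))))

  pow-1 : ∀ n → pow 1# n ≈ 1#
  pow-1 zero    = refl
  pow-1 (suc n) = trans (*-identityˡ _) (pow-1 n)

  pow-≡ : ∀ {m n} → m ≡ n → pow q m ≈ pow q n
  pow-≡ eq = reflexive (cong (pow q) eq)

  []-suc : ∀ n → [ suc n ] ≈ 1# + q * [ n ]
  []-suc n = +-congˡ (scale (λ k → k) n)
    where
    scale : ∀ f n → sumR (map (pow q) (applyUpTo (suc ∘ f) n)) ≈ q * sumR (map (pow q) (applyUpTo f n))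
    scale f zero    = sym (zeroʳ q)
    scale f (suc n) = trans (+-congˡ (scale (f ∘ suc) n)) (sym (distribˡ _ _ _))

  []-+ : ∀ m n → [ m ℕ.+ n ] ≈ [ m ] + pow q m * [ n ]
  []-+ zero n = solve 1 (λ x → x := con (+ 0) :+ con (+ 1) :* x) refl _
  []-+ (suc m) n = begin
    [ suc (m ℕ.+ n) ] ≈⟨ trans ([]-suc (m ℕ.+ n)) (+-congˡ (*-congˡ ([]-+ m n))) ⟩
    1# + q * ([ m ] + pow q m * [ n ])
      ≈⟨ solve 4 (λ q m p n → con (+ 1) :+ q :* (m :+ p :* n) := con (+ 1) :+ q :* m :+ q :* p :* n) refl q _ _ _ ⟩
    1# + q * [ m ] + pow q (suc m) * [ n ] ≈⟨ +-congʳ (sym ([]-suc m)) ⟩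
    [ suc m ] + pow q (suc m) * [ n ] ∎

  []-≡ : ∀ {m n} → m ≡ n → [ m ] ≈ [ n ]
  []-≡ eq = reflexive (cong [_] eq)

  []-difference : ∀ {m n} → m ℕ.≤ n → [ n ] - [ m ] ≈ pow q m * [ n ℕ.∸ m ]
  []-difference {m} {n} le = trans (+-congʳ (trans ([]-≡ (≡.sym (ℕₚ.m+[n∸m]≡n le))) ([]-+ m (n ℕ.∸ m))))
    (solve 2 (λ m x → m :+ x :- m := x) refl _ _)

  factorial : ℕ → Carrier
  factorial zero    = 1#
  factorial (suc k) = [ suc k ] * factorial k

  ∏-[] : ∀ i k → ∏ (λ _ j → [ suc j ]) i k ≈ factorial k
  ∏-[] i zero    = refl
  ∏-[] i (suc k) = *-congˡ (∏-[] (suc i) k)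

  ∏-pow : ∀ i k → ∏ (λ i _ → pow q i) i k ≈ pow q (i ℕ.* k ℕ.+ choose₂ k)
  ∏-pow i zero    = pow-≡ (≡.sym (≡.trans (ℕₚ.+-identityʳ _) (ℕₚ.*-zeroʳ i)))
  ∏-pow i (suc k) = trans (*-congˡ (∏-pow (suc i) k)) (trans (sym (pow-+ q i _))
    (pow-≡ (+-*-Solver.solve 3 (λ i k c → i +-*-Solver.:+ ((k +-*-Solver.:+ i +-*-Solver.:* k) +-*-Solver.:+ c) +-*-Solver.:= i +-*-Solver.:* (+-*-Solver.con 1 +-*-Solver.:+ k) +-*-Solver.:+ (k +-*-Solver.:+ c))
      ≡.refl i k (choose₂ k))))

  ∏-* : ∀ α β i k → ∏ (λ i j → α i j * β i j) i k ≈ ∏ α i k * ∏ β i k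
  ∏-* α β i zero    = sym (*-identityˡ _)
  ∏-* α β i (suc k) = trans (*-congˡ (∏-* α β (suc i) k))
    (solve 4 (λ a b c d → a :* b :* (c :* d) := a :* c :* (b :* d)) refl _ _ _ _)

  ∏-const : ∀ x i k → ∏ (λ _ _ → x) i k ≈ pow x k
  ∏-const x i zero    = refl
  ∏-const x i (suc k) = *-congˡ (∏-const x (suc i) k)

  one-pow : ∀ {n} (e : Fin n → ℕ) U → one (pow q ∘ e) U ≈ pow q (oneℕ e U)
  one-pow e []          = refl
  one-pow e (true ∷ U)  = trans (*-congˡ (one-pow (e ∘ suc) U)) (sym (pow-+ q (e zero) (oneℕ (e ∘ suc) U)))
  one-pow e (false ∷ U) = one-pow (e ∘ suc) U

  one-* : ∀ {n} (f g : Fin n → Carrier) U → one (λ i → f i * g i) U ≈ one f U * one g U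
  one-* f g []          = sym (*-identityˡ _)
  one-* f g (true ∷ U)  = trans (*-congˡ (one-* (f ∘ suc) (g ∘ suc) U))
    (solve 4 (λ a b c d → a :* b :* (c :* d) := a :* c :* (b :* d)) refl _ _ _ _)
  one-* f g (false ∷ U) = one-* (f ∘ suc) (g ∘ suc) U

  pairs-pow : ∀ {n} (e : Fin n → Fin n → ℕ) (h : Fin n → Fin n → Carrier) U →
    pairs (λ i j → pow q (e i j) * h i j) U ≈ pow q (pairsℕ e U) * pairs h U
  pairs-pow e h []          = sym (*-identityˡ _)
  pairs-pow e h (true ∷ U)  = trans
    (*-cong (trans (one-* (pow q ∘ e zero ∘ suc) _ U) (*-congʳ (one-pow (e zero ∘ suc) U)))
            (pairs-pow (λ i j → e (suc i) (suc j)) _ U))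
    (trans (solve 4 (λ a b c d → a :* b :* (c :* d) := a :* c :* (b :* d)) refl _ _ _ _)
           (*-congʳ (sym (pow-+ q (oneℕ (e zero ∘ suc) U) (pairsℕ (λ i j → e (suc i) (suc j)) U)))))
  pairs-pow e h (false ∷ U) = pairs-pow (λ i j → e (suc i) (suc j)) _ U

  -- As [j] - [i] = q^i [j ∸ i], this is the q-Vandermonde product stripped of its power of q. Both
  -- halves of the hexagon as well as `Δ` are reduced to it, so that only exponents remain to be
  -- compared.
  gaps : ∀ {n} → Subset n → Carrier
  gaps = pairs (λ i j → [ toℕ j ℕ.∸ toℕ i ])

  -- The relabelling `f` is general because each step of `labels` composes one more `suc` with it.
  prodR-labels : ∀ {n} (g : ℕ → Carrier) (f : ℕ → ℕ) (U : Subset n) →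
    prodR (map g (map f (labels U))) ≈ one (λ i → g (f (suc (toℕ i)))) U
  prodR-labels g f []          = refl
  prodR-labels g f (true ∷ U)  = *-congˡ (trans
    (reflexive (cong (prodR ∘ map g) (≡.sym (Listₚ.map-∘ (labels U))))) (prodR-labels g (f ∘ suc) U))
  prodR-labels g f (false ∷ U) = trans
    (reflexive (cong (prodR ∘ map g) (≡.sym (Listₚ.map-∘ (labels U))))) (prodR-labels g (f ∘ suc) U)

  Δ-map-labels : ∀ {n} (f : ℕ → ℕ) (U : Subset n) →
    Δ q (map f (labels U)) ≈ pairs (λ i j → [ f (suc (toℕ j)) ] - [ f (suc (toℕ i)) ]) U
  Δ-map-labels f []          = refl
  Δ-map-labels f (false ∷ U) = trans (reflexive (cong (Δ q) (≡.sym (Listₚ.map-∘ (labels U))))) (Δ-map-labels (f ∘ suc) U)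
  Δ-map-labels f (true ∷ U)  = *-cong
    (trans (reflexive (cong (λ l → prodR (map (λ s → [ s ] - [ f 1 ]) l)) (≡.sym (Listₚ.map-∘ (labels U)))))
           (prodR-labels (λ s → [ s ] - [ f 1 ]) (f ∘ suc) U))
    (trans (reflexive (cong (Δ q) (≡.sym (Listₚ.map-∘ (labels U))))) (Δ-map-labels (f ∘ suc) U))

  Δ-labels : ∀ {n} (U : Subset n) → Δ q (labels U) ≈ pow q (pairsℕ (λ i j → suc (toℕ i)) U) * gaps U
  Δ-labels U = begin
    Δ q (labels U) ≡⟨ cong (Δ q) (≡.sym (Listₚ.map-id (labels U))) ⟩
    Δ q (map (λ s → s) (labels U)) ≈⟨ Δ-map-labels (λ s → s) U ⟩
    pairs (λ i j → [ suc (toℕ j) ] - [ suc (toℕ i) ]) U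
      ≈⟨ pairs-cong (λ i j lt → []-difference (ℕ.s≤s (ℕₚ.<⇒≤ lt))) U ⟩
    pairs (λ i j → pow q (suc (toℕ i)) * [ toℕ j ℕ.∸ toℕ i ]) U ≈⟨ pairs-pow (λ i j → suc (toℕ i)) _ U ⟩
    _ ∎

  Δ-map-suc : ∀ ss → Δ q (map suc ss) ≈ pow q (choose₂ (length ss)) * Δ q ss
  Δ-map-suc []       = sym (*-identityˡ _)
  Δ-map-suc (s ∷ ss) = trans (*-cong (prod ss) (Δ-map-suc ss))
    (trans (solve 4 (λ a b c d → a :* b :* (c :* d) := a :* c :* (b :* d)) refl _ _ _ _)
           (*-congʳ (sym (pow-+ q (length ss) (choose₂ (length ss))))))
    where
    prod : ∀ ts → prodR (map (λ s′ → [ s′ ] - [ suc s ]) (map suc ts))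
                ≈ pow q (length ts) * prodR (map (λ s′ → [ s′ ] - [ s ]) ts)
    prod []       = sym (*-identityˡ _)
    prod (t ∷ ts) = trans (*-cong (+-cong ([]-suc t) (-‿cong ([]-suc s))) (prod ts))
      (solve 5 (λ q t s p x → (con (+ 1) :+ q :* t :- (con (+ 1) :+ q :* s)) :* (p :* x)
                           := q :* p :* ((t :- s) :* x)) refl q [ t ] [ s ] _ _)

  -- The pairs containing 1 give [s+1] - [1] = q [s] for s = 1, ..., k, that is, q^k times the
  -- q-factorial. The other pairs are those of [k] shifted by one, and each of the `choose₂ k` of
  -- them gains a factor q.
  Δ-range1 : ∀ k → Δ q (range1 (suc k)) ≈ pow q (k ℕ.+ choose₂ k) * factorial k * Δ q (range1 k)
  Δ-range1 k = begin
    prodR (map g (map suc (applyUpTo suc k))) * Δ q (map suc (applyUpTo suc k))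
      ≈⟨ *-congˡ (Δ-map-suc (applyUpTo suc k)) ⟩
    prodR (map g (map suc (applyUpTo suc k))) * (pow q (choose₂ (length (applyUpTo suc k))) * Δ q (applyUpTo suc k))
      ≈⟨ *-cong (top k) (*-cong (pow-≡ (cong choose₂ (Listₚ.length-applyUpTo suc k)))
                                (reflexive (cong (Δ q) (≡.sym (Listₚ.map-applyUpTo (λ x → x) suc k))))) ⟩
    pow q k * factorial k * (pow q (choose₂ k) * Δ q (range1 k))
      ≈⟨ solve 4 (λ a b c d → a :* b :* (c :* d) := a :* c :* b :* d) refl _ _ _ _ ⟩
    pow q k * pow q (choose₂ k) * factorial k * Δ q (range1 k)
      ≈⟨ *-congʳ (*-congʳ (sym (pow-+ q k (choose₂ k)))) ⟩
    _ ∎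
    where
    g : ℕ → Carrier
    g s = [ s ] - [ 1 ]
    top : ∀ k → prodR (map g (map suc (applyUpTo suc k))) ≈ pow q k * factorial k
    top zero    = solve 0 (con (+ 1) := con (+ 1) :* con (+ 1)) refl
    -- The last factor is split off, since `factorial` unfolds from its largest factor.
    top (suc k) = begin
      prodR (map g (map suc (applyUpTo suc (suc k))))
        ≡⟨ cong (λ l → prodR (map g (map suc l))) (≡.sym (Listₚ.applyUpTo-∷ʳ suc k)) ⟩
      prodR (map g (map suc (applyUpTo suc k ++ suc k ∷ [])))
        ≡⟨ cong prodR (≡.trans (cong (map g) (Listₚ.map-++ suc (applyUpTo suc k) _)) (Listₚ.map-++ g (map suc (applyUpTo suc k)) _)) ⟩
      prodR (map g (map suc (applyUpTo suc k)) ++ g (suc (suc k)) ∷ [])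
        ≈⟨ prodR-∷ʳ (map g (map suc (applyUpTo suc k))) _ ⟩
      g (suc (suc k)) * prodR (map g (map suc (applyUpTo suc k)))
        ≈⟨ *-cong (+-cong ([]-suc (suc k)) (-‿cong ([]-suc 0))) (top k) ⟩
      (1# + q * [ suc k ] - (1# + q * 0#)) * (pow q k * factorial k)
        ≈⟨ solve 4 (λ q x p f → (con (+ 1) :+ q :* x :- (con (+ 1) :+ q :* con (+ 0))) :* (p :* f)
                              := q :* p :* (x :* f)) refl q [ suc k ] _ _ ⟩
      pow q (suc k) * factorial (suc k) ∎
      where
      prodR-∷ʳ : ∀ xs y → prodR (xs ++ y ∷ []) ≈ y * prodR xs
      prodR-∷ʳ []       y = refl
      prodR-∷ʳ (x ∷ xs) y = trans (*-congˡ (prodR-∷ʳ xs y))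
        (solve 3 (λ x y z → x :* (y :* z) := y :* (x :* z)) refl x y _)

  -- The upper half of V

  -- This is (-1)^j [u+o][u+o+1]...[u+o+j-1]. The sign of one factor is there to cancel the sign
  -- that `chain-true` puts into each row.
  rising : ℕ → ℕ → ℕ → Carrier
  rising o zero    u = 1#
  rising o (suc j) u = - [ u ℕ.+ o ℕ.+ j ] * rising o j u

  rising-head : ∀ o j u → rising o (suc j) u ≈ - [ u ℕ.+ o ] * rising (suc o) j u
  rising-head o zero    u = *-congʳ (-‿cong ([]-≡ (ℕₚ.+-identityʳ (u ℕ.+ o))))
  rising-head o (suc j) u = trans (*-congˡ (rising-head o j u))
    (trans (solve 3 (λ x y z → x :* (y :* z) := y :* (x :* z)) refl _ _ _)
           (*-congˡ (*-congʳ (-‿cong ([]-≡ (≡.trans (ℕₚ.+-suc (u ℕ.+ o) j) (cong (ℕ._+ j) (≡.sym (ℕₚ.+-suc u o)))))))))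

  rising-suc : ∀ o j u → rising o j (suc u) ≈ rising (suc o) j u
  rising-suc o zero    u = refl
  rising-suc o (suc j) u = *-cong (-‿cong ([]-≡ (cong (ℕ._+ j) (≡.sym (ℕₚ.+-suc u o))))) (rising-suc o j u)

  rise : ℕ → ∀ {n} → ℕ → ℕ → Row n
  rise o i j u = pow q (i ℕ.* toℕ u) * rising o j (toℕ u)

  rise-suc : ∀ o i j {n} (u : Fin n) → rise o i j (suc u) ≈ pow q i * rise (suc o) i j u
  rise-suc o i j u = trans (*-cong (trans (pow-≡ (ℕₚ.*-suc i (toℕ u))) (pow-+ q i (i ℕ.* toℕ u))) (rising-suc o j (toℕ u)))
    (*-assoc _ _ _)

  -- After the common factors are taken out, what is left is [u+j+1] - q^(j+1) [u] = [j+1]. The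
  -- factor q^(iu) in `rise` is chosen so that κ = q^N fits all rows with i + j + 1 = N at once.
  rise-difference : ∀ N {n} i j → i ℕ.+ suc j ≡ N → (u : Fin n) →
    [ suc j ] * pow q i * rise 1 i j u ≈ pow q N * rise 0 i (suc j) (inject₁ u) - 1# * rise 0 i (suc j) (suc u)
  rise-difference N i j eq u = sym (begin
    pow q N * rise 0 i (suc j) (inject₁ u) - 1# * rise 0 i (suc j) (suc u)
      ≈⟨ +-cong (*-cong (trans (pow-≡ (≡.sym eq)) (pow-+ q i (suc j)))
                        (*-cong (pow-≡ (cong (i ℕ.*_) (Finₚ.toℕ-inject₁ u)))
                                (trans (reflexive (cong (rising 0 (suc j)) (Finₚ.toℕ-inject₁ u))) (rising-head 0 j (toℕ u)))))
                (-‿cong (*-congˡ (rise-suc 0 i (suc j) u))) ⟩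
    pow q i * pow q (suc j) * (E * (- [ toℕ u ℕ.+ 0 ] * r)) - 1# * (pow q i * (E * (- [ toℕ u ℕ.+ 1 ℕ.+ j ] * r)))
      ≈⟨ +-cong (*-congˡ (*-congˡ (*-congʳ (-‿cong ([]-≡ (ℕₚ.+-identityʳ (toℕ u)))))))
          (-‿cong (*-congˡ (*-congˡ (*-congˡ (*-congʳ (-‿cong (trans ([]-≡ eq′) ([]-+ (suc j) (toℕ u))))))))) ⟩
    pow q i * pow q (suc j) * (E * (- [ toℕ u ] * r)) - 1# * (pow q i * (E * (- ([ suc j ] + pow q (suc j) * [ toℕ u ]) * r)))
      ≈⟨ solve 6 (λ a b e u r s → a :* b :* (e :* (:- u :* r)) :- con (+ 1) :* (a :* (e :* (:- (s :+ b :* u) :* r)))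
                              := s :* a :* (e :* r)) refl _ _ _ _ _ _ ⟩
    [ suc j ] * pow q i * (E * r) ∎)
    where
    E = pow q (i ℕ.* toℕ u)
    r = rising 1 j (toℕ u)
    eq′ : toℕ u ℕ.+ 1 ℕ.+ j ≡ suc j ℕ.+ toℕ u
    eq′ = ≡.trans (ℕₚ.+-assoc (toℕ u) 1 j) (ℕₚ.+-comm (toℕ u) (suc j))

  -- [u+o+j+1] = [u+o] + q^(u+o) [j+1], and the factor q^u turns i into i + 1. So the correction is
  -- a multiple of the next row of the chain, and a change of offset does not affect the
  -- determinant.
  rise-offset : ∀ o {n} i j (u : Fin n) →
    rise (suc o) i (suc j) u ≈ 1# * rise o i (suc j) u + - (pow q o * [ suc j ]) * rise (suc o) (suc i) j u
  rise-offset o i j u = sym (begin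
    1# * (E * rising o (suc j) (toℕ u)) + - (pow q o * [ suc j ]) * (pow q (toℕ u ℕ.+ i ℕ.* toℕ u) * r)
      ≈⟨ +-cong (*-congˡ (*-congˡ (rising-head o j (toℕ u)))) (*-congˡ (*-congʳ (pow-+ q (toℕ u) (i ℕ.* toℕ u)))) ⟩
    1# * (E * (- [ toℕ u ℕ.+ o ] * r)) + - (pow q o * [ suc j ]) * (pow q (toℕ u) * E * r)
      ≈⟨ solve 6 (λ e x r a b c → con (+ 1) :* (e :* (:- x :* r)) :+ :- (a :* b) :* (c :* e :* r)
                             := e :* (:- (x :+ c :* a :* b) :* r)) refl _ _ _ _ _ _ ⟩
    E * (- ([ toℕ u ℕ.+ o ] + pow q (toℕ u) * pow q o * [ suc j ]) * r)
      ≈⟨ *-congˡ (*-congʳ (-‿cong (trans (+-congˡ (*-congʳ (sym (pow-+ q (toℕ u) o))))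
           (trans (sym ([]-+ (toℕ u ℕ.+ o) (suc j))) ([]-≡ (≡.trans (ℕₚ.+-suc (toℕ u ℕ.+ o) j) (cong (ℕ._+ j) (≡.sym (ℕₚ.+-suc (toℕ u) o))))))))) ⟩
    E * (- [ toℕ u ℕ.+ suc o ℕ.+ j ] * r) ∎)
    where
    E = pow q (i ℕ.* toℕ u)
    r = rising (suc o) j (toℕ u)

  chain-rise-offset : ∀ o {n} i k (U : Subset n) → chain (rise o) i k U ≈ chain (rise 0) i k U
  chain-rise-offset zero i k U = refl
  chain-rise-offset (suc o) i k U = trans
    (chain-rowop (rise o) (rise (suc o)) (λ _ _ → 1#) (λ _ j → - (pow q o * [ suc j ]))
      (λ _ _ → sym (*-identityˡ _)) (rise-offset o) i k U)
    (trans (*-congʳ (trans (∏-const 1# i k) (pow-1 k))) (trans (*-identityˡ _) (chain-rise-offset o i k U)))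

  -- Skipping a column replaces u by u + 1. This multiplies the row with index i by q^i and raises
  -- its offset, and the offset is lowered again by row operations.
  chain-rise-false : ∀ {n} i k (U : Subset n) →
    chain (rise 0) i k (false ∷ U) ≈ pow q (i ℕ.* k ℕ.+ choose₂ k) * chain (rise 0) i k U
  chain-rise-false i k U = begin
    chain (rise 0) i k (false ∷ U) ≈⟨ chain-false (rise 0) i k U ⟩
    chain (λ i j → rise 0 i j ∘ suc) i k U ≈⟨ chain-cong (λ i j → rise-suc 0 i j) i k U ⟩
    chain (λ i j u → pow q i * rise 1 i j u) i k U ≈⟨ chain-scale (rise 1) (λ i _ → pow q i) i k U ⟩
    ∏ (λ i _ → pow q i) i k * chain (rise 1) i k U ≈⟨ *-cong (∏-pow i k) (chain-rise-offset 1 i k U) ⟩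
    _ ∎

  -- Column zero vanishes outside the last row because [0] = 0. In the other rows column u + 1 has
  -- the common factor [u+1], which is the gap between zero and this column.
  chain-rise-true : ∀ {n} i k (U : Subset n) →
    chain (rise 0) i (suc k) (true ∷ U)
      ≈ one (λ u → [ suc (toℕ u) ]) U * (pow q (i ℕ.* k ℕ.+ choose₂ k) * chain (rise 0) i k U)
  chain-rise-true {n} i k U = begin
    chain (rise 0) i (suc k) (true ∷ U) ≈⟨ chain-true (rise 0) rise₀ rise₊ i k U ⟩
    chain (λ i j u → - rise 0 i (suc j) (suc u)) i k U ≈⟨ chain-cong factor i k U ⟩
    chain (λ i j u → [ suc (toℕ u) ] * (pow q i * rise 2 i j u)) i k U
      ≈⟨ chain-weight (λ u → [ suc (toℕ u) ]) (λ i j u → pow q i * rise 2 i j u) i k U ⟩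
    one (λ u → [ suc (toℕ u) ]) U * chain (λ i j u → pow q i * rise 2 i j u) i k U
      ≈⟨ *-congˡ (trans (chain-scale (rise 2) (λ i _ → pow q i) i k U) (*-cong (∏-pow i k) (chain-rise-offset 2 i k U))) ⟩
    _ ∎
    where
    rise₀ : ∀ i → rise 0 {suc n} i 0 zero ≈ 1#
    rise₀ i = trans (*-identityʳ _) (pow-≡ (ℕₚ.*-zeroʳ i))
    rise₊ : ∀ i j → rise 0 {suc n} i (suc j) zero ≈ 0#
    rise₊ i j = trans (*-congˡ (rising-head 0 j 0)) (solve 2 (λ x y → x :* (:- con (+ 0) :* y) := con (+ 0)) refl _ _)
    factor : ∀ i j u → - rise 0 i (suc j) (suc u) ≈ [ suc (toℕ u) ] * (pow q i * rise 2 i j u)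
    factor i j u = begin
      - rise 0 i (suc j) (suc u) ≈⟨ -‿cong (trans (rise-suc 0 i (suc j) u) (*-congˡ (*-congˡ (rising-head 1 j (toℕ u))))) ⟩
      - (pow q i * (pow q (i ℕ.* toℕ u) * (- [ toℕ u ℕ.+ 1 ] * rising 2 j (toℕ u))))
        ≈⟨ solve 4 (λ a b x r → :- (a :* (b :* (:- x :* r))) := x :* (a :* (b :* r))) refl _ _ _ _ ⟩
      [ toℕ u ℕ.+ 1 ] * (pow q i * rise 2 i j u) ≈⟨ *-congʳ ([]-≡ (ℕₚ.+-comm (toℕ u) 1)) ⟩
      _ ∎

  rise-exponent : ∀ {n} (U : Subset n) →
    1 ℕ.* (size U) ℕ.+ choose₂ (size U) ℕ.+ (oneℕ toℕ U ℕ.+ pairsℕ (λ i j → toℕ i) U)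
      ≡ oneℕ (suc ∘ toℕ) U ℕ.+ pairsℕ (λ i j → suc (toℕ i)) U
  rise-exponent U = ≡.trans
    (+-*-Solver.solve 4 (λ k c s p → +-*-Solver.con 1 :*ℕ k :+ℕ c :+ℕ (s :+ℕ p) :=ℕ (k :+ℕ s) :+ℕ (c :+ℕ p)) ≡.refl
      (size U) (choose₂ (size U)) (oneℕ toℕ U) (pairsℕ (λ i j → toℕ i) U))
    (≡.sym (cong₂ ℕ._+_ (oneℕ-suc toℕ U) (pairsℕ-suc (λ i j → toℕ i) U)))
    where
    open +-*-Solver using () renaming (_:+_ to _:+ℕ_; _:=_ to _:=ℕ_; _:*_ to _:*ℕ_)

  chain-rise : ∀ {n} (U : Subset n) →
    chain (rise 0) 1 (size U) U ≈ pow q (oneℕ toℕ U ℕ.+ pairsℕ (λ i j → toℕ i) U) * gaps U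
  chain-rise []          = solve 0 (con (+ 1) := con (+ 1) :* con (+ 1)) refl
  chain-rise (false ∷ U) = begin
    chain (rise 0) 1 (size U) (false ∷ U) ≈⟨ chain-rise-false 1 (size U) U ⟩
    pow q E * chain (rise 0) 1 (size U) U ≈⟨ *-congˡ (chain-rise U) ⟩
    pow q E * (pow q F * gaps U) ≈⟨ sym (*-assoc _ _ _) ⟩
    pow q E * pow q F * gaps U ≈⟨ *-congʳ (trans (sym (pow-+ q E F)) (pow-≡ (rise-exponent U))) ⟩
    _ ∎
    where
    E = 1 ℕ.* (size U) ℕ.+ choose₂ (size U)
    F = oneℕ toℕ U ℕ.+ pairsℕ (λ i j → toℕ i) U
  chain-rise (true ∷ U)  = begin
    chain (rise 0) 1 (suc (size U)) (true ∷ U) ≈⟨ chain-rise-true 1 (size U) U ⟩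
    O * (pow q E * chain (rise 0) 1 (size U) U) ≈⟨ *-congˡ (*-congˡ (chain-rise U)) ⟩
    O * (pow q E * (pow q F * gaps U))
      ≈⟨ solve 4 (λ o e f g → o :* (e :* (f :* g)) := e :* f :* (o :* g)) refl _ _ _ _ ⟩
    pow q E * pow q F * (O * gaps U) ≈⟨ *-congʳ (trans (sym (pow-+ q E F)) (pow-≡ exponent)) ⟩
    _ ∎
    where
    O = one (λ u → [ suc (toℕ u) ]) U
    E = 1 ℕ.* (size U) ℕ.+ choose₂ (size U)
    F = oneℕ toℕ U ℕ.+ pairsℕ (λ i j → toℕ i) U
    exponent : E ℕ.+ F ≡ oneℕ (suc ∘ toℕ) U ℕ.+ (oneℕ (λ _ → 0) U ℕ.+ pairsℕ (λ i j → suc (toℕ i)) U)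
    exponent = ≡.trans (rise-exponent U)
      (cong (λ z → oneℕ (suc ∘ toℕ) U ℕ.+ (z ℕ.+ pairsℕ (λ i j → suc (toℕ i)) U)) (≡.sym (oneℕ-0 U)))

  -- The argument is the set of dents along line k, of length k + a. The right-lozenges of the strip
  -- just above that line weigh q^k.
  upperForm : ∀ a k → Form (k ℕ.+ a)
  upperForm a zero    = 𝟙∅
  upperForm a (suc k) = Interlacing.fresh (pow q (suc k)) 1# (upperForm a k)

  -- `fresh` takes rows of offset 1 to rows of offset 0, which is why the offset is changed before
  -- it is applied. The constants [j+1] q^i of one step multiply up to the factor by which Δ([k+1])
  -- exceeds Δ([k]), so `Δ` is the right normalisation.
  upperForm-chain : ∀ a k U → Δ q (range1 k) * upperForm a k U ≈ chain (rise 0) 1 k U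
  upperForm-chain a zero U = *-identityˡ _
  upperForm-chain a (suc k) U = begin
    Δ q (range1 (suc k)) * fresh (upperForm a k) U
      ≈⟨ *-congʳ (Δ-range1 k) ⟩
    pow q (k ℕ.+ choose₂ k) * factorial k * Δ q (range1 k) * fresh (upperForm a k) U
      ≈⟨ trans (*-assoc _ _ _) (*-congˡ (sym (fresh-scale _ _ U))) ⟩
    pow q (k ℕ.+ choose₂ k) * factorial k * fresh (λ V → Δ q (range1 k) * upperForm a k V) U
      ≈⟨ *-cong (sym constant) (fresh-cong (λ V → trans (upperForm-chain a k V) (sym (chain-rise-offset 1 1 k V))) U) ⟩
    ∏ (λ i j → [ suc j ] * pow q i) 1 k * fresh (chain (rise 1) 1 k) U
      ≈⟨ fresh-chain (rise 1) (rise 0) (λ i j → [ suc j ] * pow q i) (suc k)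
           (rise-difference (suc k)) base 1 k ≡.refl U ⟩
    chain (rise 0) 1 (suc k) U ∎
    where
    open Interlacing (pow q (suc k)) 1#
    base : ∀ V → fresh 𝟙∅ V ≈ (rise 0 (suc k) 0 ⌟ 𝟙∅) V
    base V = trans (fresh-empty V) (⌟-congʳ (λ u → *-cong (pow-* (suc k) (toℕ u)) (pow-1 (k ℕ.+ a ℕ.∸ toℕ u))) V)
    constant : ∏ (λ i j → [ suc j ] * pow q i) 1 k ≈ pow q (k ℕ.+ choose₂ k) * factorial k
    constant = trans (∏-* (λ _ j → [ suc j ]) (λ i _ → pow q i) 1 k)
      (trans (*-cong (∏-[] 1 k) (trans (∏-pow 1 k) (pow-≡ (cong (ℕ._+ choose₂ k) (ℕₚ.*-identityˡ k))))) (*-comm _ _))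

  upperForm-value : ∀ a b (U : Subset (b ℕ.+ a)) → size U ≡ b →
    Δ q (range1 b) * upperForm a b U ≈ pow q (oneℕ toℕ U ℕ.+ pairsℕ (λ i j → toℕ i) U) * gaps U
  upperForm-value a b U eq = trans (upperForm-chain a b U)
    (trans (reflexive (cong (λ k → chain (rise 0) 1 k U) (≡.sym eq))) (chain-rise U))

  upperForm-supported : ∀ a b → Supported (λ U → Δ q (range1 b) * upperForm a b U) b
  upperForm-supported a b U ne = trans (upperForm-chain a b U) (chain-supported (rise 0) 1 b U ne)

  -- The lower half of V

  newton : (ℕ → Carrier) → ∀ {n} → Row n → ℕ → Row n
  newton τ x zero    u = 1#
  newton τ x (suc j) u = (x u - τ j) * newton τ x j u

  newton-suc : ∀ τ {n} (x : Row (suc n)) j u → newton τ x j (suc u) ≈ newton τ (x ∘ suc) j u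
  newton-suc τ x zero    u = refl
  newton-suc τ x (suc j) u = *-congˡ (newton-suc τ x j u)

  -- The value does not depend on the nodes `τ`, since a change of nodes adds to each row a multiple
  -- of the next one. The nodes used later are the q-integers, for which the rows behave well under
  -- differences.
  vandermonde : ∀ τ {n} (x : Row n) i (U : Subset n) →
    chain (λ _ → newton τ x) i (size U) U ≈ pairs (λ i j → x i - x j) U
  vandermonde τ x i []          = refl
  vandermonde τ x i (false ∷ U) = begin
    chain (λ _ → newton τ x) i (size U) (false ∷ U) ≈⟨ chain-false (λ _ → newton τ x) i (size U) U ⟩
    chain (λ _ j → newton τ x j ∘ suc) i (size U) U ≈⟨ chain-cong (λ _ → newton-suc τ x) i (size U) U ⟩
    chain (λ _ → newton τ (x ∘ suc)) i (size U) U ≈⟨ vandermonde τ (x ∘ suc) i U ⟩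
    _ ∎
  vandermonde τ x i (true ∷ U)  = begin
    chain (λ _ → newton τ x) i (suc (size U)) (true ∷ U)
      ≈⟨ chain-rowop (λ _ → inserted) (λ _ → newton τ x) (λ _ _ → 1#) (λ _ j → x zero - τ j)
           (λ _ _ → sym (*-identityˡ _)) (λ _ → relation) i (suc (size U)) (true ∷ U) ⟩
    ∏ (λ _ _ → 1#) i (suc (size U)) * chain (λ _ → inserted) i (suc (size U)) (true ∷ U)
      ≈⟨ *-cong (trans (∏-const 1# i (suc (size U))) (pow-1 (suc (size U))))
                (chain-true (λ _ → inserted) (λ _ → refl) (λ _ j → trans (*-congʳ (-‿inverseʳ _)) (zeroˡ _)) i (size U) U) ⟩
    1# * chain (λ _ j u → - inserted (suc j) (suc u)) i (size U) U
      ≈⟨ trans (*-identityˡ _) (chain-cong (λ _ → factor) i (size U) U) ⟩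
    chain (λ _ j u → (x zero - x (suc u)) * newton τ (x ∘ suc) j u) i (size U) U
      ≈⟨ chain-weight (λ u → x zero - x (suc u)) (λ _ → newton τ (x ∘ suc)) i (size U) U ⟩
    one (λ u → x zero - x (suc u)) U * chain (λ _ → newton τ (x ∘ suc)) i (size U) U
      ≈⟨ *-congˡ (vandermonde τ (x ∘ suc) i U) ⟩
    _ ∎
    where
    -- The Newton basis with x zero inserted as a first node: all but its first row vanish at zero.
    inserted : ℕ → Row _
    inserted zero    u = 1#
    inserted (suc j) u = (x u - x zero) * newton τ x j u
    relation : ∀ j u → newton τ x (suc j) u ≈ 1# * inserted (suc j) u + (x zero - τ j) * newton τ x j u
    relation j u = solve 4 (λ x t z e → (x :- t) :* e := con (+ 1) :* ((x :- z) :* e) :+ (z :- t) :* e) refl _ _ _ _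
    factor : ∀ j u → - inserted (suc j) (suc u) ≈ (x zero - x (suc u)) * newton τ (x ∘ suc) j u
    factor j u = trans (-‿cong (*-congˡ (newton-suc τ x j u)))
      (solve 3 (λ x z e → :- ((x :- z) :* e) := (z :- x) :* e) refl _ _ _)

  falling : ℕ → ℕ → Carrier
  falling zero    d = 1#
  falling (suc j) d = ([ d ] - [ j ]) * falling j d

  falling-suc : ∀ j d → falling (suc j) (suc d) ≈ [ suc d ] * pow q j * falling j d
  falling-suc zero    d = solve 1 (λ x → (x :- con (+ 0)) :* con (+ 1) := x :* con (+ 1) :* con (+ 1)) refl _
  falling-suc (suc j) d = begin
    ([ suc d ] - [ suc j ]) * falling (suc j) (suc d)
      ≈⟨ *-cong (+-cong ([]-suc d) (-‿cong ([]-suc j))) (falling-suc j d) ⟩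
    (1# + q * [ d ] - (1# + q * [ j ])) * ([ suc d ] * pow q j * falling j d)
      ≈⟨ solve 6 (λ q d j s p f → (con (+ 1) :+ q :* d :- (con (+ 1) :+ q :* j)) :* (s :* p :* f)
                              := s :* (q :* p) :* ((d :- j) :* f)) refl q [ d ] [ j ] _ _ _ ⟩
    [ suc d ] * pow q (suc j) * falling (suc j) d ∎

  -- The q-analogue of the difference rule for falling factorials. It rests on [j] + q^j [d+1] = [d]
  -- + q^d [j+1], both sides being [d+j+1].
  falling-difference : ∀ j d → falling (suc j) (suc d) - falling (suc j) d ≈ pow q d * [ suc j ] * falling j d
  falling-difference j d = begin
    falling (suc j) (suc d) - falling (suc j) d ≈⟨ +-congʳ (falling-suc j d) ⟩
    [ suc d ] * pow q j * falling j d - ([ d ] - [ j ]) * falling j d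
      ≈⟨ solve 5 (λ s p f d j → s :* p :* f :- (d :- j) :* f := (j :+ p :* s :- d) :* f) refl _ _ _ _ _ ⟩
    ([ j ] + pow q j * [ suc d ] - [ d ]) * falling j d
      ≈⟨ *-congʳ (+-congʳ (trans (sym ([]-+ j (suc d))) (trans ([]-≡ eq) ([]-+ d (suc j))))) ⟩
    ([ d ] + pow q d * [ suc j ] - [ d ]) * falling j d
      ≈⟨ solve 3 (λ d x f → (d :+ x :- d) :* f := x :* f) refl _ _ _ ⟩
    _ ∎
    where
    eq : j ℕ.+ suc d ≡ d ℕ.+ suc j
    eq = ≡.trans (ℕₚ.+-comm j (suc d)) (≡.sym (ℕₚ.+-suc d j))

  -- Columns are counted from the right end because that is where the weight ƛ = y accumulates in
  -- `fresh-empty`.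
  fall : Carrier → ∀ n → ℕ → Row n
  fall y n j u = pow y (n ℕ.∸ suc (toℕ u)) * falling j (n ℕ.∸ suc (toℕ u))

  -- The difference of the falling factorials produces q^d, which is absorbed by passing from the
  -- base y to q y. With y = q^i this is precisely the change of weight from one strip to the strip
  -- below.
  fall-difference : ∀ y n j (u : Fin n) →
    y * [ suc j ] * fall (q * y) n j u ≈ 1# * fall y (suc n) (suc j) (inject₁ u) - y * fall y (suc n) (suc j) (suc u)
  fall-difference y n j u = sym (begin
    1# * fall y (suc n) (suc j) (inject₁ u) - y * fall y (suc n) (suc j) (suc u)
      ≈⟨ +-congʳ (*-congˡ (reflexive (cong (λ t → pow y t * falling (suc j) t)
           (≡.trans (cong (n ℕ.∸_) (Finₚ.toℕ-inject₁ u)) n∸u)))) ⟩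
    1# * (pow y (suc d) * falling (suc j) (suc d)) - y * (pow y d * falling (suc j) d)
      ≈⟨ solve 4 (λ y p a b → con (+ 1) :* (y :* p :* a) :- y :* (p :* b) := y :* p :* (a :- b)) refl y _ _ _ ⟩
    y * pow y d * (falling (suc j) (suc d) - falling (suc j) d) ≈⟨ *-congˡ (falling-difference j d) ⟩
    y * pow y d * (pow q d * [ suc j ] * falling j d)
      ≈⟨ solve 5 (λ y p r s f → y :* p :* (r :* s :* f) := y :* s :* (r :* p :* f)) refl y _ _ _ _ ⟩
    y * [ suc j ] * (pow q d * pow y d * falling j d) ≈⟨ *-congˡ (*-congʳ (sym (pow-distrib d))) ⟩
    _ ∎)
    where
    d = n ℕ.∸ suc (toℕ u)
    n∸u : n ℕ.∸ toℕ u ≡ suc d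
    n∸u = ℕₚ.+-∸-assoc 1 (Finₚ.toℕ<n u)
    pow-distrib : ∀ d → pow (q * y) d ≈ pow q d * pow y d
    pow-distrib zero    = sym (*-identityˡ _)
    pow-distrib (suc d) = trans (*-congˡ (pow-distrib d))
      (solve 4 (λ a b c d → a :* b :* (c :* d) := a :* c :* (b :* d)) refl _ _ _ _)

  -- `i` is the depth of the bottom of the first strip, whose right-lozenges weigh q^i; `k` is the
  -- number of strips, and `z` the length of the bottom side of the hexagon.
  lowerForm : ∀ z → ℕ → ∀ k → Form (k ℕ.+ z)
  lowerForm z i zero    = 𝟙∅
  lowerForm z i (suc k) = Interlacing.fresh 1# (pow q i) (lowerForm z (suc i) k)

  -- The exponent `i * choose₂ k` is what the recursion forces: a step needs q^((i+1)k) from the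
  -- factors y, and the next form comes with (i+1) `choose₂` k, whereas passing to Δ([k+1]) supplies
  -- only k + `choose₂` k. The difference is i `choose₂` (k+1).
  lowerForm-chain : ∀ z i k U →
    Δ q (range1 k) * pow q (i ℕ.* choose₂ k) * lowerForm z (suc i) k U
      ≈ chain (λ _ → fall (pow q (suc i)) (k ℕ.+ z)) 0 k U
  lowerForm-chain z i zero U = trans (*-congʳ (*-congˡ (pow-≡ (ℕₚ.*-zeroʳ i))))
    (solve 1 (λ x → con (+ 1) :* con (+ 1) :* x := x) refl _)
  lowerForm-chain z i (suc k) U = begin
    Δ q (range1 (suc k)) * pow q (i ℕ.* choose₂ (suc k)) * fresh (lowerForm z (suc (suc i)) k) U
      ≈⟨ *-congʳ (*-congʳ (Δ-range1 k)) ⟩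
    pow q (k ℕ.+ choose₂ k) * factorial k * Δ q (range1 k) * pow q (i ℕ.* choose₂ (suc k)) * X
      ≈⟨ solve 5 (λ a b c d e → a :* b :* c :* d :* e := b :* (a :* d) :* c :* e) refl _ _ _ _ _ ⟩
    factorial k * (pow q (k ℕ.+ choose₂ k) * pow q (i ℕ.* choose₂ (suc k))) * Δ q (range1 k) * X
      ≈⟨ *-congʳ (*-congʳ (*-congˡ exponent)) ⟩
    factorial k * (pow q (suc i ℕ.* k) * pow q (suc i ℕ.* choose₂ k)) * Δ q (range1 k) * X
      ≈⟨ solve 5 (λ a b c d e → a :* (b :* c) :* d :* e := b :* a :* ((d :* c) :* e)) refl _ _ _ _ _ ⟩
    pow q (suc i ℕ.* k) * factorial k * ((Δ q (range1 k) * pow q (suc i ℕ.* choose₂ k)) * X)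
      ≈⟨ *-cong (sym constant) (trans (sym (fresh-scale _ _ U)) (fresh-cong (lowerForm-chain z (suc i) k) U)) ⟩
    ∏ (λ _ j → y * [ suc j ]) 0 k * fresh (chain (λ _ → fall (q * y) (k ℕ.+ z)) 0 k) U
      ≈⟨ fresh-chain (λ _ → fall (q * y) (k ℕ.+ z)) (λ _ → fall y (suc (k ℕ.+ z))) (λ _ j → y * [ suc j ]) k
           (λ _ j _ → fall-difference y (k ℕ.+ z) j) base 0 k ≡.refl U ⟩
    chain (λ _ → fall y (suc k ℕ.+ z)) 0 (suc k) U ∎
    where
    y = pow q (suc i)
    open Interlacing 1# y
    X = fresh (lowerForm z (suc (suc i)) k) U
    exponent : pow q (k ℕ.+ choose₂ k) * pow q (i ℕ.* choose₂ (suc k)) ≈ pow q (suc i ℕ.* k) * pow q (suc i ℕ.* choose₂ k)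
    exponent = trans (sym (pow-+ q (k ℕ.+ choose₂ k) (i ℕ.* choose₂ (suc k)))) (trans
      (pow-≡ (≡.trans (cong (suc i ℕ.*_) ≡.refl) (ℕₚ.*-distribˡ-+ (suc i) k (choose₂ k))))
      (pow-+ q (suc i ℕ.* k) (suc i ℕ.* choose₂ k)))
    constant : ∏ (λ _ j → y * [ suc j ]) 0 k ≈ pow q (suc i ℕ.* k) * factorial k
    constant = trans (∏-* (λ _ _ → y) (λ _ j → [ suc j ]) 0 k)
      (*-cong (trans (∏-const y 0 k) (pow-* (suc i) k)) (∏-[] 0 k))
    base : ∀ V → fresh 𝟙∅ V ≈ (fall y (suc (k ℕ.+ z)) 0 ⌟ 𝟙∅) V
    base V = trans (fresh-empty V) (⌟-congʳ (λ u → trans (*-congʳ (pow-1 (toℕ u))) (*-comm _ _)) V)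

  complement-difference : ∀ n a b → a ℕ.≤ b → b ℕ.≤ n → (n ℕ.∸ a) ℕ.∸ (n ℕ.∸ b) ≡ b ℕ.∸ a
  complement-difference n a b a≤b b≤n = ≡.trans
    (cong (λ t → t ℕ.∸ a ℕ.∸ (n ℕ.∸ b)) (≡.sym (ℕₚ.m∸n+n≡m b≤n)))
    (≡.trans (cong (ℕ._∸ (n ℕ.∸ b)) (ℕₚ.+-∸-assoc (n ℕ.∸ b) a≤b)) (ℕₚ.m+n∸m≡n (n ℕ.∸ b) (b ℕ.∸ a)))

  depth : ∀ n → Fin n → ℕ
  depth n u = n ℕ.∸ suc (toℕ u)

  -- `falling` is the Newton basis in the variable [d] with nodes [0], [1], .... Pulling the powers
  -- of q^i out of the columns therefore leaves a Vandermonde determinant.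
  chain-fall : ∀ i n (U : Subset n) →
    chain (λ _ → fall (pow q i) n) 0 (size U) U
      ≈ pow q (oneℕ (λ u → i ℕ.* depth n u) U ℕ.+ pairsℕ (λ _ v → depth n v) U) * gaps U
  chain-fall i n U = begin
    chain (λ _ → fall (pow q i) n) 0 (size U) U
      ≈⟨ chain-cong (λ _ j u → *-cong (pow-* i (depth n u)) (falling-newton j u)) 0 (size U) U ⟩
    chain (λ _ j u → pow q (i ℕ.* depth n u) * newton [_] x j u) 0 (size U) U
      ≈⟨ chain-weight _ (λ _ → newton [_] x) 0 (size U) U ⟩
    one (λ u → pow q (i ℕ.* depth n u)) U * chain (λ _ → newton [_] x) 0 (size U) U
      ≈⟨ *-cong (one-pow (λ u → i ℕ.* depth n u) U) (trans (vandermonde [_] x 0 U) (pairs-cong gap U)) ⟩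
    pow q A * pairs (λ u v → pow q (depth n v) * [ toℕ v ℕ.∸ toℕ u ]) U
      ≈⟨ *-congˡ (pairs-pow (λ _ v → depth n v) _ U) ⟩
    pow q A * (pow q B * gaps U) ≈⟨ trans (sym (*-assoc _ _ _)) (*-congʳ (sym (pow-+ q A B))) ⟩
    _ ∎
    where
    A = oneℕ (λ u → i ℕ.* depth n u) U
    B = pairsℕ (λ _ v → depth n v) U
    x : Row n
    x u = [ depth n u ]
    falling-newton : ∀ j u → falling j (depth n u) ≈ newton [_] x j u
    falling-newton zero    u = refl
    falling-newton (suc j) u = *-congˡ (falling-newton j u)
    gap : ∀ u v → toℕ u ℕ.< toℕ v → x u - x v ≈ pow q (depth n v) * [ toℕ v ℕ.∸ toℕ u ]
    gap u v lt = trans ([]-difference (ℕₚ.∸-monoʳ-≤ n (ℕ.s≤s (ℕₚ.<⇒≤ lt))))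
      (*-congˡ ([]-≡ (complement-difference n (suc (toℕ u)) (suc (toℕ v)) (ℕ.s≤s (ℕₚ.<⇒≤ lt)) (Finₚ.toℕ<n v))))

  lowerForm-value : ∀ z b c (U : Subset (c ℕ.+ z)) → size U ≡ c →
    Δ q (range1 c) * pow q (b ℕ.* choose₂ c) * lowerForm z (suc b) c U
      ≈ pow q (oneℕ (λ u → suc b ℕ.* depth (c ℕ.+ z) u) U ℕ.+ pairsℕ (λ _ v → depth (c ℕ.+ z) v) U) * gaps U
  lowerForm-value z b c U eq = trans (lowerForm-chain z b c U)
    (trans (reflexive (cong (λ k → chain (λ _ → fall (pow q (suc b)) (c ℕ.+ z)) 0 k U) (≡.sym eq)))
           (chain-fall (suc b) (c ℕ.+ z) U))

∧-trueˡ : ∀ {x y} → x ∧ y ≡ true → x ≡ true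
∧-trueˡ {true} _ = ≡.refl

-- Tilings as exact covers

≟T-refl : ∀ t → ⌊ t ≟T t ⌋ ≡ true
≟T-refl t with t ≟T t
... | yes _ = ≡.refl
... | no ne = ⊥-elim (ne ≡.refl)

≟T-≢ : ∀ {t u} → t ≢ u → ⌊ t ≟T u ⌋ ≡ false
≟T-≢ {t} {u} ne with t ≟T u
... | yes eq = ⊥-elim (ne eq)
... | no _   = ≡.refl

covers-up : ∀ L → covers L (proj₂ L) ≡ true
covers-up L rewrite ≟T-refl (proj₂ L) = ≡.refl

covers-partner : ∀ L → covers L (partner L) ≡ true
covers-partner L rewrite ≟T-refl (partner L) = Boolₚ.∨-zeroʳ _

covers-other : ∀ L {t} → t ≢ proj₂ L → t ≢ partner L → covers L t ≡ false
covers-other L ne ne′ rewrite ≟T-≢ ne | ≟T-≢ ne′ = ≡.refl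

covers-true : ∀ L {t} → covers L t ≡ true → t ≡ proj₂ L ⊎ t ≡ partner L
covers-true L {t} e with t ≟T proj₂ L | t ≟T partner L
... | yes eq | _      = inj₁ eq
... | no _   | yes eq = inj₂ eq

module _ {A : Set} where

  filter-++ : ∀ (p : A → Bool) xs ys → filter p (xs ++ ys) ≡ filter p xs ++ filter p ys
  filter-++ p []       ys = ≡.refl
  filter-++ p (x ∷ xs) ys with p x
  ... | true  = cong (x ∷_) (filter-++ p xs ys)
  ... | false = filter-++ p xs ys

  filter-map : ∀ {B : Set} (p : A → Bool) (f : B → A) xs → filter p (map f xs) ≡ map f (filter (p ∘ f) xs)
  filter-map p f []       = ≡.refl
  filter-map p f (x ∷ xs) with p (f x)
  ... | true  = cong (f x ∷_) (filter-map p f xs)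
  ... | false = filter-map p f xs

  filter-cong : ∀ {p p′ : A → Bool} → (∀ x → p x ≡ p′ x) → ∀ xs → filter p xs ≡ filter p′ xs
  filter-cong e []       = ≡.refl
  filter-cong {p} {p′} e (x ∷ xs) rewrite e x with p′ x
  ... | true  = cong (x ∷_) (filter-cong e xs)
  ... | false = filter-cong e xs

  filter-none : ∀ {p : A → Bool} {xs} → All (λ x → p x ≡ false) xs → filter p xs ≡ []
  filter-none []                   = ≡.refl
  filter-none {p} (e ∷ es) rewrite e = filter-none es

  all-cong : ∀ {p p′ : A → Bool} xs → All (λ x → p x ≡ p′ x) xs → all p xs ≡ all p′ xs
  all-cong []       []       = ≡.refl
  all-cong (x ∷ xs) (e ∷ es) = cong₂ _∧_ e (all-cong xs es)

  All-filter : ∀ {P : A → Set} p {xs} → All P xs → All P (filter p xs)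
  All-filter p []                  = []
  All-filter p {x ∷ xs} (px ∷ pxs) with p x
  ... | true  = px ∷ All-filter p pxs
  ... | false = All-filter p pxs

  filter-true : ∀ p (xs : List A) → All (λ x → p x ≡ true) (filter p xs)
  filter-true p []       = []
  filter-true p (x ∷ xs) with p x in eq
  ... | true  = eq ∷ filter-true p xs
  ... | false = filter-true p xs

  AllPairs-filter : ∀ {_∼_ : A → A → Set} p {xs} → AllPairs _∼_ xs → AllPairs _∼_ (filter p xs)
  AllPairs-filter p []                    = []
  AllPairs-filter p {x ∷ xs} (ax ∷ axs) with p x
  ... | true  = All-filter p ax ∷ AllPairs-filter p axs
  ... | false = AllPairs-filter p axs

all-false : ∀ (p : Tri → Bool) G {t} → t ∈ᵇ G ≡ true → p t ≡ false → all p G ≡ false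
all-false p (u ∷ G) {t} t∈ pt with t ≟T u
... | yes ≡.refl rewrite pt = ≡.refl
... | no _ rewrite all-false p G t∈ pt = Boolₚ.∧-zeroʳ _

∈ᵇ-all : ∀ G → All (λ t → t ∈ᵇ G ≡ true) G
∈ᵇ-all []      = []
∈ᵇ-all (t ∷ G) = (cong (_∨ (t ∈ᵇ G)) (≟T-refl t))
               ∷ All.map (λ {u} e → ≡.trans (cong (⌊ u ≟T t ⌋ ∨_) e) (Boolₚ.∨-zeroʳ _)) (∈ᵇ-all G)

%2-suc : ∀ n → (suc n ℕ.% 2 ≡ᵇ 0) ≡ not (n ℕ.% 2 ≡ᵇ 0)
%2-suc zero          = ≡.refl
%2-suc (suc zero)    = ≡.refl
%2-suc (suc (suc n)) = %2-suc n

even-suc : ∀ i → (ℤ.∣ i ℤ.+ + 1 ∣ ℕ.% 2 ≡ᵇ 0) ≡ not (ℤ.∣ i ∣ ℕ.% 2 ≡ᵇ 0)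
even-suc (+ n) rewrite ℕₚ.+-comm n 1 = %2-suc n
even-suc -[1+ zero ]  = ≡.refl
even-suc -[1+ suc n ] = ≡.trans (≡.sym (Boolₚ.not-involutive _)) (cong not (≡.sym (%2-suc (suc n))))

isUp-down : ∀ r j → isUp (r ℤ.+ + 1 , j) ≡ not (isUp (r , j))
isUp-down r j = ≡.trans (cong (λ i → ℤ.∣ i ∣ ℕ.% 2 ≡ᵇ 0)
  (≡.trans (ℤₚ.+-assoc r (+ 1) j) (≡.trans (cong (λ i → r ℤ.+ i) (ℤₚ.+-comm (+ 1) j)) (≡.sym (ℤₚ.+-assoc r j (+ 1))))))
  (even-suc (r ℤ.+ j))

isUp-right : ∀ r j → isUp (r , j ℤ.+ + 1) ≡ not (isUp (r , j))
isUp-right r j = ≡.trans (cong (λ i → ℤ.∣ i ∣ ℕ.% 2 ≡ᵇ 0) (≡.sym (ℤₚ.+-assoc r j (+ 1)))) (even-suc (r ℤ.+ j))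

i-1+1 : ∀ j → (j ℤ.- + 1) ℤ.+ + 1 ≡ j
i-1+1 j = ≡.trans (ℤₚ.+-assoc j _ _) (ℤₚ.+-identityʳ j)

isUp-left : ∀ r j → isUp (r , j ℤ.- + 1) ≡ not (isUp (r , j))
isUp-left r j = ≡.trans (≡.sym (Boolₚ.not-involutive _))
  (cong not (≡.trans (≡.sym (isUp-right r (j ℤ.- + 1))) (cong (λ i → isUp (r , i)) (i-1+1 j))))

isUp-partner : ∀ L → isUp (proj₂ L) ≡ true → isUp (partner L) ≡ false
isUp-partner (vert  , (r , j)) up = ≡.trans (isUp-down r j) (cong not up)
isUp-partner (right , (r , j)) up = ≡.trans (isUp-right r j) (cong not up)
isUp-partner (left  , (r , j)) up = ≡.trans (isUp-left r j) (cong not up)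

up≢partner : ∀ {u} L → isUp u ≡ true → isUp (proj₂ L) ≡ true → u ≢ partner L
up≢partner L up up′ ≡.refl with ≡.trans (≡.sym up) (isUp-partner L up′)
... | ()

-- δ t = true means that t is still to be covered.
Demand : Set
Demand = Tri → Bool

infixl 6 _∖_
_∖_ : Demand → Lozenge → Demand
(δ ∖ L) t = δ t ∧ not (covers L t)

∖-other : ∀ δ L {t} → t ≢ proj₂ L → t ≢ partner L → (δ ∖ L) t ≡ δ t
∖-other δ L ne ne′ rewrite covers-other L ne ne′ = Boolₚ.∧-identityʳ _

∖-up : ∀ δ L → (δ ∖ L) (proj₂ L) ≡ false
∖-up δ L rewrite covers-up L = Boolₚ.∧-zeroʳ _

∖-partner : ∀ δ L → (δ ∖ L) (partner L) ≡ false
∖-partner δ L rewrite covers-partner L = Boolₚ.∧-zeroʳ _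

demand : Bool → ℕ
demand true  = 1
demand false = 0

count : Tri → List Lozenge → ℕ
count t S = length (filter (λ L → covers L t) S)

module Cover {ℓ₁ ℓ₂} (R : CommutativeRing ℓ₁ ℓ₂) (w : Lozenge → CommutativeRing.Carrier R) (G : List Tri) where
  open CommutativeRing R hiding (zero)
  open RingDefs R
  open import Relation.Binary.Reasoning.Setoid setoid
  open IntegerSolver R

  matches : Demand → List Lozenge → Bool
  matches δ S = all (λ t → count t S ≡ᵇ demand (δ t)) G

  weight : List Lozenge → Carrier
  weight S = prodR (map w S)

  covering : List Lozenge → Demand → Carrier
  covering Ls δ = sumR (map weight (filter (matches δ) (sublists Ls)))

  when : Bool → Carrier → Carrier
  when b x = if b then x else 0#

  sumR-++ : ∀ xs ys → sumR (xs ++ ys) ≈ sumR xs + sumR ys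
  sumR-++ []       ys = sym (+-identityˡ _)
  sumR-++ (x ∷ xs) ys = trans (+-congˡ (sumR-++ xs ys)) (sym (+-assoc _ _ _))

  sumR-weight-∷ : ∀ L Ss → sumR (map weight (map (L ∷_) Ss)) ≈ w L * sumR (map weight Ss)
  sumR-weight-∷ L []       = sym (zeroʳ _)
  sumR-weight-∷ L (S ∷ Ss) = trans (+-congˡ (sumR-weight-∷ L Ss)) (sym (distribˡ _ _ _))

  matches-used : ∀ δ L S → δ (proj₂ L) ≡ true → δ (partner L) ≡ true → matches δ (L ∷ S) ≡ matches (δ ∖ L) S
  matches-used δ L S δu δp = all-cong G (All.universal pointwise G)
    where
    demanded : ∀ {t} → covers L t ≡ true → δ t ≡ true
    demanded {t} e with covers-true L {t} e
    ... | inj₁ ≡.refl = δu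
    ... | inj₂ ≡.refl = δp
    pointwise : ∀ t → (count t (L ∷ S) ≡ᵇ demand (δ t)) ≡ (count t S ≡ᵇ demand ((δ ∖ L) t))
    pointwise t with covers L t in eq
    ... | true rewrite demanded {t} eq = ≡.refl
    ... | false rewrite Boolₚ.∧-identityʳ (δ t) = ≡.refl

  matches-unused : ∀ δ L S {t} → t ∈ᵇ G ≡ true → covers L t ≡ true → δ t ≡ false → matches δ (L ∷ S) ≡ false
  matches-unused δ L S {t} t∈G c δt = all-false _ G t∈G lemma
    where
    lemma : (count t (L ∷ S) ≡ᵇ demand (δ t)) ≡ false
    lemma rewrite c | δt = ≡.refl

  Sub : Demand → Set
  Sub δ = ∀ t → δ t ≡ true → t ∈ᵇ G ≡ true

  Sub-∖ : ∀ {δ} L → Sub δ → Sub (δ ∖ L)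
  Sub-∖ L sub t e = sub t (∧-trueˡ e)

  covering-∷ : ∀ L Ls δ → proj₂ L ∈ᵇ G ≡ true → partner L ∈ᵇ G ≡ true →
    covering (L ∷ Ls) δ ≈ covering Ls δ + when (δ (proj₂ L)) (when (δ (partner L)) (w L * covering Ls (δ ∖ L)))
  covering-∷ L Ls δ u∈G p∈G = begin
    sumR (map weight (filter (matches δ) (sublists Ls ++ map (L ∷_) (sublists Ls))))
      ≡⟨ cong (sumR ∘ map weight) (filter-++ (matches δ) (sublists Ls) _) ⟩
    sumR (map weight (filter (matches δ) (sublists Ls) ++ filter (matches δ) (map (L ∷_) (sublists Ls))))
      ≡⟨ cong sumR (Data.List.Properties.map-++ weight (filter (matches δ) (sublists Ls)) _) ⟩
    sumR (map weight (filter (matches δ) (sublists Ls)) ++ map weight (filter (matches δ) (map (L ∷_) (sublists Ls))))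
      ≈⟨ sumR-++ (map weight (filter (matches δ) (sublists Ls))) _ ⟩
    covering Ls δ + sumR (map weight (filter (matches δ) (map (L ∷_) (sublists Ls))))
      ≈⟨ +-congˡ (trans (reflexive (cong (sumR ∘ map weight) (filter-map (matches δ) (L ∷_) (sublists Ls)))) using-L) ⟩
    _ ∎
    where
    import Data.List.Properties
    none : (∀ S → matches δ (L ∷ S) ≡ false) →
      sumR (map weight (map (L ∷_) (filter (matches δ ∘ (L ∷_)) (sublists Ls)))) ≈ 0#
    none e = reflexive (cong (λ Ss → sumR (map weight (map (L ∷_) Ss))) (filter-none (All.universal e (sublists Ls))))
    using-L : sumR (map weight (map (L ∷_) (filter (matches δ ∘ (L ∷_)) (sublists Ls))))
            ≈ when (δ (proj₂ L)) (when (δ (partner L)) (w L * covering Ls (δ ∖ L)))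
    using-L with δ (proj₂ L) in δu | δ (partner L) in δp
    ... | false | _     = none (λ S → matches-unused δ L S u∈G (covers-up L) δu)
    ... | true  | false = none (λ S → matches-unused δ L S p∈G (covers-partner L) δp)
    ... | true  | true  = trans
      (reflexive (cong (λ Ss → sumR (map weight (map (L ∷_) Ss)))
         (filter-cong (λ S → matches-used δ L S δu δp) (sublists Ls))))
      (sumR-weight-∷ L (filter (matches (δ ∖ L)) (sublists Ls)))

  inside : List Lozenge → List Lozenge
  inside = filter (λ L → partner L ∈ᵇ G)

  -- A lozenge that leaves `G` is dropped from the list. The formula still holds for it, because by
  -- `Sub δ` its partner is not demanded.
  covering-inside : ∀ L Ls δ → Sub δ → proj₂ L ∈ᵇ G ≡ true →
    covering (inside (L ∷ Ls)) δ
      ≈ covering (inside Ls) δ + when (δ (proj₂ L)) (when (δ (partner L)) (w L * covering (inside Ls) (δ ∖ L)))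
  covering-inside L Ls δ sub u∈G with partner L ∈ᵇ G in p∈G
  ... | true  = covering-∷ L (inside Ls) δ u∈G p∈G
  ... | false with δ (proj₂ L) | δ (partner L) in δp
  ...   | false | _     = sym (+-identityʳ _)
  ...   | true  | false = sym (+-identityʳ _)
  ...   | true  | true with ≡.trans (≡.sym p∈G) (sub _ δp)
  ...     | ()

  covering-dead : ∀ Ls δ {t} → t ∈ᵇ G ≡ true → δ t ≡ true → All (λ L → covers L t ≡ false) Ls → covering Ls δ ≈ 0#
  covering-dead Ls δ {t} t∈G δt uncovered =
    reflexive (cong (sumR ∘ map weight) (filter-none (All.map (λ {S} → mismatch {S}) (counts Ls uncovered))))
    where
    counts : ∀ Ls → All (λ L → covers L t ≡ false) Ls → All (λ S → count t S ≡ 0) (sublists Ls)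
    counts []       []       = ≡.refl ∷ []
    counts (L ∷ Ls) (e ∷ es) = Allₚ.++⁺ (counts Ls es) (Allₚ.map⁺ (All.map (λ {S} → add {S}) (counts Ls es)))
      where
      add : ∀ {S} → count t S ≡ 0 → count t (L ∷ S) ≡ 0
      add c rewrite e = c
    mismatch : ∀ {S} → count t S ≡ 0 → matches δ S ≡ false
    mismatch {S} c = all-false _ G t∈G lemma
      where
      lemma : (count t S ≡ᵇ demand (δ t)) ≡ false
      lemma rewrite c | δt = ≡.refl

  candidates : Tri → List Lozenge
  candidates t = (vert , t) ∷ (right , t) ∷ (left , t) ∷ []

  -- Each up-pointing triangle in turn chooses its partner.
  sweep : List Tri → Demand → Carrier
  sweep []       δ = covering [] δ
  sweep (u ∷ us) δ = option vert + (option right + option left)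
    where
    option : Kind → Carrier
    option k = when (δ (partner (k , u))) (w (k , u) * sweep us (δ ∖ (k , u)))

  -- The three candidates at u are consecutive in the list. Once one of them is used, u is no longer
  -- demanded and the other two drop out (`skip`). If none is used, u stays uncovered, because all
  -- later candidates consist of another up-pointing triangle and a down-pointing one (`dead`).
  covering-sweep : ∀ us δ → Sub δ → All (λ u → u ∈ᵇ G ≡ true) us → All (λ u → isUp u ≡ true) us →
    All (λ u → δ u ≡ true) us → AllPairs _≢_ us → covering (inside (concatMap candidates us)) δ ≈ sweep us δ
  covering-sweep [] δ sub [] [] [] [] = refl
  covering-sweep (u ∷ us) δ sub (u∈ ∷ us∈) (up ∷ ups) (δu ∷ δus) (u≢ ∷ distinct) = begin
    covering (inside (Kᵛ ∷ Kʳ ∷ Kˡ ∷ Ls)) δ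
      ≈⟨ pick Kᵛ (Kʳ ∷ Kˡ ∷ Ls) ≡.refl ⟩
    covering (inside (Kʳ ∷ Kˡ ∷ Ls)) δ + use Kᵛ (Kʳ ∷ Kˡ ∷ Ls)
      ≈⟨ +-cong (trans (pick Kʳ (Kˡ ∷ Ls) ≡.refl) (+-congʳ (trans (pick Kˡ Ls ≡.refl) (+-congʳ dead))))
                (use-cong Kᵛ (trans (skip Kʳ Kᵛ (Kˡ ∷ Ls) ≡.refl ≡.refl) (skip Kˡ Kᵛ Ls ≡.refl ≡.refl))) ⟩
    0# + use Kˡ Ls + use Kʳ (Kˡ ∷ Ls) + use Kᵛ Ls
      ≈⟨ +-congʳ (+-congˡ (use-cong Kʳ (skip Kˡ Kʳ Ls ≡.refl ≡.refl))) ⟩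
    0# + use Kˡ Ls + use Kʳ Ls + use Kᵛ Ls
      ≈⟨ solve 3 (λ l q v → con (+ 0) :+ l :+ q :+ v := v :+ (q :+ l)) refl _ _ _ ⟩
    use Kᵛ Ls + (use Kʳ Ls + use Kˡ Ls)
      ≈⟨ +-cong (use-cong Kᵛ (rec Kᵛ ≡.refl)) (+-cong (use-cong Kʳ (rec Kʳ ≡.refl)) (use-cong Kˡ (rec Kˡ ≡.refl))) ⟩
    sweep (u ∷ us) δ ∎
    where
    Kᵛ Kʳ Kˡ : Lozenge
    Kᵛ = (vert , u)
    Kʳ = (right , u)
    Kˡ = (left , u)
    Ls = concatMap candidates us
    use : Lozenge → List Lozenge → Carrier
    use K Ks = when (δ (partner K)) (w K * covering (inside Ks) (δ ∖ K))
    use-cong : ∀ K {x y} → x ≈ y → when (δ (partner K)) (w K * x) ≈ when (δ (partner K)) (w K * y)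
    use-cong K e with δ (partner K)
    ... | true  = *-congˡ e
    ... | false = refl
    pick : ∀ K Ks → proj₂ K ≡ u → covering (inside (K ∷ Ks)) δ ≈ covering (inside Ks) δ + use K Ks
    pick K Ks ≡.refl = trans (covering-inside K Ks δ sub u∈)
      (+-congˡ (reflexive (cong (λ b → when b (use K Ks)) δu)))
    skip : ∀ K K′ Ks → proj₂ K ≡ u → proj₂ K′ ≡ u →
      covering (inside (K ∷ Ks)) (δ ∖ K′) ≈ covering (inside Ks) (δ ∖ K′)
    skip K K′ Ks ≡.refl eq = trans (covering-inside K Ks (δ ∖ K′) (Sub-∖ K′ sub) u∈)
      (trans (+-congˡ (reflexive (cong (λ b → when b (when ((δ ∖ K′) (partner K)) (w K * covering (inside Ks) (δ ∖ K′ ∖ K))))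
               (≡.trans (cong (δ ∖ K′) (≡.sym eq)) (∖-up δ K′)))))
             (+-identityʳ _))
    uncovered : ∀ {us} → All (λ v → u ≢ v) us → All (λ v → isUp v ≡ true) us →
                All (λ K → covers K u ≡ false) (concatMap candidates us)
    uncovered []       []       = []
    uncovered {v ∷ _} (ne ∷ nes) (upv ∷ upvs) = c vert ∷ c right ∷ c left ∷ uncovered nes upvs
      where
      c : ∀ k → covers (k , v) u ≡ false
      c k = covers-other (k , v) ne (up≢partner (k , v) up upv)
    dead : covering (inside Ls) δ ≈ 0#
    dead = covering-dead (inside Ls) δ u∈ δu (All-filter _ (uncovered u≢ ups))
    rec : ∀ K → proj₂ K ≡ u → covering (inside Ls) (δ ∖ K) ≈ sweep us (δ ∖ K)
    rec K ≡.refl = covering-sweep us (δ ∖ K) (Sub-∖ K sub) us∈ ups (still u≢ ups δus) distinct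
      where
      still : ∀ {us} → All (λ v → u ≢ v) us → All (λ v → isUp v ≡ true) us → All (λ v → δ v ≡ true) us →
              All (λ v → (δ ∖ K) v ≡ true) us
      still []         []           []         = []
      still (ne ∷ nes) (upv ∷ upvs) (δv ∷ δvs) =
        ≡.trans (∖-other δ K (ne ∘ ≡.sym) (up≢partner K upv up)) δv ∷ still nes upvs δvs

  sweep-dead : ∀ us δ {t} → t ∈ᵇ G ≡ true → δ t ≡ true → All (λ u → ∀ k → covers (k , u) t ≡ false) us → sweep us δ ≈ 0#
  sweep-dead []       δ t∈G δt []         = covering-dead [] δ t∈G δt []
  sweep-dead (u ∷ us) δ {t} t∈G δt (c ∷ cs) = trans
    (+-cong (option vert) (+-cong (option right) (option left)))
    (solve 0 (con (+ 0) :+ (con (+ 0) :+ con (+ 0)) := con (+ 0)) refl)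
    where
    option : ∀ k → when (δ (partner (k , u))) (w (k , u) * sweep us (δ ∖ (k , u))) ≈ 0#
    option k with δ (partner (k , u))
    ... | false = refl
    ... | true  = trans (*-congˡ (sweep-dead us (δ ∖ (k , u)) t∈G still cs)) (zeroʳ _)
      where
      still : (δ ∖ (k , u)) t ≡ true
      still rewrite c k | δt = ≡.refl

  sweep-done : ∀ δ → (∀ t → t ∈ᵇ G ≡ true → δ t ≡ false) → sweep [] δ ≈ 1#
  sweep-done δ done = trans (reflexive (cong (λ b → sumR (map weight (if b then [] ∷ [] else []))) matched)) (+-identityʳ 1#)
    where
    matched : matches δ [] ≡ true
    matched = ≡.trans (all-cong G (All.map (λ e → cong (λ b → 0 ≡ᵇ demand b) (done _ e)) (∈ᵇ-all G))) (all-true G)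
      where
      all-true : ∀ (H : List Tri) → all (λ _ → true) H ≡ true
      all-true []      = ≡.refl
      all-true (_ ∷ H) = all-true H

-- One strip, swept from left to right

i<i+1 : ∀ i → i ℤ.< i ℤ.+ + 1
i<i+1 i = subst (λ t → t ℤ.< i ℤ.+ + 1) (ℤₚ.+-identityʳ i) (ℤₚ.+-monoʳ-< i (ℤ.+<+ (ℕ.s≤s ℕ.z≤n)))

i-1<i : ∀ i → i ℤ.- + 1 ℤ.< i
i-1<i i = subst (i ℤ.- + 1 ℤ.<_) (i-1+1 i) (i<i+1 (i ℤ.- + 1))

+1+2 : ∀ i → i ℤ.+ + 1 ℤ.+ + 2 ≡ i ℤ.+ + 2 ℤ.+ + 1
+1+2 i = ≡.trans (ℤₚ.+-assoc i (+ 1) (+ 2)) (≡.sym (ℤₚ.+-assoc i (+ 2) (+ 1)))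

+2-1 : ∀ i → i ℤ.+ + 2 ℤ.- + 1 ≡ i ℤ.+ + 1
+2-1 i = ℤₚ.+-assoc i (+ 2) -[1+ 0 ]

<-split : ∀ {i j} → i ℤ.< j ℤ.+ + 1 → i ≡ j ⊎ i ℤ.< j
<-split {i} {j} lt with i ℤ.≟ j
... | yes eq = inj₁ eq
... | no ne  = inj₂ (ℤₚ.≤∧≢⇒< (subst (i ℤ.≤_) (≡.trans (cong ℤ.pred (ℤₚ.+-comm j (+ 1))) (ℤₚ.pred-suc j)) (ℤₚ.i<j⇒i≤pred[j] lt)) ne)

-- Steps of 2 lead from a triangle to the next one of the same orientation. The bits are negated
-- because the sets record what is absent or already covered.
Reads : ∀ {k} → (ℤ → Bool) → ℤ → Subset k → Set
Reads f j []      = Unit.⊤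
Reads f j (x ∷ X) = f j ≡ not x × Reads f (j ℤ.+ + 2) X

i<i+2 : ∀ i → i ℤ.< i ℤ.+ + 2
i<i+2 i = subst (λ t → t ℤ.< i ℤ.+ + 2) (ℤₚ.+-identityʳ i) (ℤₚ.+-monoʳ-< i (ℤ.+<+ (ℕ.s≤s ℕ.z≤n)))

Reads-cong : ∀ {k} {f g : ℤ → Bool} j (X : Subset k) → (∀ i → j ℤ.≤ i → f i ≡ g i) → Reads f j X → Reads g j X
Reads-cong j []      e _        = Unit.tt
Reads-cong j (x ∷ X) e (r , rs) = ≡.trans (≡.sym (e j ℤₚ.≤-refl)) r ,
  Reads-cong _ X (λ i le → e i (ℤₚ.≤-trans (ℤₚ.<⇒≤ (i<i+2 j)) le)) rs

infixl 6 _⊕_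
-- This is j + 2k, written recursively so that it unfolds together with `Reads`.
_⊕_ : ℤ → ℕ → ℤ
j ⊕ zero  = j
j ⊕ suc k = (j ℤ.+ + 2) ⊕ k

rowUps : ∀ {k} → ℤ → ℤ → Subset k → List Tri
rowUps r j []          = []
rowUps r j (true ∷ X)  = rowUps r (j ℤ.+ + 2) X
rowUps r j (false ∷ X) = (r , j) ∷ rowUps r (j ℤ.+ + 2) X

rowUps-covers : ∀ {k} r j (X : Subset k) {i} → i ℤ.< j ℤ.- + 1 →
  All (λ u → ∀ κ → covers (κ , u) (r , i) ≡ false) (rowUps r j X)
rowUps-covers r j []          lt = []
rowUps-covers r j (true ∷ X)  lt = rowUps-covers r (j ℤ.+ + 2) X (ℤₚ.<-trans lt (ℤₚ.+-monoˡ-< (ℤ.- + 1) (i<i+2 j)))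
rowUps-covers r j (false ∷ X) {i} lt = c ∷ rowUps-covers r (j ℤ.+ + 2) X (ℤₚ.<-trans lt (ℤₚ.+-monoˡ-< (ℤ.- + 1) (i<i+2 j)))
  where
  i<j = ℤₚ.<-trans lt (i-1<i j)
  c : ∀ κ → covers (κ , (r , j)) (r , i) ≡ false
  c vert  = covers-other (vert , (r , j)) (ℤₚ.<⇒≢ i<j ∘ cong proj₂) (ℤₚ.<⇒≢ (i<i+1 r) ∘ cong proj₁)
  c right = covers-other (right , (r , j)) {r , i} (ℤₚ.<⇒≢ i<j ∘ cong proj₂)
              (ℤₚ.<⇒≢ (ℤₚ.<-trans i<j (i<i+1 j)) ∘ cong proj₂)
  c left  = covers-other (left , (r , j)) {r , i} (ℤₚ.<⇒≢ i<j ∘ cong proj₂) (ℤₚ.<⇒≢ lt ∘ cong proj₂)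

later-covers : ∀ {r i us} → All (λ u → r ℤ.< proj₁ u) us → All (λ u → ∀ κ → covers (κ , u) (r , i) ≡ false) us
later-covers []         = []
later-covers {r} {i} {(s , j) ∷ _} (lt ∷ lts) = c ∷ later-covers lts
  where
  c : ∀ κ → covers (κ , (s , j)) (r , i) ≡ false
  c vert  = covers-other (vert , (s , j)) (ℤₚ.<⇒≢ lt ∘ cong proj₁) (ℤₚ.<⇒≢ (ℤₚ.<-trans lt (i<i+1 s)) ∘ cong proj₁)
  c right = covers-other (right , (s , j)) (ℤₚ.<⇒≢ lt ∘ cong proj₁) (ℤₚ.<⇒≢ lt ∘ cong proj₁)
  c left  = covers-other (left , (s , j)) (ℤₚ.<⇒≢ lt ∘ cong proj₁) (ℤₚ.<⇒≢ lt ∘ cong proj₁)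

module Transfer {ℓ₁ ℓ₂} (R : CommutativeRing ℓ₁ ℓ₂) where
  open CommutativeRing R hiding (zero)
  open Exterior R

  -- Tilings of one strip, read from left to right.  Each step handles an up-pointing triangle and the
  -- down-pointing triangle on its right; the flag says that the down-pointing triangle on its left
  -- is still uncovered.
  run : ∀ {k} → Carrier → Bool → Subset k → Form k → Carrier
  run ρ true  []      Φ = 0#
  run ρ false []      Φ = Φ []
  run ρ true  (d ∷ D) Φ = run ρ (not d) D (Φ ∘ (false ∷_))
  run ρ false (d ∷ D) Φ = run ρ (not d) D (Φ ∘ (true ∷_)) + (if d then 0# else ρ * run ρ false D (Φ ∘ (false ∷_)))

  run-cong : ∀ {k} ρ p (D : Subset k) {Φ Ψ : Form k} → (∀ U → Φ U ≈ Ψ U) → run ρ p D Φ ≈ run ρ p D Ψ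
  run-cong ρ true  []          e = refl
  run-cong ρ false []          e = e []
  run-cong ρ true  (d ∷ D)     e = run-cong ρ (not d) D (e ∘ (false ∷_))
  run-cong ρ false (true ∷ D)  e = +-congʳ (run-cong ρ false D (e ∘ (true ∷_)))
  run-cong ρ false (false ∷ D) e =
    +-cong (run-cong ρ true D (e ∘ (true ∷_))) (*-congˡ (run-cong ρ false D (e ∘ (false ∷_))))

  run-zero : ∀ {k} ρ p (D : Subset k) → run ρ p D (λ _ → 0#) ≈ 0#
  run-zero ρ true  []          = refl
  run-zero ρ false []          = refl
  run-zero ρ true  (d ∷ D)     = run-zero ρ (not d) D
  run-zero ρ false (true ∷ D)  = trans (+-identityʳ _) (run-zero ρ false D)
  run-zero ρ false (false ∷ D) = trans (+-cong (run-zero ρ true D) (trans (*-congˡ (run-zero ρ false D)) (zeroʳ ρ))) (+-identityʳ 0#)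

  -- X: up-pointing triangles absent from the strip; Y: down-pointing triangles absent below it.
  -- The argument of Φ marks those that are absent or covered from above.
  glue : ∀ {k} → Subset k → Subset k → Form k → Form k
  glue []          []          Φ []          = Φ []
  glue (true ∷ X)  (y ∷ Y)     Φ (true ∷ U)  = glue X Y (Φ ∘ (y ∷_)) U
  glue (true ∷ X)  (y ∷ Y)     Φ (false ∷ U) = 0#
  glue (false ∷ X) (y ∷ Y)     Φ (false ∷ U) = glue X Y (Φ ∘ (y ∷_)) U
  glue (false ∷ X) (true ∷ Y)  Φ (true ∷ U)  = 0#
  glue (false ∷ X) (false ∷ Y) Φ (true ∷ U)  = glue X Y (Φ ∘ (true ∷_)) U

module Strips {ℓ₁ ℓ₂} (R : CommutativeRing ℓ₁ ℓ₂) (w : Lozenge → CommutativeRing.Carrier R) (G : List Tri)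
  (w-vert : ∀ t → CommutativeRing._≈_ R (w (vert , t)) (CommutativeRing.1# R))
  (w-left : ∀ t → CommutativeRing._≈_ R (w (left , t)) (CommutativeRing.1# R)) where
  open CommutativeRing R hiding (zero)
  open Exterior R
  open Transfer R
  open Cover R w G public

  -- The reading order is strip by strip downwards, and from left to right within a strip.
  Done : Demand → ℤ → ℤ → Set
  Done δ r j = ∀ s i → (s , i) ∈ᵇ G ≡ true → s ℤ.< r ⊎ (s ≡ r × i ℤ.< j) → δ (s , i) ≡ false

  ⇒false : ∀ {x y} → (y ≡ true → x ≡ true) → x ≡ false → y ≡ false
  ⇒false {false} {false} f e = ≡.refl
  ⇒false {false} {true}  f e = ≡.sym (f ≡.refl)

  -- Abstracts from what happened at (r , j): one of the three lozenges was placed, or none because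
  -- the triangle is absent. This lets `advance` serve all cases.
  record Local (r j : ℤ) (δ δ′ : Demand) : Set where
    field
      same-row : ∀ i → j ℤ.+ + 1 ℤ.< i → δ′ (r , i) ≡ δ (r , i)
      next-row : ∀ i → i ≢ j → δ′ (r ℤ.+ + 1 , i) ≡ δ (r ℤ.+ + 1 , i)
      far-row  : ∀ s i → r ℤ.+ + 1 ℤ.< s → δ′ (s , i) ≡ δ (s , i)
      smaller  : ∀ t → δ′ t ≡ true → δ t ≡ true

  ∖-local : ∀ k r j δ → Local r j δ (δ ∖ (k , (r , j)))
  ∖-local k r j δ = record
    { same-row = λ i lt → ∖-other δ (k , (r , j)) (>⇒≢ (ℤₚ.<-trans (i<i+1 j) lt) ∘ cong proj₂) (same k lt)
    ; next-row = λ i ne → ∖-other δ (k , (r , j)) (>⇒≢ (i<i+1 r) ∘ cong proj₁) (next k ne)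
    ; far-row  = λ s i lt → ∖-other δ (k , (r , j)) (>⇒≢ (ℤₚ.<-trans (i<i+1 r) lt) ∘ cong proj₁) (far k lt)
    ; smaller  = λ t → ∧-trueˡ }
    where
    >⇒≢ : ∀ {a b} → b ℤ.< a → a ≢ b
    >⇒≢ lt ≡.refl = ℤₚ.<-irrefl ≡.refl lt
    same : ∀ k {i} → j ℤ.+ + 1 ℤ.< i → (r , i) ≢ partner (k , (r , j))
    same vert  lt = ℤₚ.<⇒≢ (i<i+1 r) ∘ cong proj₁
    same right lt = >⇒≢ lt ∘ cong proj₂
    same left  lt = >⇒≢ (ℤₚ.<-trans (ℤₚ.<-trans (i-1<i j) (i<i+1 j)) lt) ∘ cong proj₂
    next : ∀ k {i} → i ≢ j → (r ℤ.+ + 1 , i) ≢ partner (k , (r , j))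
    next vert  ne = ne ∘ cong proj₂
    next right ne = >⇒≢ (i<i+1 r) ∘ cong proj₁
    next left  ne = >⇒≢ (i<i+1 r) ∘ cong proj₁
    far : ∀ k {s i} → r ℤ.+ + 1 ℤ.< s → (s , i) ≢ partner (k , (r , j))
    far vert  lt = >⇒≢ lt ∘ cong proj₁
    far right lt = >⇒≢ (ℤₚ.<-trans (i<i+1 r) lt) ∘ cong proj₁
    far left  lt = >⇒≢ (ℤₚ.<-trans (i<i+1 r) lt) ∘ cong proj₁

  -- The later strips are known through this property only, so `row` applies whatever lies below.
  -- `out` collects the down-pointing triangles of the next strip that are absent or have been
  -- covered from above.
  Continues : ∀ {k} → ℤ → List Tri → ℤ → Demand → Form k → Set _
  Continues {k} r rest j δ Φ = ∀ out δ′ → Sub δ′ → Done δ′ r (j ⊕ k) → Reads (λ i → δ′ (r ℤ.+ + 1 , i)) j out →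
    (∀ i → i ℤ.< j → δ′ (r ℤ.+ + 1 , i) ≡ δ (r ℤ.+ + 1 , i)) →
    (∀ s i → r ℤ.+ + 1 ℤ.< s → δ′ (s , i) ≡ δ (s , i)) → sweep rest δ′ ≈ Φ out

  module _ (ρ : Carrier) (r : ℤ) (w-right : ∀ j → w (right , (r , j)) ≈ ρ)
           (rest : List Tri) (rest-later : All (λ u → r ℤ.< proj₁ u) rest) where

    -- The strip is a path, so one bit of memory suffices. Once the up-pointing triangle at j has
    -- been passed, no later lozenge reaches (r , j-1); if that triangle is still waiting, the sum
    -- is zero by `sweep-dead`.
    row : ∀ {k} (X Y D : Subset k) (Φ : Form k) p j δ → Sub δ → Done δ r (j ℤ.- + 1) → δ (r , j ℤ.- + 1) ≡ p →
      Reads (λ i → δ (r , i)) (j ℤ.+ + 1) D → Reads (λ i → δ (r ℤ.+ + 1 , i)) j Y → Reads (λ i → (r , i) ∈ᵇ G) j X →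
      Continues r rest j δ Φ → sweep (rowUps r j X ++ rest) δ ≈ run ρ p D (glue X Y Φ)

    private
      uncovered : ∀ {k} (X : Subset k) j → All (λ u → ∀ κ → covers (κ , u) (r , j ℤ.- + 1) ≡ false) (rowUps r (j ℤ.+ + 2) X ++ rest)
      uncovered X j = Allₚ.++⁺ (rowUps-covers r (j ℤ.+ + 2) X
        (subst (j ℤ.- + 1 ℤ.<_) (≡.sym (+2-1 j)) (ℤₚ.<-trans (i-1<i j) (i<i+1 j)))) (later-covers rest-later)

      advance : ∀ {k} (X Y D : Subset k) (Φ : Form (suc k)) y p o j {δ δ′} →
        Sub δ → Local r j δ δ′ → Done δ r (j ℤ.- + 1) → δ′ (r , j ℤ.- + 1) ≡ false → ((r , j) ∈ᵇ G ≡ true → δ′ (r , j) ≡ false) →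
        δ′ (r , j ℤ.+ + 1) ≡ p → δ′ (r ℤ.+ + 1 , j) ≡ not o →
        Reads (λ i → δ (r , i)) (j ℤ.+ + 1 ℤ.+ + 2) D → Reads (λ i → δ (r ℤ.+ + 1 , i)) j (y ∷ Y) →
        Reads (λ i → (r , i) ∈ᵇ G) (j ℤ.+ + 2) X →
        Continues r rest j δ Φ → sweep (rowUps r (j ℤ.+ + 2) X ++ rest) δ′ ≈ run ρ p D (glue X Y (Φ ∘ (o ∷_)))
      advance X Y D Φ y p o j {δ} {δ′} sub loc done pend gone pend′ out readsD (_ , readsY) readsX cont =
        row X Y D (Φ ∘ (o ∷_)) p (j ℤ.+ + 2) δ′ (λ t e → sub t (smaller t e))
          (subst (Done δ′ r) (≡.sym (+2-1 j)) done′)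
          (≡.trans (cong (λ i → δ′ (r , i)) (+2-1 j)) pend′)
          (subst (λ i → Reads (λ i → δ′ (r , i)) i D) (+1+2 j)
            (Reads-cong _ D (λ i le → ≡.sym (same-row i (ℤₚ.<-≤-trans (i<i+2 (j ℤ.+ + 1)) le))) readsD))
          (Reads-cong _ Y (λ i le → ≡.sym (next-row i (λ { ≡.refl → ℤₚ.<-irrefl ≡.refl (ℤₚ.<-≤-trans (i<i+2 j) le) }))) readsY)
          readsX
          (λ out′ δ″ sub″ done″ reads″ below″ far″ → cont (o ∷ out′) δ″ sub″ done″
            (≡.trans (below″ j (i<i+2 j)) out , reads″)
            (λ i lt → ≡.trans (below″ i (ℤₚ.<-trans lt (i<i+2 j))) (next-row i (ℤₚ.<⇒≢ lt)))
            (λ s i lt → ≡.trans (far″ s i lt) (far-row s i lt)))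
        where
        open Local loc
        done′ : Done δ′ r (j ℤ.+ + 1)
        done′ s i ∈G (inj₁ lt) = ⇒false (smaller (s , i)) (done s i ∈G (inj₁ lt))
        done′ s i ∈G (inj₂ (≡.refl , lt)) with <-split {i} {j} lt
        ... | inj₁ ≡.refl = gone ∈G
        ... | inj₂ lt′ with <-split {i} {j ℤ.- + 1} (subst (i ℤ.<_) (≡.sym (i-1+1 j)) lt′)
        ...   | inj₁ ≡.refl = pend
        ...   | inj₂ lt″    = ⇒false (smaller (s , i)) (done s i ∈G (inj₂ (≡.refl , lt″)))

    row [] [] [] Φ true j δ sub done pend _ _ _ cont = sweep-dead rest δ (sub _ pend) pend (later-covers rest-later)
    row [] [] [] Φ false j δ sub done pend _ _ _ cont = cont [] δ sub done′ Unit.tt (λ _ _ → ≡.refl) (λ _ _ _ → ≡.refl)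
      where
      done′ : Done δ r j
      done′ s i ∈G (inj₁ lt) = done s i ∈G (inj₁ lt)
      done′ s i ∈G (inj₂ (≡.refl , lt)) with <-split {i} {j ℤ.- + 1} (subst (i ℤ.<_) (≡.sym (i-1+1 j)) lt)
      ... | inj₁ ≡.refl = pend
      ... | inj₂ lt′    = done s i ∈G (inj₂ (≡.refl , lt′))
    -- The absent triangle cannot cover the one waiting on its left; on the other side `glue` is
    -- zero at `false`.
    row (true ∷ X) (y ∷ Y) (d ∷ D) Φ true j δ sub done pend _ _ _ cont =
      trans (sweep-dead _ δ (sub _ pend) pend (uncovered X j)) (sym (run-zero ρ (not d) D))
    -- An absent triangle counts as matched downwards, so only the first summand of `run` survives.
    row (true ∷ X) (y ∷ Y) (d ∷ D) Φ false j δ sub done pend (readd , readsD) readsY (readx , readsX) cont =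
      trans (advance X Y D Φ y (not d) y j {δ} {δ} sub unchanged done pend
               (λ e → ⊥-elim (absurd (≡.trans (≡.sym e) readx))) readd (proj₁ readsY) readsD readsY readsX cont)
            (trans (sym (+-identityʳ _)) (+-congˡ (sym (lemma d))))
      where
      absurd : true ≡ false → _
      absurd ()
      unchanged : Local r j δ δ
      unchanged = record { same-row = λ _ _ → ≡.refl ; next-row = λ _ _ → ≡.refl
                         ; far-row = λ _ _ _ → ≡.refl ; smaller = λ _ e → e }
      lemma : ∀ d → (if d then 0# else ρ * run ρ false D (λ _ → 0#)) ≈ 0#
      lemma true  = refl
      lemma false = trans (*-congˡ (run-zero ρ false D)) (zeroʳ ρ)
    -- The vertical and the right option would leave the waiting triangle uncovered for good.
    row (false ∷ X) (y ∷ Y) (d ∷ D) Φ true j δ sub done pend (readd , readsD) readsY (readx , readsX) cont =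
      trans (+-cong (dead vert (covers-other (vert , (r , j)) (ℤₚ.<⇒≢ (i-1<i j) ∘ cong proj₂) (ℤₚ.<⇒≢ (i<i+1 r) ∘ cong proj₁)))
              (+-cong (dead right (covers-other (right , (r , j)) {r , j ℤ.- + 1} (ℤₚ.<⇒≢ (i-1<i j) ∘ cong proj₂)
                                     (ℤₚ.<⇒≢ (ℤₚ.<-trans (i-1<i j) (i<i+1 j)) ∘ cong proj₂)))
                      (trans (reflexive (cong (λ b → when b (w (left , (r , j)) * sweep us (δ ∖ (left , (r , j))))) pend)) leftward)))
            (trans (+-identityˡ _) (+-identityˡ _))
      where
      us = rowUps r (j ℤ.+ + 2) X ++ rest
      dead : ∀ k → covers (k , (r , j)) (r , j ℤ.- + 1) ≡ false →
        when (δ (partner (k , (r , j)))) (w (k , (r , j)) * sweep us (δ ∖ (k , (r , j)))) ≈ 0#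
      dead k c with δ (partner (k , (r , j)))
      ... | false = refl
      ... | true  = trans (*-congˡ (sweep-dead us _ (sub _ pend) still (uncovered X j))) (zeroʳ _)
        where
        still : (δ ∖ (k , (r , j))) (r , j ℤ.- + 1) ≡ true
        still rewrite c | pend = ≡.refl
      kept : (δ ∖ (left , (r , j))) (r , j ℤ.+ + 1) ≡ δ (r , j ℤ.+ + 1)
      kept = ∖-other δ (left , (r , j)) (ℤₚ.<⇒≢ (i<i+1 j) ∘ ≡.sym ∘ cong proj₂)
               (ℤₚ.<⇒≢ (ℤₚ.<-trans (i-1<i j) (i<i+1 j)) ∘ ≡.sym ∘ cong proj₂)
      below : (δ ∖ (left , (r , j))) (r ℤ.+ + 1 , j) ≡ δ (r ℤ.+ + 1 , j)
      below = ∖-other δ (left , (r , j)) (ℤₚ.<⇒≢ (i<i+1 r) ∘ ≡.sym ∘ cong proj₁) (ℤₚ.<⇒≢ (i<i+1 r) ∘ ≡.sym ∘ cong proj₁)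
      leftward : w (left , (r , j)) * sweep us (δ ∖ (left , (r , j))) ≈ run ρ (not d) D (glue X Y (Φ ∘ (y ∷_)))
      leftward = trans (*-cong (w-left _)
        (advance X Y D Φ y (not d) y j sub (∖-local left r j δ) done (∖-partner δ (left , (r , j)))
          (λ _ → ∖-up δ (left , (r , j))) (≡.trans kept readd) (≡.trans below (proj₁ readsY)) readsD readsY readsX cont))
        (*-identityˡ _)
    -- The left option contributes nothing, as the triangle on the left is not demanded.
    row (false ∷ X) (y ∷ Y) (d ∷ D) Φ false j δ sub done pend (readd , readsD) readsY (readx , readsX) cont =
      +-cong (upright y readsY)
        (trans (+-cong (rightward d readd)
                 (reflexive (cong (λ b → when b (w (left , (r , j)) * sweep us (δ ∖ (left , (r , j))))) pend)))
               (+-identityʳ _))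
      where
      us = rowUps r (j ℤ.+ + 2) X ++ rest
      upright : ∀ y → Reads (λ i → δ (r ℤ.+ + 1 , i)) j (y ∷ Y) →
        when (δ (r ℤ.+ + 1 , j)) (w (vert , (r , j)) * sweep us (δ ∖ (vert , (r , j))))
          ≈ run ρ (not d) D (glue (false ∷ X) (y ∷ Y) Φ ∘ (true ∷_))
      upright true  (e , _) rewrite e = sym (run-zero ρ (not d) D)
      upright false (e , es) = trans
        (reflexive (cong (λ b → when b (w (vert , (r , j)) * sweep us (δ ∖ (vert , (r , j))))) e))
        (trans (*-cong (w-vert _)
          (advance X Y D Φ false (not d) true j sub (∖-local vert r j δ) done
            (≡.trans (∖-other δ (vert , (r , j)) (ℤₚ.<⇒≢ (i-1<i j) ∘ cong proj₂) (ℤₚ.<⇒≢ (i<i+1 r) ∘ cong proj₁)) pend)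
            (λ _ → ∖-up δ (vert , (r , j)))
            (≡.trans (∖-other δ (vert , (r , j)) (ℤₚ.<⇒≢ (i<i+1 j) ∘ ≡.sym ∘ cong proj₂) (ℤₚ.<⇒≢ (i<i+1 r) ∘ cong proj₁)) readd)
            (∖-partner δ (vert , (r , j))) readsD (e , es) readsX cont))
          (*-identityˡ _))
      rightward : ∀ d → δ (r , j ℤ.+ + 1) ≡ not d →
        when (δ (r , j ℤ.+ + 1)) (w (right , (r , j)) * sweep us (δ ∖ (right , (r , j))))
          ≈ (if d then 0# else ρ * run ρ false D (glue (false ∷ X) (y ∷ Y) Φ ∘ (false ∷_)))
      rightward true  e rewrite e = refl
      rightward false e = trans
        (reflexive (cong (λ b → when b (w (right , (r , j)) * sweep us (δ ∖ (right , (r , j))))) e))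
        (*-cong (w-right j)
          (advance X Y D Φ y false y j sub (∖-local right r j δ) done
            (≡.trans (∖-other δ (right , (r , j)) (ℤₚ.<⇒≢ (i-1<i j) ∘ cong proj₂)
              (ℤₚ.<⇒≢ (ℤₚ.<-trans (i-1<i j) (i<i+1 j)) ∘ cong proj₂)) pend)
            (λ _ → ∖-up δ (right , (r , j))) (∖-partner δ (right , (r , j)))
            (≡.trans (∖-other δ (right , (r , j)) (ℤₚ.<⇒≢ (i<i+1 r) ∘ ≡.sym ∘ cong proj₁) (ℤₚ.<⇒≢ (i<i+1 r) ∘ ≡.sym ∘ cong proj₁)) (proj₁ readsY))
            readsD readsY readsX cont))

-- Shuffling and products over pairs

data Shuffled : (x y x′ y′ : Bool) → Set where
  both  : Shuffled true true true true
  keepˡ : Shuffled true false true false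
  keepʳ : Shuffled false true false true
  swapˡ : Shuffled true false false true
  swapʳ : Shuffled false true true false

Shuffled-sym : ∀ {x y x′ y′} → Shuffled x y x′ y′ → Shuffled x′ y′ x y
Shuffled-sym both  = both
Shuffled-sym keepˡ = keepˡ
Shuffled-sym keepʳ = keepʳ
Shuffled-sym swapˡ = swapʳ
Shuffled-sym swapʳ = swapˡ

-- (X′ , Y′) is a shuffling of (X , Y), and Z is disjoint from X ∪ Y.
data Config : ∀ {n} (X Y X′ Y′ Z : Subset n) → Set where
  []   : Config [] [] [] [] []
  none : ∀ {n} {X Y X′ Y′ Z : Subset n} z → Config X Y X′ Y′ Z →
         Config (false ∷ X) (false ∷ Y) (false ∷ X′) (false ∷ Y′) (z ∷ Z)
  some : ∀ {n x y x′ y′} {X Y X′ Y′ Z : Subset n} → Shuffled x y x′ y′ → Config X Y X′ Y′ Z →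
         Config (x ∷ X) (y ∷ Y) (x′ ∷ X′) (y′ ∷ Y′) (false ∷ Z)

data Disjoint : ∀ {n} (X Z : Subset n) → Set where
  []   : Disjoint [] []
  skip : ∀ {n} {X Z : Subset n} x → Disjoint X Z → Disjoint (x ∷ X) (false ∷ Z)
  pick : ∀ {n} {X Z : Subset n} → Disjoint X Z → Disjoint (false ∷ X) (true ∷ Z)

Config-sym : ∀ {n} {X Y X′ Y′ Z : Subset n} → Config X Y X′ Y′ Z → Config X′ Y′ X Y Z
Config-sym []         = []
Config-sym (none z c) = none z (Config-sym c)
Config-sym (some s c) = some (Shuffled-sym s) (Config-sym c)

Config-disjointˡ : ∀ {n} {X Y X′ Y′ Z : Subset n} → Config X Y X′ Y′ Z → Disjoint X Z
Config-disjointˡ []             = []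
Config-disjointˡ (none false c) = skip false (Config-disjointˡ c)
Config-disjointˡ (none true c)  = pick (Config-disjointˡ c)
Config-disjointˡ (some _ c)     = skip _ (Config-disjointˡ c)

Config-disjointʳ : ∀ {n} {X Y X′ Y′ Z : Subset n} → Config X Y X′ Y′ Z → Disjoint Y Z
Config-disjointʳ []             = []
Config-disjointʳ (none false c) = skip false (Config-disjointʳ c)
Config-disjointʳ (none true c)  = pick (Config-disjointʳ c)
Config-disjointʳ (some _ c)     = skip _ (Config-disjointʳ c)

size-∪ : ∀ {n} {X Z : Subset n} → Disjoint X Z → size (X ∪ Z) ≡ size X ℕ.+ size Z
size-∪ []             = ≡.refl
size-∪ (skip true d)  = cong suc (size-∪ d)
size-∪ (skip false d) = size-∪ d
size-∪ {X = _ ∷ X} {Z = _ ∷ Z} (pick d) = ≡.trans (cong suc (size-∪ d)) (≡.sym (ℕₚ.+-suc (size X) (size Z)))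

module ShuffledPairs {ℓ₁ ℓ₂} (Mo : CommutativeMonoid ℓ₁ ℓ₂) where
  open CommutativeMonoid Mo
  open OneAndPairs Mo
  open import Algebra.Solver.CommutativeMonoid Mo using (solve; _⊜_) renaming (_⊕_ to _⊙_)

  open import Relation.Binary.Reasoning.Setoid setoid

  one-∪ : ∀ {n} (g : Fin n → Carrier) {X Z : Subset n} → Disjoint X Z → one g (X ∪ Z) ≈ one g X ∙ one g Z
  one-∪ g []             = sym (identityˡ ε)
  one-∪ g (skip true d)  = trans (∙-congˡ (one-∪ (g ∘ suc) d)) (sym (assoc _ _ _))
  one-∪ g (skip false d) = one-∪ (g ∘ suc) d
  one-∪ g (pick d)      = trans (∙-congˡ (one-∪ (g ∘ suc) d))
    (solve 3 (λ a b c → a ⊙ (b ⊙ c) ⊜ b ⊙ (a ⊙ c)) refl _ _ _)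

  sel : Bool → Carrier → Carrier
  sel b x = if b then x else ε

  sel-shuffle : ∀ {x y x′ y′} → Shuffled x y x′ y′ → ∀ e → sel x e ∙ sel y e ≈ sel x′ e ∙ sel y′ e
  sel-shuffle both  e = refl
  sel-shuffle keepˡ e = refl
  sel-shuffle keepʳ e = refl
  sel-shuffle swapˡ e = comm _ _
  sel-shuffle swapʳ e = comm _ _

  one-∷ : ∀ {n} (g : Fin (suc n) → Carrier) b U → one g (b ∷ U) ≈ sel b (g zero) ∙ one (g ∘ suc) U
  one-∷ g true  U = refl
  one-∷ g false U = sym (identityˡ _)

  pairs-∷ : ∀ {n} (h : Fin (suc n) → Fin (suc n) → Carrier) b U →
    pairs h (b ∷ U) ≈ sel b (one (h zero ∘ suc) U) ∙ pairs (λ i j → h (suc i) (suc j)) U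
  pairs-∷ h true  U = refl
  pairs-∷ h false U = sym (identityˡ _)

  one-shuffle : ∀ {n} (g : Fin n → Carrier) {X Y X′ Y′ Z : Subset n} → Config X Y X′ Y′ Z →
    one g X ∙ one g Y ≈ one g X′ ∙ one g Y′
  one-shuffle g []         = refl
  one-shuffle g (none z c) = one-shuffle (g ∘ suc) c
  one-shuffle {suc n} g {x ∷ X} {y ∷ Y} {x′ ∷ X′} {y′ ∷ Y′} (some s c) = begin
    one g (x ∷ X) ∙ one g (y ∷ Y) ≈⟨ split x y X Y ⟩
    (sel x (g zero) ∙ sel y (g zero)) ∙ (one (g ∘ suc) X ∙ one (g ∘ suc) Y)
      ≈⟨ ∙-cong (sel-shuffle s (g zero)) (one-shuffle (g ∘ suc) c) ⟩
    (sel x′ (g zero) ∙ sel y′ (g zero)) ∙ (one (g ∘ suc) X′ ∙ one (g ∘ suc) Y′) ≈⟨ sym (split x′ y′ X′ Y′) ⟩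
    one g (x′ ∷ X′) ∙ one g (y′ ∷ Y′) ∎
    where
    split : ∀ a b (A B : Subset n) →
      one g (a ∷ A) ∙ one g (b ∷ B) ≈ (sel a (g zero) ∙ sel b (g zero)) ∙ (one (g ∘ suc) A ∙ one (g ∘ suc) B)
    split a b A B = trans (∙-cong (one-∷ g a A) (one-∷ g b B))
      (solve 4 (λ s o t p → (s ⊙ o) ⊙ (t ⊙ p) ⊜ (s ⊙ t) ⊙ (o ⊙ p)) refl _ _ _ _)

  -- The pairs between X and Z together with those between Y and Z depend on the multiset X + Y
  -- only, and the pairs within Z occur twice on either side. The pairs within X, Y, X′ and Y′ occur
  -- once on either side. The cross-multiplied form avoids division, which a monoid does not have.
  pairs-shuffle : ∀ {n} (h : Fin n → Fin n → Carrier) {X Y X′ Y′ Z : Subset n} → Config X Y X′ Y′ Z →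
    pairs h (X ∪ Z) ∙ pairs h (Y ∪ Z) ∙ (pairs h X′ ∙ pairs h Y′)
      ≈ pairs h (X′ ∪ Z) ∙ pairs h (Y′ ∪ Z) ∙ (pairs h X ∙ pairs h Y)
  pairs-shuffle h []             = refl
  pairs-shuffle h (none false c) = pairs-shuffle (λ i j → h (suc i) (suc j)) c
  pairs-shuffle {suc n} h {_ ∷ X} {_ ∷ Y} {_ ∷ X′} {_ ∷ Y′} {_ ∷ Z} (none true c) = begin
    (o (X ∪ Z) ∙ p (X ∪ Z)) ∙ (o (Y ∪ Z) ∙ p (Y ∪ Z)) ∙ (p X′ ∙ p Y′) ≈⟨ collect _ _ _ _ _ ⟩
    (o (X ∪ Z) ∙ o (Y ∪ Z)) ∙ (p (X ∪ Z) ∙ p (Y ∪ Z) ∙ (p X′ ∙ p Y′))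
      ≈⟨ ∙-cong ones (pairs-shuffle (λ i j → h (suc i) (suc j)) c) ⟩
    (o (X′ ∪ Z) ∙ o (Y′ ∪ Z)) ∙ (p (X′ ∪ Z) ∙ p (Y′ ∪ Z) ∙ (p X ∙ p Y)) ≈⟨ sym (collect _ _ _ _ _) ⟩
    _ ∎
    where
    o p : Subset n → Carrier
    o = one (h zero ∘ suc)
    p = pairs (λ i j → h (suc i) (suc j))
    collect : ∀ a b c d e → (a ∙ b) ∙ (c ∙ d) ∙ e ≈ (a ∙ c) ∙ (b ∙ d ∙ e)
    collect = solve 5 (λ a b c d e → ((a ⊙ b) ⊙ (c ⊙ d)) ⊙ e ⊜ (a ⊙ c) ⊙ ((b ⊙ d) ⊙ e)) refl
    spread : ∀ {A B} → Disjoint A Z → Disjoint B Z → o (A ∪ Z) ∙ o (B ∪ Z) ≈ (o A ∙ o B) ∙ (o Z ∙ o Z)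
    spread dA dB = trans (∙-cong (one-∪ _ dA) (one-∪ _ dB))
      (solve 3 (λ a b z → (a ⊙ z) ⊙ (b ⊙ z) ⊜ (a ⊙ b) ⊙ (z ⊙ z)) refl _ _ _)
    ones : o (X ∪ Z) ∙ o (Y ∪ Z) ≈ o (X′ ∪ Z) ∙ o (Y′ ∪ Z)
    ones = trans (spread (Config-disjointˡ c) (Config-disjointʳ c)) (trans (∙-congʳ (one-shuffle _ c))
      (sym (spread (Config-disjointˡ (Config-sym c)) (Config-disjointʳ (Config-sym c)))))
  pairs-shuffle {suc n} h {x ∷ X} {y ∷ Y} {x′ ∷ X′} {y′ ∷ Y′} {_ ∷ Z} (some s c) = begin
    pairs h ((x ∷ X) ∪ (false ∷ Z)) ∙ pairs h ((y ∷ Y) ∪ (false ∷ Z)) ∙ (pairs h (x′ ∷ X′) ∙ pairs h (y′ ∷ Y′))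
      ≈⟨ split {x} {y} {x′} {y′} {X} {Y} {X′} {Y′} (Config-disjointˡ c) (Config-disjointʳ c) ⟩
    (sel x (o Z) ∙ sel y (o Z)) ∙ ((sel x (o X) ∙ sel y (o Y)) ∙ (sel x′ (o X′) ∙ sel y′ (o Y′)))
      ∙ (p (X ∪ Z) ∙ p (Y ∪ Z) ∙ (p X′ ∙ p Y′))
      ≈⟨ ∙-cong (∙-cong (sel-shuffle s (o Z)) (comm _ _)) (pairs-shuffle (λ i j → h (suc i) (suc j)) c) ⟩
    (sel x′ (o Z) ∙ sel y′ (o Z)) ∙ ((sel x′ (o X′) ∙ sel y′ (o Y′)) ∙ (sel x (o X) ∙ sel y (o Y)))
      ∙ (p (X′ ∪ Z) ∙ p (Y′ ∪ Z) ∙ (p X ∙ p Y))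
      ≈⟨ sym (split {x′} {y′} {x} {y} {X′} {Y′} {X} {Y} (Config-disjointˡ (Config-sym c)) (Config-disjointʳ (Config-sym c))) ⟩
    _ ∎
    where
    o p : Subset n → Carrier
    o = one (h zero ∘ suc)
    p = pairs (λ i j → h (suc i) (suc j))
    sel-∙ : ∀ b u v → sel b (u ∙ v) ≈ sel b u ∙ sel b v
    sel-∙ true  u v = refl
    sel-∙ false u v = sym (identityˡ ε)
    sel-cong : ∀ b {u v} → u ≈ v → sel b u ≈ sel b v
    sel-cong true  e = e
    sel-cong false e = refl
    piece : ∀ b {A} → Disjoint A Z → pairs h ((b ∷ A) ∪ (false ∷ Z)) ≈ (sel b (o A) ∙ sel b (o Z)) ∙ p (A ∪ Z)
    piece b {A} d = trans (reflexive (cong (λ t → pairs h (t ∷ A ∪ Z)) (Boolₚ.∨-identityʳ b)))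
      (trans (pairs-∷ h b (A ∪ Z)) (∙-congʳ (trans (sel-cong b (one-∪ _ d)) (sel-∙ b _ _))))
    split : ∀ {a b a′ b′ A B A′ B′} → Disjoint A Z → Disjoint B Z →
      pairs h ((a ∷ A) ∪ (false ∷ Z)) ∙ pairs h ((b ∷ B) ∪ (false ∷ Z)) ∙ (pairs h (a′ ∷ A′) ∙ pairs h (b′ ∷ B′))
      ≈ (sel a (o Z) ∙ sel b (o Z)) ∙ ((sel a (o A) ∙ sel b (o B)) ∙ (sel a′ (o A′) ∙ sel b′ (o B′)))
        ∙ (p (A ∪ Z) ∙ p (B ∪ Z) ∙ (p A′ ∙ p B′))
    split {a} {b} {a′} {b′} {A} {B} {A′} {B′} dA dB = trans
      (∙-cong (∙-cong (piece a dA) (piece b dB)) (∙-cong (pairs-∷ h a′ A′) (pairs-∷ h b′ B′)))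
      (solve 10 (λ u v r s t w k l m n → (((u ⊙ v) ⊙ r) ⊙ ((s ⊙ t) ⊙ w)) ⊙ ((k ⊙ l) ⊙ (m ⊙ n))
          ⊜ ((v ⊙ t) ⊙ ((u ⊙ s) ⊙ (k ⊙ m))) ⊙ ((r ⊙ w) ⊙ (l ⊙ n))) refl _ _ _ _ _ _ _ _ _ _)

shuffled-or-empty : ∀ x y x′ y′ → x ∨ y ≡ x′ ∨ y′ → x ∧ y ≡ x′ ∧ y′ →
  Shuffled x y x′ y′ ⊎ ((x ≡ false × y ≡ false) × (x′ ≡ false × y′ ≡ false))
shuffled-or-empty true  true  true  true  _ _ = inj₁ both
shuffled-or-empty true  false true  false _ _ = inj₁ keepˡ
shuffled-or-empty true  false false true  _ _ = inj₁ swapˡ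
shuffled-or-empty false true  true  false _ _ = inj₁ swapʳ
shuffled-or-empty false true  false true  _ _ = inj₁ keepʳ
shuffled-or-empty false false false false _ _ = inj₂ ((≡.refl , ≡.refl) , (≡.refl , ≡.refl))
shuffled-or-empty true  true  true  false _ ()
shuffled-or-empty true  true  false true  _ ()
shuffled-or-empty true  true  false false ()
shuffled-or-empty true  false true  true  _ ()
shuffled-or-empty true  false false false ()
shuffled-or-empty false true  true  true  _ ()
shuffled-or-empty false true  false false ()
shuffled-or-empty false false true  _     ()
shuffled-or-empty false false false true  ()

-- The sum over the dents along a line

module Pairing {ℓ₁ ℓ₂} (R : CommutativeRing ℓ₁ ℓ₂) where
  open CommutativeRing R hiding (zero)
  open import Relation.Binary.Reasoning.Setoid setoid
  open Exterior R
  open Transfer R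

  ⟪_,_⟫ : ∀ {n} → Form n → Form n → Carrier
  ⟪_,_⟫ {zero}  φ ψ = φ [] * ψ []
  ⟪_,_⟫ {suc n} φ ψ = ⟪ φ ∘ (false ∷_) , ψ ∘ (false ∷_) ⟫ + ⟪ φ ∘ (true ∷_) , ψ ∘ (true ∷_) ⟫

  ⟪⟫-cong : ∀ {n} {φ φ′ ψ ψ′ : Form n} → (∀ U → φ U ≈ φ′ U) → (∀ U → ψ U ≈ ψ′ U) → ⟪ φ , ψ ⟫ ≈ ⟪ φ′ , ψ′ ⟫
  ⟪⟫-cong {zero}  e e′ = *-cong (e []) (e′ [])
  ⟪⟫-cong {suc n} e e′ = +-cong (⟪⟫-cong (e ∘ (false ∷_)) (e′ ∘ (false ∷_))) (⟪⟫-cong (e ∘ (true ∷_)) (e′ ∘ (true ∷_)))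

  ⟪⟫-+ʳ : ∀ {n} (φ ψ ψ′ : Form n) → ⟪ φ , (λ U → ψ U + ψ′ U) ⟫ ≈ ⟪ φ , ψ ⟫ + ⟪ φ , ψ′ ⟫
  ⟪⟫-+ʳ {zero}  φ ψ ψ′ = distribˡ _ _ _
  ⟪⟫-+ʳ {suc n} φ ψ ψ′ = trans (+-cong (⟪⟫-+ʳ (φ ∘ (false ∷_)) (ψ ∘ (false ∷_)) (ψ′ ∘ (false ∷_))) (⟪⟫-+ʳ (φ ∘ (true ∷_)) (ψ ∘ (true ∷_)) (ψ′ ∘ (true ∷_))))
    (solve 4 (λ a b c d → (a :+ b) :+ (c :+ d) := (a :+ c) :+ (b :+ d)) refl _ _ _ _)

  ⟪⟫-+ˡ : ∀ {n} (φ φ′ ψ : Form n) → ⟪ (λ U → φ U + φ′ U) , ψ ⟫ ≈ ⟪ φ , ψ ⟫ + ⟪ φ′ , ψ ⟫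
  ⟪⟫-+ˡ {zero}  φ φ′ ψ = distribʳ _ _ _
  ⟪⟫-+ˡ {suc n} φ φ′ ψ = trans (+-cong (⟪⟫-+ˡ (φ ∘ (false ∷_)) (φ′ ∘ (false ∷_)) (ψ ∘ (false ∷_))) (⟪⟫-+ˡ (φ ∘ (true ∷_)) (φ′ ∘ (true ∷_)) (ψ ∘ (true ∷_))))
    (solve 4 (λ a b c d → (a :+ b) :+ (c :+ d) := (a :+ c) :+ (b :+ d)) refl _ _ _ _)

  ⟪⟫-scaleʳ : ∀ {n} a (φ ψ : Form n) → ⟪ φ , (λ U → a * ψ U) ⟫ ≈ a * ⟪ φ , ψ ⟫
  ⟪⟫-scaleʳ {zero}  a φ ψ = solve 3 (λ a x y → x :* (a :* y) := a :* (x :* y)) refl a _ _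
  ⟪⟫-scaleʳ {suc n} a φ ψ = trans (+-cong (⟪⟫-scaleʳ a (φ ∘ (false ∷_)) (ψ ∘ (false ∷_))) (⟪⟫-scaleʳ a (φ ∘ (true ∷_)) (ψ ∘ (true ∷_)))) (sym (distribˡ a _ _))

  ⟪⟫-scaleˡ : ∀ {n} a (φ ψ : Form n) → ⟪ (λ U → a * φ U) , ψ ⟫ ≈ a * ⟪ φ , ψ ⟫
  ⟪⟫-scaleˡ {zero}  a φ ψ = *-assoc a _ _
  ⟪⟫-scaleˡ {suc n} a φ ψ = trans (+-cong (⟪⟫-scaleˡ a (φ ∘ (false ∷_)) (ψ ∘ (false ∷_))) (⟪⟫-scaleˡ a (φ ∘ (true ∷_)) (ψ ∘ (true ∷_)))) (sym (distribˡ a _ _))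

  ⟪⟫-zeroʳ : ∀ {n} (φ : Form n) → ⟪ φ , (λ _ → 0#) ⟫ ≈ 0#
  ⟪⟫-zeroʳ {zero}  φ = zeroʳ _
  ⟪⟫-zeroʳ {suc n} φ = trans (+-cong (⟪⟫-zeroʳ {n} _) (⟪⟫-zeroʳ {n} _)) (+-identityʳ 0#)

  ⟪⟫-zeroˡ : ∀ {n} (ψ : Form n) → ⟪ (λ _ → 0#) , ψ ⟫ ≈ 0#
  ⟪⟫-zeroˡ {zero}  ψ = zeroˡ _
  ⟪⟫-zeroˡ {suc n} ψ = trans (+-cong (⟪⟫-zeroˡ {n} _) (⟪⟫-zeroˡ {n} _)) (+-identityʳ 0#)

  ⟪𝟙∅⟫ : ∀ {n} (ψ : Form n) → ⟪ 𝟙∅ , ψ ⟫ ≈ ψ ⊥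
  ⟪𝟙∅⟫ {zero}  ψ = *-identityˡ _
  ⟪𝟙∅⟫ {suc n} ψ = trans (+-cong (⟪𝟙∅⟫ (ψ ∘ (false ∷_))) (⟪⟫-zeroˡ {n} _)) (+-identityʳ _)

  module _ (ρ : Carrier) where

    -- From a dent on the upper side to the next vertical lozenge all lozenges of the strip lean
    -- right, and from there to the next dent they lean left. This is the interlacing, with ƛ = ρ
    -- and κ = 1. The first bit stands for the down-pointing triangle with which a strip below ℓ
    -- begins.
    fresh-run : ∀ {n} b (D : Subset n) (φ : Form n) → Interlacing.fresh 1# ρ φ (b ∷ D) ≈ run ρ (not b) D φ
    fresh-run true  []      φ = refl
    fresh-run false []      φ = refl
    fresh-run false (d ∷ D) φ = trans (*-identityˡ _) (fresh-run d D (φ ∘ (false ∷_)))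
    fresh-run true  (d ∷ D) φ = +-cong (fresh-run d D (φ ∘ (true ∷_))) (pending-run d D (φ ∘ (false ∷_)))
      where
      pending-run : ∀ {n} d (D : Subset n) (φ : Form n) →
        Interlacing.pending 1# ρ φ (d ∷ D) ≈ (if d then 0# else ρ * run ρ false D φ)
      pending-run true  D       φ = refl
      pending-run false []      φ = refl
      pending-run false (d ∷ D) φ = *-congˡ (+-cong (fresh-run d D (φ ∘ (true ∷_))) (pending-run d D (φ ∘ (false ∷_))))

    open Interlacing ρ 1#

    mutual
      -- `run` sums over the lower side of a strip with given upper side, whereas `upperForm` sums
      -- over the upper side with given lower side: the two operators are transposes of each other.
      -- As the sides change roles, so do κ and ƛ. The appended `true` says that no triangle follows
      -- the last up-pointing one of a strip above ℓ.
      run-fresh : ∀ {n} (φ : Form n) (Φ : Form (suc n)) →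
        ⟪ φ , (λ D → run ρ false (D ∷ʳ true) Φ) ⟫ ≈ ⟪ fresh φ , Φ ⟫
      run-fresh {zero} φ Φ = solve 3 (λ x y z → x :* (y :+ con (+ 0)) := con (+ 0) :* z :+ x :* y) refl _ _ _
      run-fresh {suc n} φ Φ = begin
        ⟪ φ₀ , (λ D → run ρ true (D ∷ʳ true) Φₜ + ρ * run ρ false (D ∷ʳ true) Φ₀) ⟫
          + ⟪ φₜ , (λ D → run ρ false (D ∷ʳ true) Φₜ + 0#) ⟫
          ≈⟨ +-cong (trans (⟪⟫-+ʳ φ₀ _ _) (+-cong (run-pending φ₀ Φₜ) (trans (⟪⟫-scaleʳ ρ φ₀ _) (*-congˡ (run-fresh φ₀ Φ₀)))))
                    (trans (⟪⟫-cong {φ = φₜ} (λ _ → refl) (λ _ → +-identityʳ _)) (run-fresh φₜ Φₜ)) ⟩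
        ⟪ pending φ₀ , Φₜ ⟫ + ρ * ⟪ fresh φ₀ , Φ₀ ⟫ + ⟪ fresh φₜ , Φₜ ⟫
          ≈⟨ solve 3 (λ a b c → a :+ b :+ c := b :+ (c :+ a)) refl _ _ _ ⟩
        ρ * ⟪ fresh φ₀ , Φ₀ ⟫ + (⟪ fresh φₜ , Φₜ ⟫ + ⟪ pending φ₀ , Φₜ ⟫)
          ≈⟨ +-cong (sym (⟪⟫-scaleˡ ρ (fresh φ₀) Φ₀)) (sym (⟪⟫-+ˡ (fresh φₜ) (pending φ₀) Φₜ)) ⟩
        ⟪ (λ U → ρ * fresh φ₀ U) , Φ₀ ⟫ + ⟪ next φ , Φₜ ⟫
          ≈⟨ +-cong (⟪⟫-cong {φ = λ U → ρ * fresh φ₀ U} {fresh φ ∘ (false ∷_)} {Φ₀} (λ { (_ ∷ _) → refl }) (λ _ → refl))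
                    (⟪⟫-cong {φ = next φ} {fresh φ ∘ (true ∷_)} {Φₜ} (λ { (_ ∷ _) → refl }) (λ _ → refl)) ⟩
        ⟪ fresh φ , Φ ⟫ ∎
        where
        φ₀ = φ ∘ (false ∷_)
        φₜ = φ ∘ (true ∷_)
        Φ₀ = Φ ∘ (false ∷_)
        Φₜ = Φ ∘ (true ∷_)

      run-pending : ∀ {n} (φ : Form n) (Φ : Form (suc n)) →
        ⟪ φ , (λ D → run ρ true (D ∷ʳ true) Φ) ⟫ ≈ ⟪ pending φ , Φ ⟫
      run-pending {zero} φ Φ = solve 3 (λ x y z → x :* y := con (+ 1) :* x :* y :+ con (+ 0) :* z) refl _ _ _
      run-pending {suc n} φ Φ = begin
        ⟪ φ₀ , (λ D → run ρ true (D ∷ʳ true) Φ₀) ⟫ + ⟪ φₜ , (λ D → run ρ false (D ∷ʳ true) Φ₀) ⟫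
          ≈⟨ +-cong (run-pending φ₀ Φ₀) (run-fresh φₜ Φ₀) ⟩
        ⟪ pending φ₀ , Φ₀ ⟫ + ⟪ fresh φₜ , Φ₀ ⟫ ≈⟨ trans (+-comm _ _) (sym (⟪⟫-+ˡ (fresh φₜ) (pending φ₀) Φ₀)) ⟩
        ⟪ next φ , Φ₀ ⟫ ≈⟨ sym (+-identityʳ _) ⟩
        ⟪ next φ , Φ₀ ⟫ + 0#
          ≈⟨ +-cong (⟪⟫-cong {φ = next φ} {pending φ ∘ (false ∷_)} {Φ₀} (λ { (_ ∷ _) → sym (*-identityˡ _) }) (λ _ → refl))
                    (sym (⟪⟫-zeroˡ (Φ ∘ (true ∷_)))) ⟩
        ⟪ pending φ , Φ ⟫ ∎
        where
        φ₀ = φ ∘ (false ∷_)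
        φₜ = φ ∘ (true ∷_)
        Φ₀ = Φ ∘ (false ∷_)

  glue-cong : ∀ {n} (X Y : Subset n) {Φ Ψ : Form n} → (∀ U → Φ U ≈ Ψ U) → ∀ U → glue X Y Φ U ≈ glue X Y Ψ U
  glue-cong []          []          e []          = e []
  glue-cong (true ∷ X)  (y ∷ Y)     e (true ∷ U)  = glue-cong X Y (e ∘ (y ∷_)) U
  glue-cong (true ∷ X)  (y ∷ Y)     e (false ∷ U) = refl
  glue-cong (false ∷ X) (true ∷ Y)  e (true ∷ U)  = refl
  glue-cong (false ∷ X) (false ∷ Y) e (true ∷ U)  = glue-cong X Y (e ∘ (true ∷_)) U
  glue-cong (false ∷ X) (y ∷ Y)     e (false ∷ U) = glue-cong X Y (e ∘ (y ∷_)) U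

  glue-zero : ∀ {n} (X Y : Subset n) U → glue X Y (λ _ → 0#) U ≈ 0#
  glue-zero []          []          []          = refl
  glue-zero (true ∷ X)  (y ∷ Y)     (true ∷ U)  = glue-zero X Y U
  glue-zero (true ∷ X)  (y ∷ Y)     (false ∷ U) = refl
  glue-zero (false ∷ X) (true ∷ Y)  (true ∷ U)  = refl
  glue-zero (false ∷ X) (false ∷ Y) (true ∷ U)  = glue-zero X Y U
  glue-zero (false ∷ X) (y ∷ Y)     (false ∷ U) = glue-zero X Y U

  glue-⊥ : ∀ {n} (Φ : Form n) U → glue ⊥ ⊥ Φ U ≈ Φ U
  glue-⊥ Φ []          = refl
  glue-⊥ Φ (true ∷ U)  = glue-⊥ (Φ ∘ (true ∷_)) U
  glue-⊥ Φ (false ∷ U) = glue-⊥ (Φ ∘ (false ∷_)) U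

  glue-at-⊥ : ∀ {n} (Y : Subset n) (Φ : Form n) → glue ⊥ Y Φ ⊥ ≈ Φ Y
  glue-at-⊥ []      Φ = refl
  glue-at-⊥ (y ∷ Y) Φ = glue-at-⊥ Y (Φ ∘ (y ∷_))

  -- Below the last strip every down-pointing triangle is absent.
  glue-⊤ : ∀ {n} (X : Subset n) U → glue X ⊤ (λ _ → 1#) U ≈ glue X ⊥ 𝟙∅ U
  glue-⊤ []          []          = refl
  glue-⊤ (true ∷ X)  (true ∷ U)  = glue-⊤ X U
  glue-⊤ (true ∷ X)  (false ∷ U) = refl
  glue-⊤ (false ∷ X) (true ∷ U)  = sym (glue-zero X ⊥ U)
  glue-⊤ (false ∷ X) (false ∷ U) = glue-⊤ X U

  pairing-some : ∀ {n} (F L : Form (suc n)) x y (X Y : Subset n) → x ∨ y ≡ true →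
    ⟪ F , glue (x ∷ X) (y ∷ Y) L ⟫ ≈ ⟪ F ∘ (x ∷_) , glue X Y (L ∘ (y ∷_)) ⟫
  pairing-some {n} F L true  y    X Y _ = trans (+-congʳ (⟪⟫-zeroʳ {n} _)) (+-identityˡ _)
  pairing-some {n} F L false true X Y _ = trans (+-congˡ (⟪⟫-zeroʳ {n} _)) (+-identityʳ _)

  -- `glue X Y L` is supported on the sets X ∪ Z with Z disjoint from X ∪ Y, and its value there is
  -- `L (Y ∪ Z)`. Since X ∪ Y = X′ ∪ Y′, the same sets Z index both sums, which can thus be compared
  -- term by term.
  pairing-shuffle : ∀ {n} (X Y X′ Y′ : Subset n) → X ∪ Y ≡ X′ ∪ Y′ → X ∩ Y ≡ X′ ∩ Y′ →
    ∀ k k′ (F L F′ L′ : Form n) →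
    (∀ Z → Config X Y X′ Y′ Z → k * (F (X ∪ Z) * L (Y ∪ Z)) ≈ k′ * (F′ (X′ ∪ Z) * L′ (Y′ ∪ Z))) →
    k * ⟪ F , glue X Y L ⟫ ≈ k′ * ⟪ F′ , glue X′ Y′ L′ ⟫
  pairing-shuffle [] [] [] [] _ _ k k′ F L F′ L′ e = e [] []
  pairing-shuffle (x ∷ X) (y ∷ Y) (x′ ∷ X′) (y′ ∷ Y′) e∪ e∩ k k′ F L F′ L′ e
    with shuffled-or-empty x y x′ y′ (Vecₚ.∷-injectiveˡ e∪) (Vecₚ.∷-injectiveˡ e∩)
  ... | inj₂ ((≡.refl , ≡.refl) , (≡.refl , ≡.refl)) = trans (distribˡ k _ _) (trans
    (+-cong (rec false) (rec true)) (sym (distribˡ k′ _ _)))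
    where
    rec : ∀ z → k * ⟪ F ∘ (z ∷_) , glue (false ∷ X) (false ∷ Y) L ∘ (z ∷_) ⟫
              ≈ k′ * ⟪ F′ ∘ (z ∷_) , glue (false ∷ X′) (false ∷ Y′) L′ ∘ (z ∷_) ⟫
    rec false = pairing-shuffle X Y X′ Y′ (Vecₚ.∷-injectiveʳ e∪) (Vecₚ.∷-injectiveʳ e∩) k k′
      (F ∘ (false ∷_)) (L ∘ (false ∷_)) (F′ ∘ (false ∷_)) (L′ ∘ (false ∷_)) (λ Z c → e (false ∷ Z) (none false c))
    rec true = pairing-shuffle X Y X′ Y′ (Vecₚ.∷-injectiveʳ e∪) (Vecₚ.∷-injectiveʳ e∩) k k′
      (F ∘ (true ∷_)) (L ∘ (true ∷_)) (F′ ∘ (true ∷_)) (L′ ∘ (true ∷_)) (λ Z c → e (true ∷ Z) (none true c))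
  ... | inj₁ s = trans (*-congˡ (pairing-some F L x y X Y (nonempty s)))
    (trans (pairing-shuffle X Y X′ Y′ (Vecₚ.∷-injectiveʳ e∪) (Vecₚ.∷-injectiveʳ e∩) k k′
        (F ∘ (x ∷_)) (L ∘ (y ∷_)) (F′ ∘ (x′ ∷_)) (L′ ∘ (y′ ∷_)) step)
      (sym (*-congˡ (pairing-some F′ L′ x′ y′ X′ Y′ (nonempty (Shuffled-sym s))))))
    where
    nonempty : ∀ {x y x′ y′} → Shuffled x y x′ y′ → x ∨ y ≡ true
    nonempty both  = ≡.refl
    nonempty keepˡ = ≡.refl
    nonempty keepʳ = ≡.refl
    nonempty swapˡ = ≡.refl
    nonempty swapʳ = ≡.refl
    step : ∀ Z → Config X Y X′ Y′ Z →
      k * (F (x ∷ X ∪ Z) * L (y ∷ Y ∪ Z)) ≈ k′ * (F′ (x′ ∷ X′ ∪ Z) * L′ (y′ ∷ Y′ ∪ Z))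
    step Z c with e (false ∷ Z) (some s c)
    ... | eq rewrite Boolₚ.∨-identityʳ x | Boolₚ.∨-identityʳ y | Boolₚ.∨-identityʳ x′ | Boolₚ.∨-identityʳ y′ = eq

-- Exponents of q

module ℕShuffle = ShuffledPairs ℕₚ.+-0-commutativeMonoid

oneℕ-scale : ∀ {n} k (e : Fin n → ℕ) U → oneℕ (λ u → k ℕ.* e u) U ≡ k ℕ.* oneℕ e U
oneℕ-scale k e []          = ≡.sym (ℕₚ.*-zeroʳ k)
oneℕ-scale k e (true ∷ U)  = ≡.trans (cong (k ℕ.* e zero ℕ.+_) (oneℕ-scale k (e ∘ suc) U)) (≡.sym (ℕₚ.*-distribˡ-+ k _ _))
oneℕ-scale k e (false ∷ U) = oneℕ-scale k (e ∘ suc) U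

oneℕ-const : ∀ {n} k (U : Subset n) → oneℕ (λ _ → k) U ≡ k ℕ.* size U
oneℕ-const k []          = ≡.sym (ℕₚ.*-zeroʳ k)
oneℕ-const k (true ∷ U)  = ≡.trans (cong (k ℕ.+_) (oneℕ-const k U)) (≡.sym (ℕₚ.*-suc k (size U)))
oneℕ-const k (false ∷ U) = oneℕ-const k U

oneℕ-+ : ∀ {n} N (e f : Fin n → ℕ) → (∀ i → e i ℕ.+ f i ≡ N) → ∀ U → oneℕ e U ℕ.+ oneℕ f U ≡ N ℕ.* size U
oneℕ-+ N e f h []          = ≡.sym (ℕₚ.*-zeroʳ N)
oneℕ-+ N e f h (true ∷ U)  = ≡.trans
  (solve 4 (λ a b c d → (a :+ b) :+ (c :+ d) := (a :+ c) :+ (b :+ d)) ≡.refl (e zero) (oneℕ (e ∘ suc) U) (f zero) _)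
  (≡.trans (cong₂ ℕ._+_ (h zero) (oneℕ-+ N (e ∘ suc) (f ∘ suc) (h ∘ suc) U)) (≡.sym (ℕₚ.*-suc N (size U))))
  where open +-*-Solver
oneℕ-+ N e f h (false ∷ U) = oneℕ-+ N (e ∘ suc) (f ∘ suc) (h ∘ suc) U

pairsℕ-+ : ∀ {n} N (e f : Fin n → Fin n → ℕ) → (∀ i j → e i j ℕ.+ f i j ≡ N) →
  ∀ U → pairsℕ e U ℕ.+ pairsℕ f U ≡ N ℕ.* choose₂ (size U)
pairsℕ-+ N e f h []          = ≡.sym (ℕₚ.*-zeroʳ N)
pairsℕ-+ N e f h (true ∷ U)  = ≡.trans
  (solve 4 (λ a b c d → (a :+ b) :+ (c :+ d) := (a :+ c) :+ (b :+ d)) ≡.refl (oneℕ (e zero ∘ suc) U) _ (oneℕ (f zero ∘ suc) U) _)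
  (≡.trans (cong₂ ℕ._+_ (oneℕ-+ N (e zero ∘ suc) (f zero ∘ suc) (h zero ∘ suc) U) (pairsℕ-+ N _ _ (λ i j → h (suc i) (suc j)) U))
           (≡.sym (ℕₚ.*-distribˡ-+ N (size U) (choose₂ (size U)))))
  where open +-*-Solver
pairsℕ-+ N e f h (false ∷ U) = pairsℕ-+ N _ _ (λ i j → h (suc i) (suc j)) U

-- Every element of U is the smaller or the larger member of size U ∸ 1 pairs.
pairsℕ-min+max : ∀ {n} (g : Fin n → ℕ) U →
  pairsℕ (λ i _ → g i) U ℕ.+ pairsℕ (λ _ j → g j) U ℕ.+ oneℕ g U ≡ size U ℕ.* oneℕ g U
pairsℕ-min+max g []          = ≡.refl
pairsℕ-min+max g (false ∷ U) = pairsℕ-min+max (g ∘ suc) U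
pairsℕ-min+max g (true ∷ U)  = ≡.trans
  (cong (λ t → t ℕ.+ p₁ ℕ.+ (o ℕ.+ p₂) ℕ.+ (g zero ℕ.+ o)) (oneℕ-const (g zero) U))
  (≡.trans (solve 5 (λ g k p r o → g :* k :+ p :+ (o :+ r) :+ (g :+ o) := g :* k :+ (p :+ r :+ o) :+ (g :+ o)) ≡.refl
              (g zero) (size U) p₁ p₂ o)
    (≡.trans (cong (λ t → g zero ℕ.* size U ℕ.+ t ℕ.+ (g zero ℕ.+ o)) (pairsℕ-min+max (g ∘ suc) U))
      (solve 3 (λ g k o → g :* k :+ k :* o :+ (g :+ o) := (con 1 :+ k) :* (g :+ o)) ≡.refl (g zero) (size U) o)))
  where
  open +-*-Solver
  p₁ = pairsℕ (λ i _ → g (suc i)) U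
  p₂ = pairsℕ (λ _ j → g (suc j)) U
  o  = oneℕ (g ∘ suc) U

sum-labels : ∀ {n} (U : Subset n) → sum (labels U) ≡ oneℕ (suc ∘ toℕ) U
sum-labels U = ≡.trans (cong sum (≡.sym (Listₚ.map-id (labels U)))) (go (λ s → s) U)
  where
  go : ∀ {n} (f : ℕ → ℕ) (U : Subset n) → sum (map f (labels U)) ≡ oneℕ (λ u → f (suc (toℕ u))) U
  go f []          = ≡.refl
  go f (true ∷ U)  = cong (f 1 ℕ.+_) (≡.trans (cong sum (≡.sym (Listₚ.map-∘ (labels U)))) (go (f ∘ suc) U))
  go f (false ∷ U) = ≡.trans (cong sum (≡.sym (Listₚ.map-∘ (labels U)))) (go (f ∘ suc) U)

choose₂-half : ∀ k → k ℕ.* (k ∸ 1) ≡ choose₂ k ℕ.* 2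
choose₂-half zero          = ≡.refl
choose₂-half (suc zero)    = ≡.refl
choose₂-half (suc (suc k)) = ≡.trans
  (solve 1 (λ k → (con 2 :+ k) :* (con 1 :+ k) := (con 1 :+ k) :* con 2 :+ (con 1 :+ k) :* k) ≡.refl k)
  (≡.trans (cong (suc k ℕ.* 2 ℕ.+_) (choose₂-half (suc k)))
    (≡.sym (ℕₚ.*-distribʳ-+ 2 (suc k) (choose₂ (suc k)))))
  where open +-*-Solver

half : ∀ N k → (N ℕ.* k ℕ.* (k ∸ 1)) / 2 ≡ N ℕ.* choose₂ k
half N k = ≡.trans (cong (_/ 2) (≡.trans (ℕₚ.*-assoc N k (k ∸ 1))
  (≡.trans (cong (N ℕ.*_) (choose₂-half k)) (≡.sym (ℕₚ.*-assoc N (choose₂ k) 2))))) (m*n/n≡m (N ℕ.* choose₂ k) 2)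

half-suc : ∀ N k → (N ℕ.* k ℕ.* (k ℕ.+ 1)) / 2 ≡ N ℕ.* choose₂ (suc k)
half-suc N k = ≡.trans (cong (_/ 2) (≡.trans (ℕₚ.*-assoc N k (k ℕ.+ 1)) (≡.trans
  (cong (N ℕ.*_) (≡.trans (cong (k ℕ.*_) (ℕₚ.+-comm k 1)) (ℕₚ.*-comm k (suc k)))) (≡.sym (ℕₚ.*-assoc N (suc k) k)))))
  (half N (suc k))

labelSum : ∀ {n} → Subset n → ℕ
labelSum = oneℕ (suc ∘ toℕ)

minSum : ∀ {n} → Subset n → ℕ
minSum = pairsℕ (λ i _ → suc (toℕ i))

-- `expN′` leaves out the summand `b * choose₂ c` of `expN`: that power of q is needed on the
-- left-hand side of `lowerForm-value`.
expP′ expN′ : ∀ {n} → ℕ → ℕ → Subset n → ℕ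
expP′ {n} b c X = labelSum X ℕ.+ suc n ℕ.* (suc b ℕ.* c ℕ.+ choose₂ c)
expN′ b c Y = (b ℕ.+ c) ℕ.* labelSum Y ℕ.+ (b ℕ.+ choose₂ b) ℕ.+ (choose₂ c ℕ.+ suc b ℕ.* c)

expP≡ : ∀ n a b c (X : Subset n) ys → a ℕ.+ b ≡ n → expP a b c (labels X) ys ≡ expP′ b c X
expP≡ _ a b c X ys ≡.refl = ≡.trans
  (cong₂ (λ s t → s ℕ.+ (a ℕ.+ b ℕ.+ 1) ℕ.* (b ℕ.+ 1) ℕ.* c ℕ.+ t) (sum-labels X) (half (a ℕ.+ b ℕ.+ 1) c))
  (solve 5 (λ s a b c t → s :+ (a :+ b :+ con 1) :* (b :+ con 1) :* c :+ (a :+ b :+ con 1) :* t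
     := s :+ (con 1 :+ (a :+ b)) :* ((con 1 :+ b) :* c :+ t)) ≡.refl (labelSum X) a b c (choose₂ c))
  where open +-*-Solver

expN≡ : ∀ {n} a b c xs (Y : Subset n) → expN a b c xs (labels Y) ≡ b ℕ.* choose₂ c ℕ.+ expN′ b c Y
expN≡ a b c xs Y = ≡.trans
  (cong₂ ℕ._+_ (cong₂ (λ s t → (b ℕ.+ c) ℕ.* s ℕ.+ t) (sum-labels Y)
      (≡.trans (cong (λ t → (t ℕ.* (b ℕ.+ 1)) / 2) (≡.sym (ℕₚ.*-identityˡ b))) (half-suc 1 b)))
    (half-suc (b ℕ.+ 1) c))
  (solve 5 (λ s b c t u → (b :+ c) :* s :+ con 1 :* (b :+ u) :+ (b :+ con 1) :* (c :+ t)
     := b :* t :+ ((b :+ c) :* s :+ (b :+ u) :+ (t :+ (con 1 :+ b) :* c))) ≡.refl (labelSum Y) b c (choose₂ c) (choose₂ b))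
  where open +-*-Solver

depth-complement : ∀ n (u : Fin n) → (n ∸ suc (toℕ u)) ℕ.+ suc (toℕ u) ≡ n
depth-complement n u = ℕₚ.m∸n+n≡m (Finₚ.toℕ<n u)

upperExponent : ∀ {n} → Subset n → ℕ
upperExponent U = oneℕ toℕ U ℕ.+ pairsℕ (λ i j → toℕ i) U

lowerExponent : ∀ {n} → ℕ → Subset n → ℕ
lowerExponent {n} b D = oneℕ (λ u → suc b ℕ.* (n ∸ suc (toℕ u))) D ℕ.+ pairsℕ (λ _ v → n ∸ suc (toℕ v)) D

upperExponent≡ : ∀ {n} (U : Subset n) → upperExponent U ℕ.+ (size U ℕ.+ choose₂ (size U)) ≡ labelSum U ℕ.+ minSum U
upperExponent≡ U = ≡.trans
  (solve 4 (λ a b c d → (a :+ b) :+ (c :+ d) := (c :+ a) :+ (d :+ b)) ≡.refl (oneℕ toℕ U) _ (size U) _)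
  (≡.sym (cong₂ ℕ._+_ (oneℕ-suc toℕ U) (pairsℕ-suc (λ i _ → toℕ i) U)))
  where open +-*-Solver

-- Depth and label of a position add up to n. The added multiple of `labelSum D` is just enough to
-- complete all depths: `pairsℕ-min+max` turns the summand with factor `size D` into the labels of
-- the larger members of the pairs, a further copy of the label sum, and `minSum D`, which remains.
lowerExponent≡ : ∀ {n} b (D : Subset n) → lowerExponent b D ℕ.+ (b ℕ.+ size D) ℕ.* labelSum D
  ≡ n ℕ.* (suc b ℕ.* size D ℕ.+ choose₂ (size D)) ℕ.+ minSum D
lowerExponent≡ {n} b D = ≡.trans
  (cong (λ t → t ℕ.+ Pd ℕ.+ (b ℕ.+ k) ℕ.* s) (oneℕ-scale (suc b) (λ u → n ∸ suc (toℕ u)) D))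
  (≡.trans (solve 5 (λ b k o p s → (con 1 :+ b) :* o :+ p :+ (b :+ k) :* s := (con 1 :+ b) :* o :+ p :+ b :* s :+ k :* s) ≡.refl b k O Pd s)
  (≡.trans (cong (suc b ℕ.* O ℕ.+ Pd ℕ.+ b ℕ.* s ℕ.+_) (≡.sym (pairsℕ-min+max (suc ∘ toℕ) D)))
  (≡.trans (solve 6 (λ b o p s e m → (con 1 :+ b) :* o :+ p :+ b :* s :+ (e :+ m :+ s) := (con 1 :+ b) :* (o :+ s) :+ (p :+ m) :+ e)
              ≡.refl b O Pd s e M)
  (≡.trans (cong₂ (λ x y → suc b ℕ.* x ℕ.+ y ℕ.+ e)
      (oneℕ-+ n (λ u → n ∸ suc (toℕ u)) (suc ∘ toℕ) (depth-complement n) D)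
      (pairsℕ-+ n (λ _ v → n ∸ suc (toℕ v)) (λ _ v → suc (toℕ v)) (λ _ → depth-complement n) D))
    (solve 5 (λ b n k c e → (con 1 :+ b) :* (n :* k) :+ n :* c :+ e := n :* ((con 1 :+ b) :* k :+ c) :+ e) ≡.refl b n k (choose₂ k) e)))))
  where
  open +-*-Solver
  k = size D
  s = labelSum D
  e = minSum D
  O = oneℕ (λ u → n ∸ suc (toℕ u)) D
  Pd = pairsℕ (λ _ v → n ∸ suc (toℕ v)) D
  M = pairsℕ (λ _ v → suc (toℕ v)) D

module _ {n} (X Y X′ Y′ Z : Subset n) where

  totalExponent : ℕ → ℕ → ℕ → ℕ → ℕ
  totalExponent b c b′ c′ = upperExponent (X ∪ Z) ℕ.+ lowerExponent b (Y ∪ Z) ℕ.+ (minSum X′ ℕ.+ minSum Y′)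
    ℕ.+ (expP′ b′ c′ X′ ℕ.+ expN′ b c Y)

  -- Once the labels of Z are compensated, the right-hand side is visibly symmetric in (X , Y , b ,
  -- c) and (X′ , Y′ , b′ , c′), except for the sums of minima, to which `pairs-shuffle` applies.
  -- The compensation is harmless because b + c = b′ + c′. This is the identity behind α.
  totalExponent≡ : ∀ b c b′ c′ → Disjoint X Z → Disjoint Y Z → size (X ∪ Z) ≡ b → size (Y ∪ Z) ≡ c →
    totalExponent b c b′ c′ ℕ.+ (b ℕ.+ c) ℕ.* labelSum Z
      ≡ labelSum X ℕ.+ labelSum X′ ℕ.+ labelSum Z
        ℕ.+ (minSum (X ∪ Z) ℕ.+ minSum (Y ∪ Z) ℕ.+ (minSum X′ ℕ.+ minSum Y′))
        ℕ.+ suc n ℕ.* ((suc b ℕ.* c ℕ.+ choose₂ c) ℕ.+ (suc b′ ℕ.* c′ ℕ.+ choose₂ c′))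
  totalExponent≡ b c b′ c′ dX dY ≡.refl ≡.refl = ≡.trans
    (solve 9 (λ A B e Q sY bb cc P sZ → A :+ B :+ e :+ (P :+ (Q :* sY :+ bb :+ cc)) :+ Q :* sZ
       := (A :+ bb) :+ (B :+ Q :* (sY :+ sZ)) :+ e :+ P :+ cc) ≡.refl
       (upperExponent (X ∪ Z)) (lowerExponent b (Y ∪ Z)) (minSum X′ ℕ.+ minSum Y′) (b ℕ.+ c) (labelSum Y)
       (b ℕ.+ choose₂ b) (choose₂ c ℕ.+ suc b ℕ.* c) (expP′ b′ c′ X′) (labelSum Z))
    (≡.trans (cong₂ (λ s t → s ℕ.+ t ℕ.+ (minSum X′ ℕ.+ minSum Y′) ℕ.+ expP′ b′ c′ X′ ℕ.+ (choose₂ c ℕ.+ suc b ℕ.* c))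
        (≡.trans (upperExponent≡ (X ∪ Z)) (cong (ℕ._+ minSum (X ∪ Z)) (ℕShuffle.one-∪ (suc ∘ toℕ) dX)))
        (≡.trans (cong (λ t → lowerExponent b (Y ∪ Z) ℕ.+ (b ℕ.+ c) ℕ.* t) (≡.sym (ℕShuffle.one-∪ (suc ∘ toℕ) dY)))
                 (lowerExponent≡ b (Y ∪ Z))))
      (solve 10 (λ sX sZ eU n bc tc eD eXY sX′ T → (sX :+ sZ :+ eU) :+ (n :* (bc :+ tc) :+ eD) :+ eXY
            :+ (sX′ :+ (con 1 :+ n) :* T) :+ (tc :+ bc)
          := sX :+ sX′ :+ sZ :+ (eU :+ eD :+ eXY) :+ (con 1 :+ n) :* ((bc :+ tc) :+ T)) ≡.refl
        (labelSum X) (labelSum Z) (minSum (X ∪ Z)) n (suc b ℕ.* c) (choose₂ c) (minSum (Y ∪ Z)) (minSum X′ ℕ.+ minSum Y′)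
        (labelSum X′) (suc b′ ℕ.* c′ ℕ.+ choose₂ c′)))
    where open +-*-Solver

totalExponent-shuffle : ∀ {n} {X Y X′ Y′ Z : Subset n} b c b′ c′ → Config X Y X′ Y′ Z → b ℕ.+ c ≡ b′ ℕ.+ c′ →
  size (X ∪ Z) ≡ b → size (Y ∪ Z) ≡ c → size (X′ ∪ Z) ≡ b′ → size (Y′ ∪ Z) ≡ c′ →
  totalExponent X Y X′ Y′ Z b c b′ c′ ≡ totalExponent X′ Y′ X Y Z b′ c′ b c
totalExponent-shuffle {n} {X} {Y} {X′} {Y′} {Z} b c b′ c′ cfg eq sU sD sU′ sD′ = ℕₚ.+-cancelʳ-≡ ((b ℕ.+ c) ℕ.* labelSum Z) _ _
  (≡.trans (totalExponent≡ X Y X′ Y′ Z b c b′ c′ (Config-disjointˡ cfg) (Config-disjointʳ cfg) sU sD)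
  (≡.trans (cong₂ ℕ._+_ (cong₂ (λ s t → s ℕ.+ labelSum Z ℕ.+ t) (ℕₚ.+-comm (labelSum X) (labelSum X′))
              (ℕShuffle.pairs-shuffle (λ i _ → suc (toℕ i)) cfg))
            (cong (suc n ℕ.*_) (ℕₚ.+-comm (suc b ℕ.* c ℕ.+ choose₂ c) (suc b′ ℕ.* c′ ℕ.+ choose₂ c′))))
  (≡.trans (≡.sym (totalExponent≡ X′ Y′ X Y Z b′ c′ b c (Config-disjointˡ (Config-sym cfg)) (Config-disjointʳ (Config-sym cfg)) sU′ sD′))
    (cong (λ Q → totalExponent X′ Y′ X Y Z b′ c′ b c ℕ.+ Q ℕ.* labelSum Z) (≡.sym eq)))))

-- The summand belonging to a single set Z

module Summands {ℓ₁ ℓ₂} (R : CommutativeRing ℓ₁ ℓ₂) (q : CommutativeRing.Carrier R) where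
  open CommutativeRing R hiding (zero)
  open import Relation.Binary.Reasoning.Setoid setoid
  open QAnalogue R q public
  open Pairing R public
  module Shuffle* = ShuffledPairs *-commutativeMonoid

  upper : ∀ {n} a b → b ℕ.+ a ≡ n → Form n
  upper a b eq = subst Form eq (upperForm a b)

  lower : ∀ {n} z b c → c ℕ.+ z ≡ n → Form n
  lower z b c eq = subst Form eq (lowerForm z (suc b) c)

  upper-value : ∀ {n} a b (eq : b ℕ.+ a ≡ n) U → size U ≡ b →
    Δ q (range1 b) * upper a b eq U ≈ pow q (upperExponent U) * gaps U
  upper-value a b ≡.refl U = upperForm-value a b U

  upper-supported : ∀ {n} a b (eq : b ℕ.+ a ≡ n) U → size U ≢ b → Δ q (range1 b) * upper a b eq U ≈ 0#
  upper-supported a b ≡.refl U = upperForm-supported a b U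

  lower-value : ∀ {n} z b c (eq : c ℕ.+ z ≡ n) U → size U ≡ c →
    Δ q (range1 c) * pow q (b ℕ.* choose₂ c) * lower z b c eq U ≈ pow q (lowerExponent b U) * gaps U
  lower-value z b c ≡.refl U = lowerForm-value z b c U

  -- The factor of M(V(X,Y)) in the formula with cleared denominators. The summand `b * choose₂ c`
  -- is kept apart since it is consumed by `lower-value`.
  constant : ∀ {n} → ℕ → ℕ → ℕ → ℕ → (X Y X′ Y′ : Subset n) → Carrier
  constant b c b′ c′ X Y X′ Y′ = Δ q (range1 b) * Δ q (range1 c) * Δ q (labels X′) * Δ q (labels Y′)
    * pow q (expP′ b′ c′ X′ ℕ.+ (b ℕ.* choose₂ c ℕ.+ expN′ b c Y))

  summand-value : ∀ {n} a b c z b′ c′ (eqU : b ℕ.+ a ≡ n) (eqL : c ℕ.+ z ≡ n) (X Y X′ Y′ Z : Subset n) →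
    size (X ∪ Z) ≡ b → size (Y ∪ Z) ≡ c →
    constant b c b′ c′ X Y X′ Y′ * (upper a b eqU (X ∪ Z) * lower z b c eqL (Y ∪ Z))
      ≈ pow q (totalExponent X Y X′ Y′ Z b c b′ c′)
        * (gaps (X ∪ Z) * gaps (Y ∪ Z) * (gaps X′ * gaps Y′))
  summand-value a b c z b′ c′ eqU eqL X Y X′ Y′ Z sU sD = begin
    db * dc * dX * dY * pow q (P ℕ.+ (T ℕ.+ N)) * (u * l)
      ≈⟨ *-congʳ (*-congˡ (trans (pow-+ q P (T ℕ.+ N)) (*-congˡ (pow-+ q T N)))) ⟩
    db * dc * dX * dY * (pow q P * (pow q T * pow q N)) * (u * l)
      ≈⟨ solve 9 (λ db dc dX dY P T N u l → db :* dc :* dX :* dY :* (P :* (T :* N)) :* (u :* l)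
                    := (db :* u) :* (dc :* T :* l) :* (dX :* dY) :* (P :* N)) refl _ _ _ _ _ _ _ _ _ ⟩
    (db * u) * (dc * pow q T * l) * (dX * dY) * (pow q P * pow q N)
      ≈⟨ *-congʳ (*-cong (*-cong (upper-value a b eqU (X ∪ Z) sU) (lower-value z b c eqL (Y ∪ Z) sD))
                         (*-cong (Δ-labels X′) (Δ-labels Y′))) ⟩
    (pow q A * gaps (X ∪ Z)) * (pow q B * gaps (Y ∪ Z)) * ((pow q (minSum X′) * gaps X′) * (pow q (minSum Y′) * gaps Y′))
      * (pow q P * pow q N)
      ≈⟨ solve 10 (λ A g B h e x f y P N → (A :* g) :* (B :* h) :* ((e :* x) :* (f :* y)) :* (P :* N)
                    := A :* B :* (e :* f) :* (P :* N) :* (g :* h :* (x :* y))) refl _ _ _ _ _ _ _ _ _ _ ⟩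
    pow q A * pow q B * (pow q (minSum X′) * pow q (minSum Y′)) * (pow q P * pow q N) * Γ
      ≈⟨ *-congʳ (sym (trans (pow-+ q (A ℕ.+ B ℕ.+ (minSum X′ ℕ.+ minSum Y′)) (P ℕ.+ N))
           (*-cong (trans (pow-+ q (A ℕ.+ B) (minSum X′ ℕ.+ minSum Y′)) (*-cong (pow-+ q A B) (pow-+ q (minSum X′) (minSum Y′))))
                   (pow-+ q P N)))) ⟩
    _ ∎
    where
    db = Δ q (range1 b)
    dc = Δ q (range1 c)
    dX = Δ q (labels X′)
    dY = Δ q (labels Y′)
    P = expP′ b′ c′ X′
    T = b ℕ.* choose₂ c
    N = expN′ b c Y
    A = upperExponent (X ∪ Z)
    B = lowerExponent b (Y ∪ Z)
    u = upper a b eqU (X ∪ Z)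
    l = lower z b c eqL (Y ∪ Z)
    Γ = gaps (X ∪ Z) * gaps (Y ∪ Z) * (gaps X′ * gaps Y′)

  summand-zero : ∀ {n} a b c z b′ c′ (eqU : b ℕ.+ a ≡ n) (eqL : c ℕ.+ z ≡ n) (X Y X′ Y′ Z : Subset n) →
    size (X ∪ Z) ≢ b → constant b c b′ c′ X Y X′ Y′ * (upper a b eqU (X ∪ Z) * lower z b c eqL (Y ∪ Z)) ≈ 0#
  summand-zero a b c z b′ c′ eqU eqL X Y X′ Y′ Z ne = trans
    (solve 7 (λ db dc dX dY e u l → db :* dc :* dX :* dY :* e :* (u :* l) := (db :* u) :* (dc :* dX :* dY :* e :* l)) refl
       _ _ _ _ _ _ _)
    (trans (*-congʳ (upper-supported a b eqU (X ∪ Z) ne)) (zeroˡ _))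

  -- `m` is the number of vertical lozenges that cross ℓ. If Z has another size, the upper form
  -- vanishes on both sides; otherwise all four sets of dents have the size for which the closed
  -- values hold.
  summand-shuffle : ∀ {n} (a b c z a′ b′ c′ z′ m : ℕ)
    (eqU : b ℕ.+ a ≡ n) (eqL : c ℕ.+ z ≡ n) (eqU′ : b′ ℕ.+ a′ ≡ n) (eqL′ : c′ ℕ.+ z′ ≡ n) (X Y X′ Y′ : Subset n) →
    b ℕ.+ c ≡ b′ ℕ.+ c′ → size X ℕ.+ m ≡ b → size Y ℕ.+ m ≡ c → size X′ ℕ.+ m ≡ b′ → size Y′ ℕ.+ m ≡ c′ →
    ∀ Z → Config X Y X′ Y′ Z →
    constant b c b′ c′ X Y X′ Y′ * (upper a b eqU (X ∪ Z) * lower z b c eqL (Y ∪ Z))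
      ≈ constant b′ c′ b c X′ Y′ X Y * (upper a′ b′ eqU′ (X′ ∪ Z) * lower z′ b′ c′ eqL′ (Y′ ∪ Z))
  summand-shuffle a b c z a′ b′ c′ z′ m eqU eqL eqU′ eqL′ X Y X′ Y′ bc sX sY sX′ sY′ Z cfg with size Z ℕ.≟ m
  ... | no ne = trans (summand-zero a b c z b′ c′ eqU eqL X Y X′ Y′ Z (differs (Config-disjointˡ cfg) sX))
          (sym (summand-zero a′ b′ c′ z′ b c eqU′ eqL′ X′ Y′ X Y Z (differs (Config-disjointˡ (Config-sym cfg)) sX′)))
    where
    differs : ∀ {A} {k} → Disjoint A Z → size A ℕ.+ m ≡ k → size (A ∪ Z) ≢ k
    differs {A} d e f = ne (ℕₚ.+-cancelˡ-≡ (size A) _ _ (≡.trans (≡.sym (size-∪ d)) (≡.trans f (≡.sym e))))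
  ... | yes eq = begin
    _ ≈⟨ summand-value a b c z b′ c′ eqU eqL X Y X′ Y′ Z sU sD ⟩
    _ ≈⟨ *-cong (pow-≡ (totalExponent-shuffle b c b′ c′ cfg bc sU sD sU′ sD′))
                (Shuffle*.pairs-shuffle (λ i j → [ toℕ j ∸ toℕ i ]) cfg) ⟩
    _ ≈⟨ sym (summand-value a′ b′ c′ z′ b c eqU′ eqL′ X′ Y′ X Y Z sU′ sD′) ⟩
    _ ∎
    where
    agrees : ∀ {A} {k} → Disjoint A Z → size A ℕ.+ m ≡ k → size (A ∪ Z) ≡ k
    agrees {A} d e = ≡.trans (size-∪ d) (≡.trans (cong (size A ℕ.+_) eq) e)
    sU = agrees (Config-disjointˡ cfg) sX
    sD = agrees (Config-disjointʳ cfg) sY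
    sU′ = agrees (Config-disjointˡ (Config-sym cfg)) sX′
    sD′ = agrees (Config-disjointʳ (Config-sym cfg)) sY′

-- Membership, and the up-pointing triangles of a row

∈ᵇ⇒∈ : ∀ {t} G → t ∈ᵇ G ≡ true → t ∈ G
∈ᵇ⇒∈ {t} (u ∷ G) e with t ≟T u
... | yes eq = here eq
... | no _   = there (∈ᵇ⇒∈ G e)

∈⇒∈ᵇ : ∀ {t} {G} → t ∈ G → t ∈ᵇ G ≡ true
∈⇒∈ᵇ {t} {G} t∈ = All.lookup (∈ᵇ-all G) t∈

∉⇒∈ᵇ : ∀ {t} G → t ∉ G → t ∈ᵇ G ≡ false
∉⇒∈ᵇ {t} G t∉ with t ∈ᵇ G in eq
... | true  = ⊥-elim (t∉ (∈ᵇ⇒∈ G eq))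
... | false = ≡.refl

module _ {A : Set} where
  ∈-filter⇒ : ∀ p {t : A} xs → t ∈ filter p xs → t ∈ xs × p t ≡ true
  ∈-filter⇒ p (x ∷ xs) t∈ with p x in eq
  ∈-filter⇒ p (x ∷ xs) (here ≡.refl) | true  = here ≡.refl , eq
  ∈-filter⇒ p (x ∷ xs) (there t∈)    | true  = there (proj₁ (∈-filter⇒ p xs t∈)) , proj₂ (∈-filter⇒ p xs t∈)
  ∈-filter⇒ p (x ∷ xs) t∈            | false = there (proj₁ (∈-filter⇒ p xs t∈)) , proj₂ (∈-filter⇒ p xs t∈)

  ⇒∈-filter : ∀ p {t : A} {xs} → t ∈ xs → p t ≡ true → t ∈ filter p xs
  ⇒∈-filter p {xs = x ∷ xs} (here ≡.refl) e rewrite e = here ≡.refl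
  ⇒∈-filter p {xs = x ∷ xs} (there t∈) e with p x
  ... | true  = there (⇒∈-filter p t∈ e)
  ... | false = ⇒∈-filter p t∈ e

  filter-concatMap : ∀ {B : Set} (p : A → Bool) (f : B → List A) xs →
    filter p (concatMap f xs) ≡ concatMap (filter p ∘ f) xs
  filter-concatMap p f []       = ≡.refl
  filter-concatMap p f (x ∷ xs) = ≡.trans (filter-++ p (f x) _) (cong (filter p (f x) ++_) (filter-concatMap p f xs))

candidates-ups : ∀ {B : Set} (p : Tri → Bool) (f : Tri → List B) G →
  concatMap (λ t → if p t then f t else []) G ≡ concatMap f (filter p G)
candidates-ups p f []      = ≡.refl
candidates-ups p f (t ∷ G) with p t
... | true  = cong (f t ++_) (candidates-ups p f G)
... | false = candidates-ups p f G

⊕-+ : ∀ j k → j ⊕ k ≡ j ℤ.+ + (k ℕ.+ k)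
⊕-+ j zero    = ≡.sym (ℤₚ.+-identityʳ j)
⊕-+ j (suc k) = ≡.trans (⊕-+ (j ℤ.+ + 2) k) (≡.trans (ℤₚ.+-assoc j (+ 2) (+ (k ℕ.+ k)))
  (cong (λ m → j ℤ.+ + suc m) (≡.sym (ℕₚ.+-suc k k))))

Reads-intro : ∀ {k} f j (X : Subset k) → (∀ p → f (j ⊕ toℕ p) ≡ not (lookup X p)) → Reads f j X
Reads-intro f j []      e = Unit.tt
Reads-intro f j (x ∷ X) e = e zero , Reads-intro f (j ℤ.+ + 2) X (e ∘ suc)

Reads-elim : ∀ {k} {f} j (X : Subset k) → Reads f j X → ∀ p → f (j ⊕ toℕ p) ≡ not (lookup X p)
Reads-elim j (x ∷ X) (e , es) zero    = e
Reads-elim j (x ∷ X) (e , es) (suc p) = Reads-elim (j ℤ.+ + 2) X es p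

Reads-∷ʳ : ∀ {k} f j (X : Subset k) {x} → Reads f j X → f (j ⊕ k) ≡ not x → Reads f j (X ∷ʳ x)
Reads-∷ʳ f j []      _        e = e , Unit.tt
Reads-∷ʳ f j (y ∷ X) (r , rs) e = r , Reads-∷ʳ f (j ℤ.+ + 2) X rs e

lookup-⊥ : ∀ {n} (p : Fin n) → lookup ⊥ p ≡ false
lookup-⊥ zero    = ≡.refl
lookup-⊥ (suc p) = lookup-⊥ p

lookup-⊤ : ∀ {n} (p : Fin n) → lookup ⊤ p ≡ true
lookup-⊤ zero    = ≡.refl
lookup-⊤ (suc p) = lookup-⊤ p

∈-labels : ∀ {n} (X : Subset n) {i} → i ∈ labels X → ∃ λ (p : Fin n) → i ≡ suc (toℕ p) × lookup X p ≡ true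
∈-labels (true ∷ X) (here ≡.refl) = zero , ≡.refl , ≡.refl
∈-labels (true ∷ X) (there i∈) with ∈-map⁻ suc i∈
... | i , i∈X , ≡.refl with ∈-labels X i∈X
...   | p , e , l = suc p , cong suc e , l
∈-labels (false ∷ X) i∈ with ∈-map⁻ suc i∈
... | i , i∈X , ≡.refl with ∈-labels X i∈X
...   | p , e , l = suc p , cong suc e , l

labels-∈ : ∀ {n} (X : Subset n) p → lookup X p ≡ true → suc (toℕ p) ∈ labels X
labels-∈ (true ∷ X)  zero    e = here ≡.refl
labels-∈ (true ∷ X)  (suc p) e = there (∈-map⁺ suc (labels-∈ X p e))
labels-∈ (false ∷ X) (suc p) e = ∈-map⁺ suc (labels-∈ X p e)

-- Unfolds two triangles at a time, in step with `Reads`, which k + k does not.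
double : ℕ → ℕ
double zero    = zero
double (suc k) = suc (suc (double k))

double-+ : ∀ k → double k ≡ k ℕ.+ k
double-+ zero    = ≡.refl
double-+ (suc k) = cong suc (≡.trans (cong suc (double-+ k)) (≡.sym (ℕₚ.+-suc k k)))

applyUpTo-cong : ∀ {A : Set} {f g : ℕ → A} → (∀ i → f i ≡ g i) → ∀ n → applyUpTo f n ≡ applyUpTo g n
applyUpTo-cong e zero    = ≡.refl
applyUpTo-cong e (suc n) = cong₂ _∷_ (e 0) (applyUpTo-cong (e ∘ suc) n)

rangeℤ-suc : ∀ lo k → rangeℤ lo (suc k) ≡ lo ∷ rangeℤ (lo ℤ.+ + 1) k
rangeℤ-suc lo k = cong₂ _∷_ (ℤₚ.+-identityʳ lo) (≡.trans (Listₚ.map-applyUpTo suc _ k)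
  (≡.trans (applyUpTo-cong (λ i → ≡.sym (ℤₚ.+-assoc lo (+ 1) (+ i))) k) (≡.sym (Listₚ.map-applyUpTo (λ i → i) _ k))))

module _ (nr : Tri → Bool) (r : ℤ) where

  private
    strip : ℤ → ℕ → List Tri
    strip j m = filter isUp (filter nr (map (λ i → (r , i)) (rangeℤ j m)))

    strip-suc : ∀ j m → strip j (suc m) ≡ filter isUp (filter nr ((r , j) ∷ map (λ i → (r , i)) (rangeℤ (j ℤ.+ + 1) m)))
    strip-suc j m = cong (λ l → filter isUp (filter nr (map (λ i → (r , i)) l))) (rangeℤ-suc j m)

    strip-up : ∀ j m x → isUp (r , j) ≡ true → nr (r , j) ≡ not x →
      strip j (suc m) ≡ (if x then [] else (r , j) ∷ []) ++ strip (j ℤ.+ + 1) m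
    strip-up j m true  up e = ≡.trans (strip-suc j m) lemma
      where
      lemma : filter isUp (filter nr ((r , j) ∷ map (λ i → (r , i)) (rangeℤ (j ℤ.+ + 1) m))) ≡ strip (j ℤ.+ + 1) m
      lemma rewrite e = ≡.refl
    strip-up j m false up e = ≡.trans (strip-suc j m) lemma
      where
      lemma : filter isUp (filter nr ((r , j) ∷ map (λ i → (r , i)) (rangeℤ (j ℤ.+ + 1) m))) ≡ (r , j) ∷ strip (j ℤ.+ + 1) m
      lemma rewrite e | up = ≡.refl

    strip-down : ∀ j m → isUp (r , j) ≡ false → strip j (suc m) ≡ strip (j ℤ.+ + 1) m
    strip-down j m dn = ≡.trans (strip-suc j m) lemma
      where
      lemma : filter isUp (filter nr ((r , j) ∷ map (λ i → (r , i)) (rangeℤ (j ℤ.+ + 1) m))) ≡ strip (j ℤ.+ + 1) m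
      lemma with nr (r , j)
      ... | true rewrite dn = ≡.refl
      ... | false = ≡.refl

    +1+1 : ∀ j → j ℤ.+ + 1 ℤ.+ + 1 ≡ j ℤ.+ + 2
    +1+1 j = ℤₚ.+-assoc j (+ 1) (+ 1)

    isUp-+2 : ∀ j → isUp (r , j) ≡ true → isUp (r , j ℤ.+ + 2) ≡ true
    isUp-+2 j up = ≡.trans (cong (λ i → isUp (r , i)) (≡.sym (+1+1 j)))
      (≡.trans (isUp-right r (j ℤ.+ + 1)) (cong not (≡.trans (isUp-right r j) (cong not up))))

    rowUps-∷ : ∀ {k} j x (X : Subset k) → rowUps r j (x ∷ X) ≡ (if x then [] else (r , j) ∷ []) ++ rowUps r (j ℤ.+ + 2) X
    rowUps-∷ j true  X = ≡.refl
    rowUps-∷ j false X = ≡.refl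

  strip-even : ∀ {k} j (X : Subset k) → isUp (r , j) ≡ true → Reads (λ i → nr (r , i)) j X →
    strip j (double k) ≡ rowUps r j X
  strip-even j []                up _        = ≡.refl
  strip-even {suc k} j (x ∷ X) up (e , es) = ≡.trans (strip-up j (suc (double k)) x up e)
    (≡.trans (cong ((if x then [] else (r , j) ∷ []) ++_)
      (≡.trans (strip-down (j ℤ.+ + 1) (double k) (≡.trans (isUp-right r j) (cong not up)))
        (≡.trans (cong (λ i → strip i (double k)) (+1+1 j)) (strip-even (j ℤ.+ + 2) X (isUp-+2 j up) es))))
      (≡.sym (rowUps-∷ j x X)))

  -- Rows above ℓ begin and end with an up-pointing triangle, those below with a down-pointing one
  -- (`strip-odd-down`).
  strip-odd-up : ∀ {k} j (X : Subset (suc k)) → isUp (r , j) ≡ true → Reads (λ i → nr (r , i)) j X →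
    strip j (suc (double k)) ≡ rowUps r j X
  strip-odd-up {zero}  j (x ∷ [])        up (e , _)  = ≡.trans (strip-up j 0 x up e) (≡.sym (rowUps-∷ j x []))
  strip-odd-up {suc k} j (x ∷ X) up (e , es) = ≡.trans (strip-up j (suc (suc (double k))) x up e)
    (≡.trans (cong ((if x then [] else (r , j) ∷ []) ++_)
      (≡.trans (strip-down (j ℤ.+ + 1) (suc (double k)) (≡.trans (isUp-right r j) (cong not up)))
        (≡.trans (cong (λ i → strip i (suc (double k))) (+1+1 j)) (strip-odd-up (j ℤ.+ + 2) X (isUp-+2 j up) es))))
      (≡.sym (rowUps-∷ j x X)))

  strip-odd-down : ∀ {k} j (X : Subset k) → isUp (r , j) ≡ true → Reads (λ i → nr (r , i)) j X →
    strip (j ℤ.- + 1) (suc (double k)) ≡ rowUps r j X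
  strip-odd-down {k} j X up es = ≡.trans (strip-down (j ℤ.- + 1) (double k) (≡.trans (isUp-left r j) (cong not up)))
    (≡.trans (cong (λ i → strip i (double k)) (i-1+1 j)) (strip-even j X up es))

-- The region V

even-double : ∀ k → (double k ℕ.% 2 ℕ.≡ᵇ 0) ≡ true
even-double zero    = ≡.refl
even-double (suc k) = even-double k

-- The horizontal coordinate of the segment of ℓ with label 1.
start : ℕ → ℤ
start b = + 1 ℤ.- + b

labelMid-⊕ : ∀ b p → labelMid b (suc p) ≡ start b ⊕ p
labelMid-⊕ b p = ≡.trans (cong (λ m → + suc m ℤ.- + 1 ℤ.- + b)
    (≡.trans (cong (λ m → p ℕ.+ m) (cong suc (ℕₚ.+-identityʳ p))) (ℕₚ.+-suc p p)))
  (≡.trans (identity (+ b) (+ (p ℕ.+ p))) (≡.sym (⊕-+ (start b) p)))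
  where
  identity : ∀ b m → + 2 ℤ.+ m ℤ.- + 1 ℤ.- b ≡ + 1 ℤ.- b ℤ.+ m
  identity = solve-∀

⊕-injective : ∀ j {p q} → j ⊕ p ≡ j ⊕ q → p ≡ q
⊕-injective j {p} {q} e = double-injective p q (ℤₚ.+-injective (∙-cancelˡ j _ _
  (≡.trans (≡.sym (⊕-+ j p)) (≡.trans e (⊕-+ j q)))))
  where
  double-injective : ∀ p q → p ℕ.+ p ≡ q ℕ.+ q → p ≡ q
  double-injective p q e = ℕₚ.*-cancelˡ-≡ p q 2
    (≡.trans (cong (p ℕ.+_) (ℕₚ.+-identityʳ p)) (≡.trans e (cong (q ℕ.+_) (≡.sym (ℕₚ.+-identityʳ q)))))

isUp-removedˡ : ∀ b p → isUp (+ b ℤ.- + 1 , start b ⊕ p) ≡ true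
isUp-removedˡ b p = ≡.trans (cong (λ i → ℤ.∣ i ∣ ℕ.% 2 ℕ.≡ᵇ 0)
    (≡.trans (cong (λ i → + b ℤ.- + 1 ℤ.+ i) (⊕-+ (start b) p)) (≡.trans (identity (+ b) (+ (p ℕ.+ p)))
      (cong +_ (≡.sym (double-+ p))))))
  (even-double p)
  where
  identity : ∀ b m → b ℤ.- + 1 ℤ.+ (+ 1 ℤ.- b ℤ.+ m) ≡ m
  identity = solve-∀

isUp-removedʳ : ∀ b p → isUp (+ b , start b ⊕ p) ≡ false
isUp-removedʳ b p = ≡.trans (cong (λ r → isUp (r , start b ⊕ p)) (≡.sym (i-1+1 (+ b))))
  (≡.trans (isUp-down (+ b ℤ.- + 1) (start b ⊕ p)) (cong not (isUp-removedˡ b p)))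

lo : ℕ → ℕ → ℤ
lo b s = + s ℤ.- + (2 ℕ.* b) ℤ.+ + 1

module Region (a b c : ℕ) {n} (X Y : Subset n) where

  removed : List Tri
  removed = map (λ i → (+ b ℤ.- + 1 , labelMid b i)) (labels X) ++ map (λ i → (+ b , labelMid b i)) (labels Y)

  kept : Tri → Bool
  kept t = not (t ∈ᵇ removed)

  G : List Tri
  G = V a b c (labels X) (labels Y)

  upsOf : ℕ → List Tri
  upsOf s = filter isUp (filter kept (hexRow a b c s))

  upsFrom : ℕ → ℕ → List Tri
  upsFrom s zero    = []
  upsFrom s (suc m) = upsOf s ++ upsFrom (suc s) m

  ups-G : filter isUp G ≡ upsFrom 0 (b ℕ.+ c)
  ups-G = ≡.trans (cong (filter isUp) (filter-concatMap kept (hexRow a b c) (upTo (b ℕ.+ c))))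
    (≡.trans (filter-concatMap isUp (filter kept ∘ hexRow a b c) (upTo (b ℕ.+ c))) (from (λ s → s) 0 (λ _ → ≡.refl) (b ℕ.+ c)))
    where
    from : ∀ f s → (∀ i → f i ≡ s ℕ.+ i) → ∀ m → concatMap upsOf (applyUpTo f m) ≡ upsFrom s m
    from f s e zero    = ≡.refl
    from f s e (suc m) = cong₂ _++_ (cong upsOf (≡.trans (e 0) (ℕₚ.+-identityʳ s)))
      (from (f ∘ suc) (suc s) (λ i → ≡.trans (e (suc i)) (ℕₚ.+-suc s i)) m)

  hexRow-upper : ∀ {s} → s ℕ.< b → hexRow a b c s ≡ map (λ j → (+ s , j)) (rangeℤ (ℤ.- + s) (suc (double (s ℕ.+ a))))
  hexRow-upper {s} lt with s ℕ.<ᵇ b | ℕₚ.<⇒<ᵇ lt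
  ... | true | _ = cong (λ m → map (λ j → (+ s , j)) (rangeℤ (ℤ.- + s) m)) (≡.trans (identity a s) (cong suc (≡.sym (double-+ (s ℕ.+ a)))))
    where
    identity : ∀ a s → 2 ℕ.* a ℕ.+ 2 ℕ.* s ℕ.+ 1 ≡ suc ((s ℕ.+ a) ℕ.+ (s ℕ.+ a))
    identity = ℕSolver.solve-∀

  -- The assumed equation ensures that the subtraction in `hexRow` is not truncated.
  hexRow-lower : ∀ {s k} → b ℕ.≤ s → 2 ℕ.* a ℕ.+ 4 ℕ.* b ≡ (2 ℕ.* s ℕ.+ 1) ℕ.+ suc (double k) →
    hexRow a b c s ≡ map (λ j → (+ s , j)) (rangeℤ (lo b s) (suc (double k)))
  hexRow-lower {s} {k} le e with s ℕ.<ᵇ b | ℕₚ.<ᵇ⇒< s b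
  ... | true  | f = ⊥-elim (ℕₚ.<⇒≱ (f Unit.tt) le)
  ... | false | _ = cong (λ m → map (λ j → (+ s , j)) (rangeℤ (lo b s) m))
      (≡.trans (cong (_∸ (2 ℕ.* s ℕ.+ 1)) e) (ℕₚ.m+n∸m≡n (2 ℕ.* s ℕ.+ 1) (suc (double k))))

  hexRow-row : ∀ s {t} → t ∈ hexRow a b c s → proj₁ t ≡ + s
  hexRow-row s t∈ with s ℕ.<ᵇ b
  hexRow-row s t∈ | true with ∈-map⁻ _ t∈
  ... | _ , _ , ≡.refl = ≡.refl
  hexRow-row s t∈ | false with ∈-map⁻ _ t∈
  ... | _ , _ , ≡.refl = ≡.refl

  ∈G⇒ : ∀ {t} → t ∈ G → ∃ λ s → s ℕ.< b ℕ.+ c × t ∈ hexRow a b c s × kept t ≡ true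
  ∈G⇒ t∈ with ∈-filter⇒ kept (hexagon a b c) t∈
  ... | t∈hex , k with find (∈-concatMap⁻ (hexRow a b c) {xs = upTo (b ℕ.+ c)} t∈hex)
  ...   | s , s∈ , t∈row = s , ∈-upTo⁻ s∈ , t∈row , k

  ⇒∈G : ∀ {s t} → s ℕ.< b ℕ.+ c → t ∈ hexRow a b c s → kept t ≡ true → t ∈ G
  ⇒∈G lt t∈ k = ⇒∈-filter kept (∈-concatMap⁺ (hexRow a b c) (lose (∈-upTo⁺ lt) t∈)) k

  ∈G-row⇒ : ∀ {s j} → (+ s , j) ∈ᵇ G ≡ true → s ℕ.< b ℕ.+ c × (+ s , j) ∈ hexRow a b c s
  ∈G-row⇒ {s} e with ∈G⇒ (∈ᵇ⇒∈ G e)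
  ... | s′ , lt , t∈ , _ with ℤₚ.+-injective (hexRow-row s′ t∈)
  ...   | ≡.refl = lt , t∈

  ∈ᵇ-kept : ∀ {s t} → s ℕ.< b ℕ.+ c → t ∈ hexRow a b c s → t ∈ᵇ G ≡ kept t
  ∈ᵇ-kept {s} {t} lt t∈ with kept t in eq
  ... | true  = ∈⇒∈ᵇ (⇒∈G lt t∈ eq)
  ... | false = ∉⇒∈ᵇ G (λ t∈G → Boolₚ.not-¬ {true} ≡.refl (≡.trans (≡.sym (proj₂ (proj₂ (proj₂ (∈G⇒ t∈G))))) eq))

  nonnegative : ∀ {s j} → (s , j) ∈ᵇ G ≡ true → ¬ s ℤ.< + 0
  nonnegative e lt with ∈G⇒ (∈ᵇ⇒∈ G e)
  ... | s′ , _ , t∈ , _ rewrite hexRow-row s′ t∈ = ℤₚ.<⇒≱ lt (ℤ.+≤+ ℕ.z≤n)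

  outside : ∀ {s} j → b ℕ.+ c ℕ.≤ s → (+ s , j) ∈ᵇ G ≡ false
  outside {s} j le = ∉⇒∈ᵇ G (λ t∈ → ℕₚ.<⇒≱ (proj₁ (∈G-row⇒ (∈⇒∈ᵇ t∈))) le)

  removed⇒ : ∀ {r j} → (r , j) ∈ removed →
    (r ≡ + b ℤ.- + 1 × ∃ λ (p : Fin n) → j ≡ start b ⊕ toℕ p × lookup X p ≡ true)
    ⊎ (r ≡ + b × ∃ λ (p : Fin n) → j ≡ start b ⊕ toℕ p × lookup Y p ≡ true)
  removed⇒ t∈ with ∈-++⁻ (map (λ i → (+ b ℤ.- + 1 , labelMid b i)) (labels X)) t∈
  ... | inj₁ t∈X with ∈-map⁻ _ t∈X
  ...   | i , i∈ , ≡.refl with ∈-labels X i∈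
  ...     | p , ≡.refl , l = inj₁ (≡.refl , p , labelMid-⊕ b (toℕ p) , l)
  removed⇒ t∈ | inj₂ t∈Y with ∈-map⁻ _ t∈Y
  ...   | i , i∈ , ≡.refl with ∈-labels Y i∈
  ...     | p , ≡.refl , l = inj₂ (≡.refl , p , labelMid-⊕ b (toℕ p) , l)

  kept-intro : ∀ {t} → t ∉ removed → kept t ≡ true
  kept-intro t∉ = cong not (∉⇒∈ᵇ removed t∉)

  kept-other : ∀ {s} j → suc s ≢ b → s ≢ b → kept (+ s , j) ≡ true
  kept-other {s} j ne ne′ = kept-intro λ t∈ → case (removed⇒ t∈)
    where
    case : _ → _
    case (inj₁ (e , _)) = ne (ℤₚ.+-injective (≡.trans (cong +_ (ℕₚ.+-comm 1 s)) (≡.trans (cong (ℤ._+ + 1) e) (i-1+1 (+ b)))))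
    case (inj₂ (e , _)) = ne′ (ℤₚ.+-injective e)

  kept-down : ∀ {s} j → s ≢ b → isUp (+ s , j) ≡ false → kept (+ s , j) ≡ true
  kept-down {s} j ne dn = kept-intro λ t∈ → case (removed⇒ t∈)
    where
    case : _ → _
    case (inj₁ (e , p , ≡.refl , _)) with ≡.trans (≡.sym dn) (≡.trans (cong (λ r → isUp (r , start b ⊕ toℕ p)) e) (isUp-removedˡ b (toℕ p)))
    ... | ()
    case (inj₂ (e , _)) = ne (ℤₚ.+-injective e)

  kept-up : ∀ {s} j → suc s ≢ b → isUp (+ s , j) ≡ true → kept (+ s , j) ≡ true
  kept-up {s} j ne up = kept-intro λ t∈ → case (removed⇒ t∈)
    where
    case : _ → _
    case (inj₁ (e , _)) = ne (ℤₚ.+-injective (≡.trans (cong +_ (ℕₚ.+-comm 1 s)) (≡.trans (cong (ℤ._+ + 1) e) (i-1+1 (+ b)))))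
    case (inj₂ (e , p , ≡.refl , _)) with ≡.trans (≡.sym up) (≡.trans (cong (λ r → isUp (r , start b ⊕ toℕ p)) e) (isUp-removedʳ b (toℕ p)))
    ... | ()

  pred≢ : + b ℤ.- + 1 ≢ + b
  pred≢ e = ℤₚ.<-irrefl e (i-1<i (+ b))

  kept-X : ∀ p → kept (+ b ℤ.- + 1 , start b ⊕ toℕ p) ≡ not (lookup X p)
  kept-X p with lookup X p in eq
  ... | true  = cong not (∈⇒∈ᵇ (∈-++⁺ˡ (subst (λ j → (+ b ℤ.- + 1 , j) ∈ _) (labelMid-⊕ b (toℕ p))
                  (∈-map⁺ (λ i → (+ b ℤ.- + 1 , labelMid b i)) (labels-∈ X p eq)))))
  ... | false = kept-intro λ t∈ → case (removed⇒ t∈)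
    where
    case : _ → _
    case (inj₁ (_ , p′ , e , l)) with Finₚ.toℕ-injective {i = p} {p′} (⊕-injective (start b) e)
    ... | ≡.refl with ≡.trans (≡.sym l) eq
    ...   | ()
    case (inj₂ (e , _)) = pred≢ e

  kept-Y : ∀ p → kept (+ b , start b ⊕ toℕ p) ≡ not (lookup Y p)
  kept-Y p with lookup Y p in eq
  ... | true  = cong not (∈⇒∈ᵇ (∈-++⁺ʳ (map (λ i → (+ b ℤ.- + 1 , labelMid b i)) (labels X))
                  (subst (λ j → (+ b , j) ∈ _) (labelMid-⊕ b (toℕ p)) (∈-map⁺ (λ i → (+ b , labelMid b i)) (labels-∈ Y p eq)))))
  ... | false = kept-intro λ t∈ → case (removed⇒ t∈)
    where
    case : _ → _
    case (inj₁ (e , _)) = pred≢ (≡.sym e)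
    case (inj₂ (_ , p′ , e , l)) with Finₚ.toℕ-injective {i = p} {p′} (⊕-injective (start b) e)
    ... | ≡.refl with ≡.trans (≡.sym l) eq
    ...   | ()

  ∈-range : ∀ {r : ℤ} {lo len j} m → m ℕ.< len → j ≡ lo ℤ.+ + m → (r , j) ∈ map (λ i → (r , i)) (rangeℤ lo len)
  ∈-range {r} {lo} m lt ≡.refl = ∈-map⁺ (λ i → (r , i)) (∈-map⁺ (λ k → lo ℤ.+ + k) (∈-upTo⁺ lt))

  range-∈ : ∀ {r : ℤ} {lo len j} → (r , j) ∈ map (λ i → (r , i)) (rangeℤ lo len) → ∃ λ m → m ℕ.< len × j ≡ lo ℤ.+ + m
  range-∈ t∈ with ∈-map⁻ _ t∈
  ... | i , i∈ , ≡.refl with ∈-map⁻ _ i∈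
  ...   | m , m∈ , ≡.refl = m , ∈-upTo⁻ m∈ , ≡.refl

  Row : ℕ → ℤ → ℕ → Set
  Row s l k = hexRow a b c s ≡ map (λ j → (+ s , j)) (rangeℤ l (suc (double k)))

  module _ {s l k} (row : Row s l k) (inside : s ℕ.< b ℕ.+ c) where

    row-∈ : ∀ {j} m → m ℕ.≤ double k → j ≡ l ℤ.+ + m → (+ s , j) ∈ᵇ G ≡ kept (+ s , j)
    row-∈ m le e = ∈ᵇ-kept inside (subst (_ ∈_) (≡.sym row) (∈-range {lo = l} m (ℕ.s≤s le) e))

    row-∈⊕ : ∀ p → p ℕ.≤ k → (+ s , l ⊕ p) ∈ᵇ G ≡ kept (+ s , l ⊕ p)
    row-∈⊕ p le = row-∈ (p ℕ.+ p) (subst (p ℕ.+ p ℕ.≤_) (≡.sym (double-+ k)) (ℕₚ.+-mono-≤ le le)) (⊕-+ l p)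

    row-bounds : ∀ {j} → (+ s , j) ∈ᵇ G ≡ true → l ℤ.≤ j × j ℤ.< l ℤ.+ + 1 ⊕ k
    row-bounds e with range-∈ {lo = l} {suc (double k)} (subst (_ ∈_) row (proj₂ (∈G-row⇒ e)))
    ... | m , lt , ≡.refl = subst (ℤ._≤ l ℤ.+ + m) (ℤₚ.+-identityʳ l) (ℤₚ.+-monoʳ-≤ l (ℤ.+≤+ ℕ.z≤n)) ,
      subst (l ℤ.+ + m ℤ.<_) (≡.trans (≡.sym (ℤₚ.+-assoc l (+ 1) _)) (≡.sym (≡.trans (⊕-+ (l ℤ.+ + 1) k)
        (cong (λ m → l ℤ.+ + 1 ℤ.+ + m) (≡.sym (double-+ k)))))) (ℤₚ.+-monoʳ-< l (ℤ.+<+ lt))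

    row-below : ∀ {j} → j ℤ.< l → (+ s , j) ∈ᵇ G ≡ false
    row-below {j} lt with (+ s , j) ∈ᵇ G in e
    ... | false = ≡.refl
    ... | true  = ⊥-elim (ℤₚ.<⇒≱ lt (proj₁ (row-bounds e)))

    row-end : (+ s , l ℤ.+ + 1 ⊕ k) ∈ᵇ G ≡ false
    row-end with (+ s , l ℤ.+ + 1 ⊕ k) ∈ᵇ G in e
    ... | false = ≡.refl
    ... | true  = ⊥-elim (ℤₚ.<-irrefl ≡.refl (proj₂ (row-bounds e)))

  upsOf-row : ∀ s → All (λ t → proj₁ t ≡ + s) (upsOf s)
  upsOf-row s = All-filter isUp (All-filter kept (All.tabulate (hexRow-row s)))

  upsFrom-row : ∀ {r} s m → r ℤ.< + s → All (λ t → r ℤ.< proj₁ t) (upsFrom s m)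
  upsFrom-row s zero    lt = []
  upsFrom-row s (suc m) lt = Allₚ.++⁺ (All.map (λ e → subst (_ ℤ.<_) (≡.sym e) lt) (upsOf-row s))
    (upsFrom-row (suc s) m (ℤₚ.<-trans lt (ℤ.+<+ ℕₚ.≤-refl)))

  strip-distinct : ∀ s l m → AllPairs _≢_ (map (λ j → (+ s , j)) (rangeℤ l m))
  strip-distinct s l m = Uniqueₚ.map⁺ (cong proj₂) (Uniqueₚ.map⁺ (λ e → ℤₚ.+-injective (∙-cancelˡ l _ _ e)) (Uniqueₚ.upTo⁺ m))

  hexRow-distinct : ∀ s → AllPairs _≢_ (hexRow a b c s)
  hexRow-distinct s with s ℕ.<ᵇ b
  ... | true  = strip-distinct s (ℤ.- + s) (2 ℕ.* a ℕ.+ 2 ℕ.* s ℕ.+ 1)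
  ... | false = strip-distinct s (lo b s) ((2 ℕ.* a ℕ.+ 4 ℕ.* b) ∸ (2 ℕ.* s ℕ.+ 1))

  upsFrom-distinct : ∀ s m → AllPairs _≢_ (upsFrom s m)
  upsFrom-distinct s zero    = []
  upsFrom-distinct s (suc m) = AllPairsₚ.++⁺ (AllPairs-filter isUp (AllPairs-filter kept (hexRow-distinct s)))
    (upsFrom-distinct (suc s) m)
    (All.map (λ e → All.map (λ lt → ℤₚ.<⇒≢ lt ∘ ≡.trans (≡.sym e) ∘ cong proj₁) (upsFrom-row (suc s) m (ℤ.+<+ ℕₚ.≤-refl))) (upsOf-row s))

isUp-⊕ : ∀ r j p → isUp (r , j ⊕ p) ≡ isUp (r , j)
isUp-⊕ r j zero    = ≡.refl
isUp-⊕ r j (suc p) = ≡.trans (isUp-⊕ r (j ℤ.+ + 2) p)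
  (≡.trans (cong (λ i → isUp (r , i)) (≡.sym (ℤₚ.+-assoc j (+ 1) (+ 1))))
    (≡.trans (isUp-right r (j ℤ.+ + 1)) (≡.trans (cong not (isUp-right r j)) (Boolₚ.not-involutive _))))

isUp-antidiagonal : ∀ s → isUp (+ s , ℤ.- + s) ≡ true
isUp-antidiagonal s = cong (λ i → ℤ.∣ i ∣ ℕ.% 2 ℕ.≡ᵇ 0) (ℤₚ.+-inverseʳ (+ s))

+-double : ∀ b → + (2 ℕ.* b) ≡ + b ℤ.+ + b
+-double b = cong (λ m → + (b ℕ.+ m)) (ℕₚ.+-identityʳ b)

lo-suc : ∀ b s → lo b (suc s) ≡ lo b s ℤ.+ + 1
lo-suc b s = identity (+ s) (+ (2 ℕ.* b))
  where
  identity : ∀ s t → + 1 ℤ.+ s ℤ.- t ℤ.+ + 1 ≡ s ℤ.- t ℤ.+ + 1 ℤ.+ + 1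
  identity = solve-∀

start-lo : ∀ b → start b ≡ lo b b
start-lo b = ≡.trans (identity (+ b)) (cong (λ t → + b ℤ.- t ℤ.+ + 1) (≡.sym (+-double b)))
  where
  identity : ∀ b → + 1 ℤ.- b ≡ b ℤ.- (b ℤ.+ b) ℤ.+ + 1
  identity = solve-∀

start-suc : ∀ s → start (suc s) ≡ ℤ.- + s
start-suc s = identity (+ s)
  where
  identity : ∀ s → + 1 ℤ.- (+ 1 ℤ.+ s) ≡ ℤ.- s
  identity = solve-∀

suc-1 : ∀ s → + suc s ℤ.- + 1 ≡ + s
suc-1 s = identity (+ s)
  where
  identity : ∀ s → + 1 ℤ.+ s ℤ.- + 1 ≡ s
  identity = solve-∀

+1-1 : ∀ j → j ℤ.+ + 1 ℤ.- + 1 ≡ j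
+1-1 j = ≡.trans (ℤₚ.+-assoc j (+ 1) -[1+ 0 ]) (ℤₚ.+-identityʳ j)

neg-suc : ∀ s → ℤ.- + suc s ≡ ℤ.- + s ℤ.- + 1
neg-suc s = identity (+ s)
  where
  identity : ∀ s → ℤ.- (+ 1 ℤ.+ s) ≡ ℤ.- s ℤ.- + 1
  identity = solve-∀

isUp-lo : ∀ {b s} → b ℕ.≤ s → isUp (+ s , lo b s ℤ.+ + 1) ≡ true
isUp-lo {b} {s} le = ≡.trans (cong (λ i → ℤ.∣ i ∣ ℕ.% 2 ℕ.≡ᵇ 0) even) (even-double (suc (s ∸ b)))
  where
  identity : ∀ b d → (b ℤ.+ d) ℤ.+ (b ℤ.+ d ℤ.- (b ℤ.+ b) ℤ.+ + 1 ℤ.+ + 1) ≡ + 2 ℤ.+ (d ℤ.+ d)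
  identity = solve-∀
  even : + s ℤ.+ (lo b s ℤ.+ + 1) ≡ + double (suc (s ∸ b))
  even = ≡.trans (cong₂ (λ x t → + x ℤ.+ (+ x ℤ.- t ℤ.+ + 1 ℤ.+ + 1)) (≡.sym (ℕₚ.m+[n∸m]≡n le)) (+-double b))
    (≡.trans (identity (+ b) (+ (s ∸ b))) (cong (λ m → + suc (suc m)) (≡.sym (double-+ (s ∸ b)))))

foldr-min : ℤ → List Tri → ℤ
foldr-min = Data.List.foldr (λ t m → proj₁ t ℤ.⊓ m)

topLine-0 : ∀ G → All (λ t → + 0 ℤ.≤ proj₁ t) G → ∀ {j} → (+ 0 , j) ∈ᵇ G ≡ true → topLine G ≡ + 0
topLine-0 (t ∷ G) (le ∷ les) {j} t∈ = ℤₚ.≤-antisym (below (∈ᵇ⇒∈ (t ∷ G) t∈)) (above le les)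
  where
  open import Data.List.Membership.Propositional using (_∈_)
  open import Data.List.Relation.Unary.Any using (here; there)
  above : ∀ {r G} → + 0 ℤ.≤ r → All (λ t → + 0 ℤ.≤ proj₁ t) G → + 0 ℤ.≤ foldr-min r G
  above le []         = le
  above le (le′ ∷ ls) = ℤₚ.⊓-glb le′ (above le ls)
  base : ∀ r G → foldr-min r G ℤ.≤ r
  base r []      = ℤₚ.≤-refl
  base r (u ∷ G) = ℤₚ.≤-trans (ℤₚ.i⊓j≤j (proj₁ u) _) (base r G)
  member : ∀ r {u} {G} → u ∈ G → foldr-min r G ℤ.≤ proj₁ u
  member r {G = v ∷ _} (here ≡.refl) = ℤₚ.i⊓j≤i (proj₁ v) _
  member r {G = v ∷ _} (there u∈)    = ℤₚ.≤-trans (ℤₚ.i⊓j≤j (proj₁ v) _) (member r u∈)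
  below : (+ 0 , j) ∈ t ∷ G → foldr-min (proj₁ t) G ℤ.≤ + 0
  below (here ≡.refl) = base (+ 0) G
  below (there u∈)    = member (proj₁ t) u∈

module Rows (a b c : ℕ) {n} (X Y : Subset n) where
  open Region a b c X Y public

  upperRow : ∀ {s} → s ℕ.< b → Row s (ℤ.- + s) (s ℕ.+ a)
  upperRow = hexRow-upper

  -- Here k is the number of strips below strip s, and z = a + b - c is the length of the bottom
  -- side. A strip shortens by two triangles at each step downwards.
  lowerRow : ∀ {s k z} → c ℕ.+ z ≡ b ℕ.+ a → b ℕ.≤ s → s ℕ.+ suc k ≡ b ℕ.+ c → Row s (lo b s) (k ℕ.+ z)
  lowerRow {s} {k} {z} ez le e = hexRow-lower le (≡.sym (≡.trans
    (cong (λ t → 2 ℕ.* s ℕ.+ 1 ℕ.+ suc t) (double-+ (k ℕ.+ z)))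
    (≡.trans (i₁ s k z) (≡.trans (cong (λ t → 2 ℕ.* t ℕ.+ 2 ℕ.* z) e)
      (≡.trans (i₂ b c z) (≡.trans (cong (λ t → 2 ℕ.* b ℕ.+ 2 ℕ.* t) ez) (i₃ a b)))))))
    where
    i₁ : ∀ s k z → 2 ℕ.* s ℕ.+ 1 ℕ.+ suc ((k ℕ.+ z) ℕ.+ (k ℕ.+ z)) ≡ 2 ℕ.* (s ℕ.+ suc k) ℕ.+ 2 ℕ.* z
    i₁ = ℕSolver.solve-∀
    i₂ : ∀ b c z → 2 ℕ.* (b ℕ.+ c) ℕ.+ 2 ℕ.* z ≡ 2 ℕ.* b ℕ.+ 2 ℕ.* (c ℕ.+ z)
    i₂ = ℕSolver.solve-∀
    i₃ : ∀ a b → 2 ℕ.* b ℕ.+ 2 ℕ.* (b ℕ.+ a) ≡ 2 ℕ.* a ℕ.+ 4 ℕ.* b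
    i₃ = ℕSolver.solve-∀

  module Upper {s} (lt : s ℕ.< b) where
    row : Row s (ℤ.- + s) (s ℕ.+ a)
    row = upperRow lt
    inRegion : s ℕ.< b ℕ.+ c
    inRegion = ℕₚ.≤-trans lt (ℕₚ.m≤m+n b c)

    ups : ∀ (Xs : Subset (suc (s ℕ.+ a))) → Reads (λ i → kept (+ s , i)) (ℤ.- + s) Xs → upsOf s ≡ rowUps (+ s) (ℤ.- + s) Xs
    ups Xs reads = ≡.trans (cong (λ l → filter isUp (filter kept l)) row)
      (strip-odd-up kept (+ s) (ℤ.- + s) Xs (isUp-antidiagonal s) reads)

    reads-kept : suc s ≢ b → Reads (λ i → kept (+ s , i)) (ℤ.- + s) (⊥ {suc (s ℕ.+ a)})
    reads-kept ne = Reads-intro _ _ ⊥ λ p → ≡.trans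
      (kept-up _ ne (≡.trans (isUp-⊕ (+ s) (ℤ.- + s) (toℕ p)) (isUp-antidiagonal s))) (cong not (≡.sym (lookup-⊥ p)))

    reads-G : ∀ (Xs : Subset (suc (s ℕ.+ a))) → Reads (λ i → kept (+ s , i)) (ℤ.- + s) Xs →
      Reads (λ i → (+ s , i) ∈ᵇ G) (ℤ.- + s) Xs
    reads-G Xs reads = Reads-intro _ _ Xs λ p → ≡.trans (row-∈⊕ row inRegion (toℕ p) (ℕ.s≤s⁻¹ (Finₚ.toℕ<n p)))
      (Reads-elim _ Xs reads p)

  upper-next : ∀ {s} → suc s ℕ.< b → Reads (λ i → (+ suc s , i) ∈ᵇ G) (ℤ.- + s) (⊥ {suc (s ℕ.+ a)})
  upper-next {s} lt = Reads-intro _ _ ⊥ λ p → ≡.trans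
    (row-∈ {l = ℤ.- + suc s} (Upper.row lt) (Upper.inRegion lt) (suc (toℕ p ℕ.+ toℕ p))
      (ℕₚ.≤-trans (ℕ.s≤s (ℕₚ.+-mono-≤ (ℕ.s≤s⁻¹ (Finₚ.toℕ<n p)) (ℕ.s≤s⁻¹ (Finₚ.toℕ<n p))))
        (ℕₚ.≤-trans (ℕₚ.≤-reflexive (cong suc (≡.sym (double-+ (s ℕ.+ a))))) (ℕₚ.n≤1+n _)))
      (≡.trans (⊕-+ (ℤ.- + s) (toℕ p)) (identity (+ s) (+ (toℕ p ℕ.+ toℕ p)))))
    (≡.trans (kept-down _ (ℕₚ.<⇒≢ lt) (≡.trans (isUp-⊕ (+ suc s) (ℤ.- + s) (toℕ p))
        (≡.trans (cong (λ r → isUp (r , ℤ.- + s)) (cong +_ (ℕₚ.+-comm 1 s)))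
          (≡.trans (isUp-down (+ s) (ℤ.- + s)) (cong not (isUp-antidiagonal s))))))
      (cong not (≡.sym (lookup-⊥ p))))
    where
    identity : ∀ s m → ℤ.- s ℤ.+ m ≡ ℤ.- (+ 1 ℤ.+ s) ℤ.+ (+ 1 ℤ.+ m)
    identity = solve-∀

  module Lower {s k z} (ez : c ℕ.+ z ≡ b ℕ.+ a) (le : b ℕ.≤ s) (e : s ℕ.+ suc k ≡ b ℕ.+ c) where
    row : Row s (lo b s) (k ℕ.+ z)
    row = lowerRow ez le e
    inRegion : s ℕ.< b ℕ.+ c
    inRegion = subst (s ℕ.<_) e (ℕₚ.m<m+n s (ℕ.s≤s ℕ.z≤n))

    reads-kept : Reads (λ i → kept (+ s , i)) (lo b s ℤ.+ + 1) (⊥ {k ℕ.+ z})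
    reads-kept = Reads-intro _ _ ⊥ λ p → ≡.trans
      (kept-up _ (ℕₚ.<⇒≢ (ℕ.s≤s le) ∘ ≡.sym) (≡.trans (isUp-⊕ (+ s) (lo b s ℤ.+ + 1) (toℕ p)) (isUp-lo le)))
      (cong not (≡.sym (lookup-⊥ p)))

    ups : upsOf s ≡ rowUps (+ s) (lo b s ℤ.+ + 1) (⊥ {k ℕ.+ z})
    ups = ≡.trans (cong (λ l → filter isUp (filter kept l)) row)
      (≡.trans (cong (λ j → filter isUp (filter kept (map (λ i → (+ s , i)) (rangeℤ j (suc (double (k ℕ.+ z))))))) (≡.sym (+1-1 (lo b s))))
        (strip-odd-down kept (+ s) (lo b s ℤ.+ + 1) ⊥ (isUp-lo le) reads-kept))

    reads-G : Reads (λ i → (+ s , i) ∈ᵇ G) (lo b s ℤ.+ + 1) (⊥ {k ℕ.+ z})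
    reads-G = Reads-intro _ _ ⊥ λ p → ≡.trans
      (row-∈ {l = lo b s} row inRegion (suc (toℕ p ℕ.+ toℕ p))
        (ℕₚ.≤-trans (ℕₚ.n≤1+n _) (ℕₚ.≤-trans (ℕₚ.≤-reflexive (cong suc (≡.sym (ℕₚ.+-suc (toℕ p) (toℕ p)))))
          (ℕₚ.≤-trans (ℕₚ.+-mono-≤ (Finₚ.toℕ<n p) (Finₚ.toℕ<n p)) (ℕₚ.≤-reflexive (≡.sym (double-+ (k ℕ.+ z)))))))
        (≡.trans (⊕-+ (lo b s ℤ.+ + 1) (toℕ p)) (ℤₚ.+-assoc (lo b s) (+ 1) _)))
      (Reads-elim _ ⊥ reads-kept p)

    reads-first : suc s ≢ b → s ≢ b → Reads (λ i → (+ s , i) ∈ᵇ G) (lo b s) (⊥ {suc (k ℕ.+ z)})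
    reads-first ne ne′ = Reads-intro _ _ ⊥ λ p → ≡.trans (row-∈⊕ row inRegion (toℕ p) (ℕ.s≤s⁻¹ (Finₚ.toℕ<n p)))
      (≡.trans (kept-other _ ne ne′) (cong not (≡.sym (lookup-⊥ p))))

-- From tilings of V to the recursion of the lower half

module Assembly {ℓ₁ ℓ₂} (R : CommutativeRing ℓ₁ ℓ₂) (q : CommutativeRing.Carrier R)
  (a b c : ℕ) {n} (X Y : Subset n) where
  open CommutativeRing R hiding (zero)
  open import Relation.Binary.Reasoning.Setoid setoid
  open Summands R q
  open Transfer R
  open Rows a b c X Y

  w₀ : Lozenge → Carrier
  w₀ (right , (r , j)) = pow q ℤ.∣ r ℤ.+ + 1 ∣
  w₀ (vert  , _)       = 1#
  w₀ (left  , _)       = 1#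

  open Strips R w₀ G (λ _ → refl) (λ _ → refl)

  -- The invariant when strip s is about to be swept: the strips above are covered and those below
  -- are untouched, while strip s itself may already be hit by vertical lozenges.
  State : ℕ → Demand → ℤ → Set
  State s δ v = Sub δ × Done δ (+ s) v × (∀ s′ i → + s ℤ.< s′ → δ (s′ , i) ≡ (s′ , i) ∈ᵇ G)

  next≡ : ∀ s → + s ℤ.+ + 1 ≡ + suc s
  next≡ s = cong +_ (ℕₚ.+-comm s 1)

  -- `row` in terms of the invariant: u is the position of the first up-pointing triangle of strip
  -- s, and strip s + 1 has no triangle of the region to the left of v′.
  row-step : ∀ s m u {k} (Xs Ys D : Subset k) (Φ : Form k) p v′ δ →
    upsOf s ≡ rowUps (+ s) u Xs → Reads (λ i → (+ s , i) ∈ᵇ G) u Xs →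
    State s δ (u ℤ.- + 1) → δ (+ s , u ℤ.- + 1) ≡ p → Reads (λ i → δ (+ s , i)) (u ℤ.+ + 1) D →
    Reads (λ i → (+ suc s , i) ∈ᵇ G) u Ys →
    (∀ {i} → (+ s , i) ∈ᵇ G ≡ true → i ℤ.< u ⊕ k) → (∀ {i} → i ℤ.< v′ → (+ suc s , i) ∈ᵇ G ≡ false) →
    (∀ out δ′ → State (suc s) δ′ v′ → Reads (λ i → δ′ (+ suc s , i)) u out → sweep (upsFrom (suc s) m) δ′ ≈ Φ out) →
    sweep (upsFrom s (suc m)) δ ≈ run (pow q (suc s)) p D (glue Xs Ys Φ)
  row-step s m u {k} Xs Ys D Φ p v′ δ ups readsX (sub , done , far) pend readsD readsY bound below cont = trans
    (reflexive (cong (λ l → sweep (l ++ upsFrom (suc s) m) δ) ups))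
    (row (pow q (suc s)) (+ s) (λ _ → pow-≡ (ℕₚ.+-comm s 1)) (upsFrom (suc s) m) (upsFrom-row (suc s) m (ℤ.+<+ ℕₚ.≤-refl))
      Xs Ys D Φ p u δ sub done pend readsD
      (Reads-cong u Ys (λ i _ → ≡.trans (cong (λ t → (t , i) ∈ᵇ G) (≡.sym (next≡ s))) (≡.sym (far _ i (i<i+1 (+ s))))) readsY)
      readsX
      (λ out δ′ sub′ done′ reads′ _ far′ → cont out δ′
        (sub′ , done″ done′ , λ s′ i lt → ≡.trans (far′ s′ i (subst (ℤ._< s′) (≡.sym (next≡ s)) lt))
                                               (far s′ i (ℤₚ.<-trans (ℤ.+<+ ℕₚ.≤-refl) lt)))
        (subst (λ t → Reads (λ i → δ′ (t , i)) u out) (next≡ s) reads′)))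
    where
    done″ : ∀ {δ′} → Done δ′ (+ s) (u ⊕ k) → Done δ′ (+ suc s) v′
    done″ done′ r i ∈G (inj₂ (≡.refl , lt)) with ≡.trans (≡.sym ∈G) (below lt)
    ... | ()
    done″ done′ r i ∈G (inj₁ lt) with <-split {r} {+ s} (subst (r ℤ.<_) (≡.sym (next≡ s)) lt)
    ... | inj₁ ≡.refl = done′ r i ∈G (inj₂ (≡.refl , bound ∈G))
    ... | inj₂ lt′    = done′ r i ∈G (inj₁ lt′)

  State-end : ∀ {δ s v} → State s δ v → s ≡ b ℕ.+ c → sweep [] δ ≈ 1#
  State-end (_ , done , _) ≡.refl = sweep-done _ λ t ∈G → end t ∈G
    where
    end : ∀ t → t ∈ᵇ G ≡ true → _
    end (r , j) ∈G with ∈G⇒ (∈ᵇ⇒∈ G ∈G)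
    ... | s , lt , t∈ , _ = done r j ∈G (inj₁ (subst (ℤ._< _) (≡.sym (hexRow-row s t∈)) (ℤ.+<+ lt)))

  outside-reads : ∀ {k} s u → s ≡ b ℕ.+ c → Reads (λ i → (+ s , i) ∈ᵇ G) u (⊤ {k})
  outside-reads s u e = Reads-intro _ u ⊤ λ p → ≡.trans (outside _ (ℕₚ.≤-reflexive (≡.sym e))) (cong not (≡.sym (lookup-⊤ p)))

  lower-step : ∀ {z} k s → (ez : c ℕ.+ z ≡ b ℕ.+ a) → b ℕ.≤ s → s ℕ.+ suc k ≡ b ℕ.+ c →
    ∀ (D : Subset (suc k ℕ.+ z)) (Ys : Subset (k ℕ.+ z)) (Φ : Form (k ℕ.+ z)) δ →
    State s δ (lo b s) → Reads (λ i → δ (+ s , i)) (lo b s) D →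
    Reads (λ i → (+ suc s , i) ∈ᵇ G) (lo b s ℤ.+ + 1) Ys →
    (∀ {i} → i ℤ.< lo b (suc s) → (+ suc s , i) ∈ᵇ G ≡ false) →
    (∀ out δ′ → State (suc s) δ′ (lo b (suc s)) → Reads (λ i → δ′ (+ suc s , i)) (lo b s ℤ.+ + 1) out →
      sweep (upsFrom (suc s) k) δ′ ≈ Φ out) →
    (∀ U → glue ⊥ Ys Φ U ≈ lowerForm z (suc (suc s)) k U) →
    sweep (upsFrom s (suc k)) δ ≈ lowerForm z (suc s) (suc k) D
  lower-step {z} k s ez le e (d ∷ D) Ys Φ δ state (read , reads) readsY below cont form = begin
    sweep (upsFrom s (suc k)) δ
      ≈⟨ row-step s k (lo b s ℤ.+ + 1) ⊥ Ys D Φ (not d) (lo b (suc s)) δ ups reads-G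
           (subst (State s δ) (≡.sym (+1-1 (lo b s))) state)
           (≡.trans (cong (λ i → δ (+ s , i)) (+1-1 (lo b s))) read)
           (subst (λ i → Reads (λ i → δ (+ s , i)) i D) (≡.sym (ℤₚ.+-assoc (lo b s) (+ 1) (+ 1))) reads)
           readsY (proj₂ ∘ row-bounds {l = lo b s} row₀ inRegion) below cont ⟩
    run (pow q (suc s)) (not d) D (glue ⊥ Ys Φ) ≈⟨ run-cong (pow q (suc s)) (not d) D form ⟩
    run (pow q (suc s)) (not d) D (lowerForm z (suc (suc s)) k) ≈⟨ sym (fresh-run (pow q (suc s)) d D _) ⟩
    lowerForm z (suc s) (suc k) (d ∷ D) ∎
    where
    open Lower {s} {k} {z} ez le e renaming (row to row₀)

  lower-sweep : ∀ {z} → c ℕ.+ z ≡ b ℕ.+ a → ∀ k s → b ℕ.≤ s → s ℕ.+ suc k ≡ b ℕ.+ c → ∀ {n′} (e′ : suc k ℕ.+ z ≡ n′) (D : Subset n′) δ →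
    State s δ (lo b s) → Reads (λ i → δ (+ s , i)) (lo b s) D →
    sweep (upsFrom s (suc k)) δ ≈ subst Form e′ (lowerForm z (suc s) (suc k)) D
  -- Under the last strip nothing is left to cover, so the continuation is constantly 1; `glue-⊤`
  -- turns this into `𝟙∅`.
  lower-sweep ez zero s le e ≡.refl D δ state reads = lower-step zero s ez le e D ⊤ (λ _ → 1#) δ state reads
    (outside-reads (suc s) _ end) (λ {i} _ → outside i (ℕₚ.≤-reflexive (≡.sym end)))
    (λ _ _ state′ _ → State-end state′ end) (λ U → trans (glue-⊤ ⊥ U) (glue-⊥ 𝟙∅ U))
    where
    end : suc s ≡ b ℕ.+ c
    end = ≡.trans (cong suc (≡.sym (ℕₚ.+-identityʳ s))) (≡.trans (≡.sym (ℕₚ.+-suc s 0)) e)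
  lower-sweep {z} ez (suc k) s le e ≡.refl D δ state reads = lower-step (suc k) s ez le e D ⊥ (lowerForm z (suc (suc s)) (suc k)) δ state reads
    (subst (λ i → Reads (λ i → (+ suc s , i) ∈ᵇ G) i (⊥ {suc (k ℕ.+ z)})) (lo-suc b s)
      (Next.reads-first (ℕₚ.<⇒≢ (ℕ.s≤s (ℕₚ.m≤n⇒m≤1+n le)) ∘ ≡.sym) (ℕₚ.<⇒≢ (ℕ.s≤s le) ∘ ≡.sym)))
    (row-below {l = lo b (suc s)} Next.row Next.inRegion)
    (λ out δ′ state′ reads′ → lower-sweep ez k (suc s) (ℕₚ.m≤n⇒m≤1+n le) e₊ ≡.refl out δ′ state′
      (subst (λ i → Reads (λ i → δ′ (+ suc s , i)) i out) (≡.sym (lo-suc b s)) reads′))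
    (glue-⊥ _)
    where
    e₊ : suc s ℕ.+ suc k ≡ b ℕ.+ c
    e₊ = ≡.trans (≡.sym (ℕₚ.+-suc s (suc k))) e
    module Next = Lower {suc s} {k} {z} ez (ℕₚ.m≤n⇒m≤1+n le) e₊

  δ₀ : Demand
  δ₀ t = t ∈ᵇ G

  δ₀-state : ∀ v → (∀ {i} → i ℤ.< v → (+ 0 , i) ∈ᵇ G ≡ false) → State 0 δ₀ v
  δ₀-state v below = (λ _ e → e) , done , (λ _ _ _ → ≡.refl)
    where
    done : Done δ₀ (+ 0) v
    done r i ∈G (inj₁ lt) = ⊥-elim (nonnegative ∈G lt)
    done r i ∈G (inj₂ (≡.refl , lt)) = below lt

  M-sweep : (∃ λ j → (+ 0 , j) ∈ᵇ G ≡ true) ⊎ upsFrom 0 (b ℕ.+ c) ≡ [] →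
    M q G ≈ sweep (upsFrom 0 (b ℕ.+ c)) δ₀
  M-sweep top = begin
    M q G ≈⟨ weights top ⟩
    covering (lozengesIn G) (λ _ → true)
      ≡⟨ cong (λ Ls → covering (inside Ls) (λ _ → true)) (≡.trans (candidates-ups isUp candidates G) (cong (concatMap candidates) ups-G)) ⟩
    covering (inside (concatMap candidates us)) (λ _ → true)
      -- The two demands agree on `G`, but only `δ₀` is confined to `G`, as `Sub` requires.
      ≡⟨ cong (sumR ∘ map weight) (filter-cong (λ S → all-cong G (All.map (λ {t} e → cong (λ x → count t S ℕ.≡ᵇ demand x) (≡.sym e)) (∈ᵇ-all G)))
            (sublists (inside (concatMap candidates us)))) ⟩
    covering (inside (concatMap candidates us)) δ₀
      ≈⟨ covering-sweep us δ₀ (λ _ e → e) us∈G us-up us∈G (upsFrom-distinct 0 (b ℕ.+ c)) ⟩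
    sweep us δ₀ ∎
    where
    us = upsFrom 0 (b ℕ.+ c)
    us∈G : All (λ t → t ∈ᵇ G ≡ true) us
    us∈G = subst (All (λ t → t ∈ᵇ G ≡ true)) ups-G (All-filter isUp (∈ᵇ-all G))
    us-up : All (λ t → isUp t ≡ true) us
    us-up = subst (All (λ t → isUp t ≡ true)) ups-G (filter-true isUp G)
    sum-cong : ∀ {f g : List Lozenge → Carrier} → (∀ S → f S ≈ g S) → ∀ Ss → sumR (map f Ss) ≈ sumR (map g Ss)
    sum-cong e []       = refl
    sum-cong e (S ∷ Ss) = +-cong (e S) (sum-cong e Ss)
    prod-cong : ∀ {f g : Lozenge → Carrier} → (∀ L → f L ≈ g L) → ∀ S → prodR (map f S) ≈ prodR (map g S)
    prod-cong e []      = refl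
    prod-cong e (L ∷ S) = *-cong (e L) (prod-cong e S)
    weights : (∃ λ j → (+ 0 , j) ∈ᵇ G ≡ true) ⊎ us ≡ [] → M q G ≈ covering (lozengesIn G) (λ _ → true)
    weights (inj₁ (j , ∈G)) = sum-cong (prod-cong agree) (tilings G)
      where
      top≡0 : topLine G ≡ + 0
      top≡0 = topLine-0 G (All.map (λ {t} e → ℤₚ.≮⇒≥ (nonnegative {proj₁ t} {proj₂ t} e)) (∈ᵇ-all G)) ∈G
      agree : ∀ L → wt q G L ≈ w₀ L
      agree (right , (r , j)) = pow-≡ (cong ℤ.∣_∣ (≡.trans (cong (λ t → r ℤ.+ + 1 ℤ.- t) top≡0) (ℤₚ.+-identityʳ (r ℤ.+ + 1))))
      agree (vert  , _)       = refl
      agree (left  , _)       = refl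
    -- Without up-pointing triangles there are no lozenges, so the weights never enter.
    weights (inj₂ empty) = reflexive (≡.trans (cong (λ Ss → sumR (map (λ S → prodR (map (wt q G) S)) (filter (isTiling G) (sublists Ss)))) none≡)
      (≡.trans (lemma (isTiling G [])) (cong (λ Ls → covering Ls (λ _ → true)) (≡.sym none≡))))
      where
      none≡ : lozengesIn G ≡ []
      none≡ = cong inside (≡.trans (candidates-ups isUp candidates G) (cong (concatMap candidates) (≡.trans ups-G empty)))
      lemma : ∀ x → sumR (map (λ S → prodR (map (wt q G) S)) (if x then [] ∷ [] else [])) ≡ sumR (map weight (if x then [] ∷ [] else []))
      lemma true  = ≡.refl
      lemma false = ≡.refl

-- The upper half, from ℓ up to the top side

module Sweep {ℓ₁ ℓ₂} (R : CommutativeRing ℓ₁ ℓ₂) (q : CommutativeRing.Carrier R)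
  (a b′ c : ℕ) {z} (X Y : Subset (suc b′ ℕ.+ a)) (ez : c ℕ.+ z ≡ suc b′ ℕ.+ a) (Y-empty : c ≡ 0 → Y ≡ ⊥) where
  open CommutativeRing R hiding (zero)
  open import Relation.Binary.Reasoning.Setoid setoid
  open Summands R q
  open Transfer R
  open Rows a (suc b′) c X Y
  open Assembly R q a (suc b′) c X Y
  open Strips R w₀ G (λ _ → refl) (λ _ → refl)

  b : ℕ
  b = suc b′

  total : Carrier
  total = ⟪ upperForm a b , glue X Y (lower z b c ez) ⟫

  Sweeps : ∀ s → Form (s ℕ.+ a) → Set _
  Sweeps s Ψ = ∀ m → s ℕ.+ m ≡ b ℕ.+ c → ∀ D δ → State s δ (ℤ.- + s ℤ.- + 1) →
    Reads (λ i → δ (+ s , i)) (ℤ.- + s ℤ.+ + 1) D → sweep (upsFrom s m) δ ≈ Ψ D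

  upper-step : ∀ s (lt : s ℕ.< b) (Xs Ys : Subset (suc s ℕ.+ a)) (Φ : Form (suc s ℕ.+ a)) v′ →
    Reads (λ i → kept (+ s , i)) (ℤ.- + s) Xs → Reads (λ i → (+ suc s , i) ∈ᵇ G) (ℤ.- + s) Ys →
    (∀ {i} → i ℤ.< v′ → (+ suc s , i) ∈ᵇ G ≡ false) →
    (∀ m → suc s ℕ.+ m ≡ b ℕ.+ c → ∀ out δ′ → State (suc s) δ′ v′ → Reads (λ i → δ′ (+ suc s , i)) (ℤ.- + s) out →
      sweep (upsFrom (suc s) m) δ′ ≈ Φ out) →
    ∃ λ Ψ → Sweeps s Ψ × ⟪ upperForm a s , Ψ ⟫ ≈ ⟪ upperForm a (suc s) , glue Xs Ys Φ ⟫
  upper-step s lt Xs Ys Φ v′ readsX readsY below cont =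
    (λ D → run (pow q (suc s)) false (D ∷ʳ true) (glue Xs Ys Φ)) , sweeps , run-fresh (pow q (suc s)) (upperForm a s) (glue Xs Ys Φ)
    where
    open Upper lt renaming (row to row₀)
    sweeps : Sweeps s _
    sweeps zero e D δ _ _ = ⊥-elim (ℕₚ.<⇒≢ inRegion (≡.trans (≡.sym (ℕₚ.+-identityʳ s)) e))
    sweeps (suc m) e D δ state@(sub , _) reads =
      row-step s m (ℤ.- + s) Xs Ys (D ∷ʳ true) Φ false v′ δ (ups Xs readsX) (reads-G Xs readsX) state
        (⇒false (sub _) (row-below {l = ℤ.- + s} row₀ inRegion (i-1<i (ℤ.- + s))))
        (Reads-∷ʳ _ _ D reads (⇒false (sub _) (row-end {l = ℤ.- + s} row₀ inRegion))) readsY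
        (λ e → ℤₚ.<-trans (proj₂ (row-bounds {l = ℤ.- + s} row₀ inRegion e)) (+1⊕<+2⊕ (ℤ.- + s) (s ℕ.+ a)))
        below (cont m (≡.trans (≡.sym (ℕₚ.+-suc s m)) e))
      where
      +1⊕<+2⊕ : ∀ j k → j ℤ.+ + 1 ⊕ k ℤ.< j ℤ.+ + 2 ⊕ k
      +1⊕<+2⊕ j k = subst₂ ℤ._<_ (≡.sym (⊕-+ (j ℤ.+ + 1) k)) (≡.sym (⊕-+ (j ℤ.+ + 2) k))
        (ℤₚ.+-monoˡ-< (+ (k ℕ.+ k)) (ℤₚ.+-monoʳ-< j (ℤ.+<+ ℕₚ.≤-refl)))

  Reachable : ℕ → Set _
  Reachable s = ∃ λ Ψ → Sweeps s Ψ × ⟪ upperForm a s , Ψ ⟫ ≈ total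

  reads-X : Reads (λ i → kept (+ b′ , i)) (ℤ.- + b′) X
  reads-X = Reads-intro _ _ X λ p → subst₂ (λ r j → kept (r , j ⊕ toℕ p) ≡ not (lookup X p)) (suc-1 b′) (start-suc b′) (kept-X p)

  lo≡ : lo b b ≡ ℤ.- + b′
  lo≡ = ≡.trans (≡.sym (start-lo b)) (start-suc b′)

  module _ {k} (c≡ : c ≡ suc k) where
    private
      ek : b ℕ.+ suc k ≡ b ℕ.+ c
      ek = cong (b ℕ.+_) (≡.sym c≡)
      module First = Lower {b} {k} {z} ez ℕₚ.≤-refl ek

    reads-Y : Reads (λ i → (+ b , i) ∈ᵇ G) (lo b b) Y
    reads-Y = Reads-intro _ _ Y λ p → ≡.trans
      (row-∈⊕ First.row First.inRegion (toℕ p) (ℕ.s≤s⁻¹ (subst (toℕ p ℕ.<_) (≡.trans (≡.sym ez) (cong (ℕ._+ z) c≡)) (Finₚ.toℕ<n p))))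
      (subst (λ j → kept (+ b , j ⊕ toℕ p) ≡ not (lookup Y p)) (start-lo b) (kept-Y p))

    middle-more : Reachable b′
    middle-more = upper-step b′ ℕₚ.≤-refl X Y (lower z b c ez) (lo b b) reads-X
                       (subst (λ j → Reads (λ i → (+ b , i) ∈ᵇ G) j Y) lo≡ reads-Y)
                       (row-below {l = lo b b} First.row First.inRegion) cont
      where
      cont : ∀ m → b ℕ.+ m ≡ b ℕ.+ c → ∀ out δ′ → State b δ′ (lo b b) → Reads (λ i → δ′ (+ b , i)) (ℤ.- + b′) out →
        sweep (upsFrom b m) δ′ ≈ lower z b c ez out
      cont m em out δ′ state reads = trans (reflexive (cong (λ t → sweep (upsFrom b t) δ′) (≡.trans (ℕₚ.+-cancelˡ-≡ b _ _ em) c≡)))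
        (trans (lower-sweep ez k b ℕₚ.≤-refl ek (≡.trans (cong (ℕ._+ z) (≡.sym c≡)) ez) out δ′ state
                 (subst (λ j → Reads (λ i → δ′ (+ b , i)) j out) (≡.sym lo≡) reads))
          (reflexive (same c≡ ez)))
        where
        same : ∀ {c n} (e : c ≡ suc k) (ez : c ℕ.+ z ≡ n) {U} →
          subst Form (≡.trans (cong (ℕ._+ z) (≡.sym e)) ez) (lowerForm z (suc b) (suc k)) U ≡ lower z b c ez U
        same ≡.refl ≡.refl = ≡.refl

  -- There is no strip below ℓ, so all down-pointing triangles on it are absent and Z must be empty.
  -- To the pairing this looks like Y = ∅ with `𝟙∅` as the lower form.
  middle-last : c ≡ 0 → Reachable b′
  middle-last c≡ with upper-step b′ ℕₚ.≤-refl X ⊤ (λ _ → 1#) (+ 0) reads-X (outside-reads b (ℤ.- + b′) end)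
                        (λ {i} _ → outside i (ℕₚ.≤-reflexive (≡.sym end))) cont
    where
    end : b ≡ b ℕ.+ c
    end = ≡.trans (≡.sym (ℕₚ.+-identityʳ b)) (cong (b ℕ.+_) (≡.sym c≡))
    cont : ∀ m → b ℕ.+ m ≡ b ℕ.+ c → ∀ out δ′ → State b δ′ (+ 0) → Reads (λ i → δ′ (+ b , i)) (ℤ.- + b′) out →
      sweep (upsFrom b m) δ′ ≈ 1#
    cont m em out δ′ state _ = trans (reflexive (cong (λ t → sweep (upsFrom b t) δ′) (≡.trans (ℕₚ.+-cancelˡ-≡ b _ _ em) c≡)))
      (State-end state end)
  ... | Ψ , sweeps , e = Ψ , sweeps , trans e (⟪⟫-cong {φ = upperForm a b} (λ _ → refl) λ U →
      trans (glue-⊤ X U) (trans (glue-cong X ⊥ (λ V → reflexive (same c≡ ez V)) U)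
        (reflexive (cong (λ T → glue X T (lower z b c ez) U) (≡.sym (Y-empty c≡))))))
    where
    𝟙∅-subst : ∀ {k n} (e : k ≡ n) V → 𝟙∅ V ≡ subst Form e 𝟙∅ V
    𝟙∅-subst ≡.refl V = ≡.refl
    same : ∀ {c n} (e : c ≡ 0) (ez : c ℕ.+ z ≡ n) V → 𝟙∅ V ≡ lower z b c ez V
    same ≡.refl ez V = 𝟙∅-subst ez V

  middle : Reachable b′
  middle = go c ≡.refl
    where
    go : ∀ k → c ≡ k → Reachable b′
    go zero    e = middle-last e
    go (suc k) e = middle-more e

  climb : ∀ s → suc s ℕ.< b → Reachable (suc s) → Reachable s
  climb s lt (Ψ , sweeps , e) with upper-step s (ℕₚ.<-trans ℕₚ.≤-refl lt) ⊥ ⊥ Ψ (ℤ.- + suc s)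
      (Upper.reads-kept (ℕₚ.<-trans ℕₚ.≤-refl lt) (ℕₚ.<⇒≢ lt)) (upper-next lt)
      (row-below {l = ℤ.- + suc s} (Upper.row lt) (Upper.inRegion lt)) cont
    where
    smaller : ∀ {δ′} → State (suc s) δ′ (ℤ.- + suc s) → State (suc s) δ′ (ℤ.- + suc s ℤ.- + 1)
    smaller (sub , done , far) = sub , (λ { r i ∈G (inj₁ lt) → done r i ∈G (inj₁ lt)
                                          ; r i ∈G (inj₂ (e , lt)) → done r i ∈G (inj₂ (e , ℤₚ.<-trans lt (i-1<i _))) }) , far
    cont : ∀ m → suc s ℕ.+ m ≡ b ℕ.+ c → ∀ out δ′ → State (suc s) δ′ (ℤ.- + suc s) →
      Reads (λ i → δ′ (+ suc s , i)) (ℤ.- + s) out → sweep (upsFrom (suc s) m) δ′ ≈ Ψ out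
    cont m em out δ′ state reads = sweeps m em out δ′ (smaller state)
      (subst (λ j → Reads (λ i → δ′ (+ suc s , i)) j out)
        (≡.trans (≡.sym (i-1+1 (ℤ.- + s))) (cong (ℤ._+ + 1) (≡.sym (neg-suc s)))) reads)
  ... | Ψ′ , sweeps′ , e′ = Ψ′ , sweeps′ , trans e′ (trans (⟪⟫-cong {φ = upperForm a (suc s)} (λ _ → refl) (glue-⊥ Ψ)) e)

  reachable : ∀ k s → s ℕ.+ k ≡ b′ → Reachable s
  reachable zero    s e = subst Reachable (≡.trans (≡.sym e) (ℕₚ.+-identityʳ s)) middle
  reachable (suc k) s e = climb s (ℕ.s≤s (subst (s ℕ.<_) e (ℕₚ.m<m+n s (ℕ.s≤s ℕ.z≤n))))
    (reachable k (suc s) (≡.trans (≡.sym (ℕₚ.+-suc s k)) e))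

  reads-top : Reads (λ i → (+ 0 , i) ∈ᵇ G) (+ 1) (⊥ {a})
  reads-top = Reads-intro _ _ ⊥ λ p → ≡.trans
    (row-∈ {l = + 0} (Upper.row (ℕ.s≤s ℕ.z≤n)) (ℕ.s≤s ℕ.z≤n) (suc (toℕ p ℕ.+ toℕ p))
      (ℕₚ.≤-trans (ℕₚ.n≤1+n _) (ℕₚ.≤-trans (ℕₚ.≤-reflexive (cong suc (≡.sym (ℕₚ.+-suc (toℕ p) (toℕ p)))))
        (ℕₚ.≤-trans (ℕₚ.+-mono-≤ (Finₚ.toℕ<n p) (Finₚ.toℕ<n p)) (ℕₚ.≤-reflexive (≡.sym (double-+ a))))))
      (⊕-+ (+ 1) (toℕ p)))
    (≡.trans (kept-down _ (λ ()) (isUp-⊕ (+ 0) (+ 1) (toℕ p))) (cong not (≡.sym (lookup-⊥ p))))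

  sweep-total : sweep (upsFrom 0 (b ℕ.+ c)) δ₀ ≈ total
  sweep-total with reachable b′ 0 ≡.refl
  -- No down-pointing triangle of strip 0 is missing, so the initial set is `⊥`, and pairing with
  -- `𝟙∅` evaluates Ψ there.
  ... | Ψ , sweeps , e = trans (sweeps (b ℕ.+ c) ≡.refl ⊥ δ₀
      (δ₀-state -[1+ 0 ] (λ lt → row-below {l = + 0} (Upper.row (ℕ.s≤s ℕ.z≤n)) (ℕ.s≤s ℕ.z≤n) (ℤₚ.<-trans lt ℤ.-<+))) reads-top)
    (trans (sym (⟪𝟙∅⟫ Ψ)) e)

-- Weights are counted from the top line of the region, which is line 0 unless no up-pointing triangle is left.
top-or-empty : ∀ a b c z {n} (X Y : Subset n) → b ℕ.+ a ≡ n → c ℕ.+ z ≡ n →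
  let open Rows a b c X Y in (∃ λ j → (+ 0 , j) ∈ᵇ G ≡ true) ⊎ upsFrom 0 (b ℕ.+ c) ≡ []
top-or-empty (suc a) (suc b) c z X Y ≡.refl ez = inj₁ (+ 1 ,
  ≡.trans (row-∈ {l = + 0} (Upper.row (ℕ.s≤s ℕ.z≤n)) (ℕ.s≤s ℕ.z≤n) 1 (ℕ.s≤s ℕ.z≤n) ≡.refl) (kept-down (+ 1) (λ ()) ≡.refl))
  where open Rows (suc a) (suc b) c X Y
-- Strip 0 is a single up-pointing triangle; its base is not on ℓ, so it cannot be removed.
top-or-empty zero (suc (suc b)) c z X Y ≡.refl ez = inj₁ (+ 0 ,
  ≡.trans (row-∈ {l = + 0} (Upper.row (ℕ.s≤s ℕ.z≤n)) (ℕ.s≤s ℕ.z≤n) 0 ℕ.z≤n ≡.refl) (kept-up (+ 0) (λ ()) ≡.refl))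
  where open Rows 0 (suc (suc b)) c X Y
top-or-empty zero (suc zero) c z (false ∷ []) Y ≡.refl ez = inj₁ (+ 0 ,
  ≡.trans (row-∈ {l = + 0} (Upper.row (ℕ.s≤s ℕ.z≤n)) (ℕ.s≤s ℕ.z≤n) 0 ℕ.z≤n ≡.refl) (kept-X zero))
  where open Rows 0 1 c (false ∷ []) Y
-- The only up-pointing triangle of strip 0 is removed. As c is at most 1, what lies below ℓ is at
-- most one down-pointing triangle.
top-or-empty zero (suc zero) zero z X@(true ∷ []) Y ≡.refl ez =
  inj₂ (cong (_++ []) (Upper.ups (ℕ.s≤s ℕ.z≤n) X (kept-X zero , _)))
  where open Rows 0 1 0 X Y
top-or-empty zero (suc zero) (suc zero) zero X@(true ∷ []) Y ≡.refl ez =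
  inj₂ (cong₂ (λ us vs → us ++ vs ++ []) (Upper.ups (ℕ.s≤s ℕ.z≤n) X (kept-X zero , _)) (Lower.ups {k = 0} {0} ez ℕₚ.≤-refl ≡.refl))
  where open Rows 0 1 1 X Y
-- For b = 0 the removed up-pointing triangles would lie in strip -1. So strip 0 keeps its own, the
-- first of them at j = 2, and has none only if it is absent or a single down-pointing triangle.
top-or-empty a zero zero z X Y ≡.refl ez = inj₂ ≡.refl
top-or-empty a zero (suc zero) zero X Y ≡.refl ez = inj₂ (cong (_++ []) (Lower.ups {s = 0} {0} {0} ez ℕ.z≤n ≡.refl))
  where open Rows a 0 1 X Y
top-or-empty a zero (suc zero) (suc z) X Y ≡.refl ez = inj₁ (+ 2 ,
  ≡.trans (row-∈ {l = + 1} (Lower.row {k = 0} {suc z} ez ℕ.z≤n ≡.refl) (ℕ.s≤s ℕ.z≤n) 1 (ℕ.s≤s ℕ.z≤n) ≡.refl) (kept-up (+ 2) (λ ()) ≡.refl))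
  where open Rows a 0 1 X Y
top-or-empty a zero (suc (suc k)) z X Y ≡.refl ez = inj₁ (+ 2 ,
  ≡.trans (row-∈ {l = + 1} (Lower.row {k = suc k} {z} ez ℕ.z≤n ≡.refl) (ℕ.s≤s ℕ.z≤n) 1 (ℕ.s≤s ℕ.z≤n) ≡.refl) (kept-up (+ 2) (λ ()) ≡.refl))
  where open Rows a 0 (suc (suc k)) X Y

size-zero : ∀ {n} (X : Subset n) → size X ≡ 0 → X ≡ ⊥
size-zero []          e = ≡.refl
size-zero (false ∷ X) e = cong (false ∷_) (size-zero X e)

module Reduction {ℓ₁ ℓ₂} (R : CommutativeRing ℓ₁ ℓ₂) (q : CommutativeRing.Carrier R) where
  open CommutativeRing R hiding (zero)
  open Summands R q
  open Transfer R

  -- An empty half must have no dents: a label in X for b = 0, or in Y for c = 0, would name a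
  -- triangle outside the hexagon, which the pairing would nevertheless count as missing.
  M-pairing : ∀ a b c z {n} (eqU : b ℕ.+ a ≡ n) (eqL : c ℕ.+ z ≡ n) (X Y : Subset n) → (b ≡ 0 → X ≡ ⊥) → (c ≡ 0 → Y ≡ ⊥) →
    M q (V a b c (labels X) (labels Y)) ≈ ⟪ upper a b eqU , glue X Y (lower z b c eqL) ⟫
  M-pairing a (suc b) c z ≡.refl eqL X Y _ Y-empty = trans
    (Assembly.M-sweep R q a (suc b) c X Y (top-or-empty a (suc b) c z X Y ≡.refl eqL))
    (Sweep.sweep-total R q a b c X Y eqL Y-empty)
  -- No strip lies above ℓ. The sweep starts directly in the lower half with dents Y, and pairing
  -- with `𝟙∅` picks the same value.
  M-pairing a zero c z ≡.refl eqL X Y X-empty Y-empty = trans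
    (Assembly.M-sweep R q a 0 c X Y (top-or-empty a 0 c z X Y ≡.refl eqL))
    (trans (below c eqL Y-empty) (sym (trans (⟪𝟙∅⟫ (glue X Y (lower z 0 c eqL)))
      (trans (reflexive (cong (λ T → glue T Y (lower z 0 c eqL) ⊥) (X-empty ≡.refl))) (glue-at-⊥ Y (lower z 0 c eqL))))))
    where
    𝟙∅-⊥ : ∀ {k n} (e : k ≡ n) → subst Form e 𝟙∅ ⊥ ≈ 1#
    𝟙∅-⊥ {zero}  ≡.refl = refl
    𝟙∅-⊥ {suc k} ≡.refl = 𝟙∅-⊥ {k} ≡.refl
    below : ∀ c (eqL : c ℕ.+ z ≡ a) → (c ≡ 0 → Y ≡ ⊥) → let open Rows a 0 c X Y in
      Cover.sweep R (Assembly.w₀ R q a 0 c X Y) G (upsFrom 0 c) (_∈ᵇ G) ≈ lower z 0 c eqL Y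
    below zero eqL Y-empty = trans (State-end (δ₀-state (+ 0) (λ {i} _ → outside {0} i ℕ.z≤n)) ≡.refl)
      (sym (trans (reflexive (cong (lower z 0 0 eqL) (Y-empty ≡.refl))) (𝟙∅-⊥ eqL)))
      where
      open Assembly R q a 0 0 X Y
      open Rows a 0 0 X Y
    below (suc k) eqL _ = lower-sweep eqL k 0 ℕ.z≤n ≡.refl eqL Y δ₀
      (δ₀-state (+ 1) (row-below {l = + 1} First.row (ℕ.s≤s ℕ.z≤n)))
      (Reads-intro _ _ Y λ p → ≡.trans
        (row-∈⊕ First.row (ℕ.s≤s ℕ.z≤n) (toℕ p) (ℕ.s≤s⁻¹ (subst (toℕ p ℕ.<_) (≡.sym eqL) (Finₚ.toℕ<n p)))) (kept-Y p))
      where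
      open Assembly R q a 0 (suc k) X Y
      open Rows a 0 (suc k) X Y
      module First = Lower {0} {k} {z} eqL ℕ.z≤n ≡.refl

-- The quotient, with denominators cleared

open import Data.Nat using (_+_; _≤_)
open import Data.Fin.Subset using (∁; ∣_∣)

theorem4p1 : ∀ {ℓ₁ ℓ₂} (R : CommutativeRing ℓ₁ ℓ₂) (q : CommutativeRing.Carrier R)
    (n a b c a′ b′ c′ m : ℕ) (X Y : Subset n) (X′ Y′ : Subset n) →
    X ∪ Y ≡ X′ ∪ Y′ → X ∩ Y ≡ X′ ∩ Y′ →
    a + b ≡ n → a′ + b′ ≡ n → b + c ≡ b′ + c′ →
    c ≤ a + b → c′ ≤ a′ + b′ →
    ∣ X ∣ + m ≡ b → ∣ Y ∣ + m ≡ c → ∣ X′ ∣ + m ≡ b′ → ∣ Y′ ∣ + m ≡ c′ →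
    m ≤ ∣ ∁ (X ∪ Y) ∣ →
    let open CommutativeRing R hiding (_+_)
        open RingDefs R
        LX = labels X
        LY = labels Y
        LX′ = labels X′
        LY′ = labels Y′
    in M q (V a′ b′ c′ LX′ LY′)
         * (Δ q (range1 b′) * Δ q (range1 c′) * Δ q LX * Δ q LY)
         * pow q (expP a b c LX LY + expN a′ b′ c′ LX′ LY′)
       ≈ M q (V a b c LX LY)
         * (Δ q (range1 b) * Δ q (range1 c) * Δ q LX′ * Δ q LY′)
         * pow q (expP a′ b′ c′ LX′ LY′ + expN a b c LX LY)
theorem4p1 R q n a b c a′ b′ c′ m X Y X′ Y′ e∪ e∩ ab ab′ bc c≤ c′≤ sX sY sX′ sY′ _ = begin
  M q (V a′ b′ c′ (labels X′) (labels Y′)) * D′ * pow q (expP a b c (labels X) (labels Y) + expN a′ b′ c′ (labels X′) (labels Y′))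
    ≈⟨ rearrange a′ b′ c′ b c X′ Y′ X Y (cong₂ _+_ (expP≡ n a b c X (labels Y) ab) (expN≡ a′ b′ c′ (labels X′) Y′)) ⟩
  constant b′ c′ b c X′ Y′ X Y * M q (V a′ b′ c′ (labels X′) (labels Y′))
    ≈⟨ *-congˡ (M-pairing a′ b′ c′ (n ∸ c′) (flip a′ b′ ab′) (rest a′ b′ c′ ab′ c′≤) X′ Y′ (empty X′ sX′) (empty Y′ sY′)) ⟩
  constant b′ c′ b c X′ Y′ X Y * ⟪ upper a′ b′ (flip a′ b′ ab′) , glue X′ Y′ (lower (n ∸ c′) b′ c′ (rest a′ b′ c′ ab′ c′≤)) ⟫
    ≈⟨ sym (pairing-shuffle X Y X′ Y′ e∪ e∩ _ _ _ _ _ _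
         (summand-shuffle a b c (n ∸ c) a′ b′ c′ (n ∸ c′) m (flip a b ab) (rest a b c ab c≤) (flip a′ b′ ab′) (rest a′ b′ c′ ab′ c′≤)
           X Y X′ Y′ bc sX sY sX′ sY′)) ⟩
  constant b c b′ c′ X Y X′ Y′ * ⟪ upper a b (flip a b ab) , glue X Y (lower (n ∸ c) b c (rest a b c ab c≤)) ⟫
    ≈⟨ *-congˡ (sym (M-pairing a b c (n ∸ c) (flip a b ab) (rest a b c ab c≤) X Y (empty X sX) (empty Y sY))) ⟩
  constant b c b′ c′ X Y X′ Y′ * M q (V a b c (labels X) (labels Y))
    ≈⟨ sym (rearrange a b c b′ c′ X Y X′ Y′ (cong₂ _+_ (expP≡ n a′ b′ c′ X′ (labels Y′) ab′) (expN≡ a b c (labels X) Y))) ⟩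
  M q (V a b c (labels X) (labels Y)) * D * pow q (expP a′ b′ c′ (labels X′) (labels Y′) + expN a b c (labels X) (labels Y)) ∎
  where
  open CommutativeRing R hiding (_+_; zero)
  open Summands R q
  open Reduction R q
  open Transfer R
  open import Relation.Binary.Reasoning.Setoid setoid
  D  = Δ q (range1 b) * Δ q (range1 c) * Δ q (labels X′) * Δ q (labels Y′)
  D′ = Δ q (range1 b′) * Δ q (range1 c′) * Δ q (labels X) * Δ q (labels Y)
  flip : ∀ a b → a + b ≡ n → b + a ≡ n
  flip a b e = ≡.trans (ℕₚ.+-comm b a) e
  rest : ∀ a b c → a + b ≡ n → c ≤ a + b → c + (n ∸ c) ≡ n
  rest a b c e le = ℕₚ.m+[n∸m]≡n (subst (c ≤_) e le)
  -- A set of dents has at most as many elements as its half has strips.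
  empty : ∀ (A : Subset n) {k} → ∣ A ∣ + m ≡ k → k ≡ 0 → A ≡ ⊥
  empty A e ≡.refl = size-zero A (ℕₚ.m+n≡0⇒m≡0 ∣ A ∣ e)
  rearrange : ∀ a b c b′ c′ (X Y X′ Y′ : Subset n) {e} → e ≡ expP′ b′ c′ X′ + (b ℕ.* choose₂ c + expN′ b c Y) →
    M q (V a b c (labels X) (labels Y)) * (Δ q (range1 b) * Δ q (range1 c) * Δ q (labels X′) * Δ q (labels Y′)) * pow q e
      ≈ constant b c b′ c′ X Y X′ Y′ * M q (V a b c (labels X) (labels Y))
  rearrange a b c b′ c′ X Y X′ Y′ ≡.refl = trans (*-assoc _ _ _) (*-comm _ _)
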